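{- Let $G$ be an $\{\mathrm{ISK4},\mathrm{wheel}\}$-free trigraph. Then at least one of the following holds: $G$ is a series-parallel trigraph; $G$ is a thick complete bipartite trigraph; $G$ is a line trigraph of a cyclically 3-connected, chordless graph of maximum degree at most three; $G$ admits a clique-cutset; $G$ admits a stable 2-cutset.
   Context: A trigraph $G$ is a finite set $V(G)$ together with a function $\theta_G$ from the 2-element subsets of $V(G)$ to $\{ -1,0,1\}$. For distinct $u,v$: strongly adjacent if $\theta_G(uv)=1$, semi-adjacent if $0$, strongly anti-adjacent if $-1$; adjacent if $\theta_G(uv)\ge0$, anti-adjacent if $\theta_G(uv)\le0$. A graph is a trigraph with no semi-adjacent pairs. A realization of $G$ is a graph obtained by turning each semi-adjacent pair into an edge or a non-edge; the full realization turns all of them into edges. $G[X]$ is the induced subtrigraph on $X$, $G\setminus X=G[V(G)\setminus X]$. $G$ is $\{\mathrm{ISK4},\mathrm{wheel}\}$-free if no realization of $G$ has an induced subgraph isomorphic to a subdivision of $K_4$ or to a wheel (a chordless cycle plus a vertex with at least three neighbors on it). $G$ is connected if its full realization is. A cutset is a (possibly empty) set $C$ with $G\setminus C$ disconnected; a clique-cutset is a cutset that is a strong clique (pairwise strongly adjacent); a stable 2-cutset is a cutset that is a stable set (pairwise anti-adjacent) of size two. $G$ is series-parallel if its full realization contains no subdivision of $K_4$ as a subgraph. A complete bipartite trigraph is one whose vertex set partitions into two strongly stable sets (pairwise strongly anti-adjacent) strongly complete to each other; it is thick if both sets have at least three vertices. A line trigraph of a graph $H$ is a trigraph whose full realization is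 isomorphic to the line graph of $H$ and all of whose triangles (three pairwise adjacent vertices) are strong. A graph is chordless if all its cycles are induced. A separation of a graph $H$ is a pair $(A,B)$ with $A\cup B=V(H)$ and no edges between $A\setminus B$ and $B\setminus A$; it is a 2-separation if $|A\cap B|\le2$ and cyclic if both $H[A]$ and $H[B]$ contain cycles. $H$ is cyclically 3-connected if it is 2-connected, is not a cycle, and admits no cyclic 2-separation. -}

module Defs where

open import Data.Nat using (ℕ; zero; suc; _≤_; _∸_; _≡ᵇ_)
open import Data.Fin using (Fin; zero; suc; toℕ; _≟_)
open import Data.Bool using (Bool; true; false; _∧_; _∨_; not)
open import Data.List using (length; filterᵇ)
open import Data.List using (List)
open import Data.Fin using () renaming (Fin to F)
open import Data.List.Base using ()
open import Data.Product using (Σ; ∃; ∃-syntax; _×_; _,_; proj₁; proj₂)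
open import Data.Sum using (_⊎_)
open import Relation.Binary.PropositionalEquality using (_≡_; _≢_)
open import Relation.Nullary using (¬_)
open import Relation.Nullary.Decidable using (⌊_⌋)
open import Function.Definitions using (Injective)
import Data.List as L

allFin : (n : ℕ) → List (Fin n)
allFin n = Data.List.tabulate (λ i → i)
  where import Data.List

count : {k : ℕ} → (Fin k → Bool) → ℕ
count {k} p = length (filterᵇ p (allFin k))

_==_ : {n : ℕ} → Fin n → Fin n → Bool
x == y = ⌊ x ≟ y ⌋

InjectiveFn : {a b : ℕ} → (Fin a → Fin b) → Set
InjectiveFn f = Injective _≡_ _≡_ f

Adj : ℕ → Set
Adj n = Fin n → Fin n → Bool

IsGraph : {n : ℕ} → Adj n → Set
IsGraph {n} H = (∀ x y → H x y ≡ H y x) × (∀ x → H x x ≡ false)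

next : (k : ℕ) → Fin k → Fin k → Bool
next k i j = (suc (toℕ i) ≡ᵇ toℕ j) ∨ ((suc (toℕ i) ≡ᵇ k) ∧ (toℕ j ≡ᵇ 0))

cycAdj : (k : ℕ) → Adj k
cycAdj k i j = next k i j ∨ next k j i

-- A ≅ B via a bijection σ (injective self-map of Fin n)
Iso : {n : ℕ} → Adj n → Adj n → Set
Iso {n} A B = Σ (Fin n → Fin n) λ σ → InjectiveFn σ × (∀ x y → A x y ≡ B (σ x) (σ y))

K4 : Adj 4
K4 i j = not (i == j)

subdivide : {n : ℕ} → Adj n → Fin n → Fin n → Adj (suc n)
subdivide A u v zero zero = false
subdivide A u v zero (suc y) = (y == u) ∨ (y == v)
subdivide A u v (suc x) zero = (x == u) ∨ (x == v)
subdivide A u v (suc x) (suc y) =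
  A x y ∧ not (((x == u) ∧ (y == v)) ∨ ((x == v) ∧ (y == u)))

data SubdivK4 : (k : ℕ) → Adj k → Set where
  base : (H : Adj 4) → Iso K4 H → SubdivK4 4 H
  step : {k : ℕ} {H : Adj k} {H' : Adj (suc k)} → SubdivK4 k H →
         (u v : Fin k) → H u v ≡ true → Iso (subdivide H u v) H' →
         SubdivK4 (suc k) H'

HasISK4 : {n : ℕ} → Adj n → Set
HasISK4 {n} R = Σ ℕ λ k → Σ (Adj k) λ H → SubdivK4 k H ×
  Σ (Fin k → Fin n) λ f → InjectiveFn f × (∀ i j → R (f i) (f j) ≡ H i j)

HasSubdivK4Subgraph : {n : ℕ} → Adj n → Set
HasSubdivK4Subgraph {n} R = Σ ℕ λ k → Σ (Adj k) λ H → SubdivK4 k H ×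
  Σ (Fin k → Fin n) λ f → InjectiveFn f × (∀ i j → H i j ≡ true → R (f i) (f j) ≡ true)

HasWheel : {n : ℕ} → Adj n → Set
HasWheel {n} R = Σ ℕ λ k → 4 ≤ k × Σ (Fin k → Fin n) λ c → InjectiveFn c ×
  (∀ i j → R (c i) (c j) ≡ cycAdj k i j) ×
  Σ (Fin n) λ x → (∀ i → c i ≢ x) × 3 ≤ count (λ i → R x (c i))

data Reach {n : ℕ} (H : Adj n) (X : Fin n → Bool) (a : Fin n) : Fin n → Set where
  here : X a ≡ true → Reach H X a a
  step : {b c : Fin n} → Reach H X a b → X c ≡ true → H b c ≡ true → Reach H X a c

ConnectedOn : {n : ℕ} → Adj n → (Fin n → Bool) → Set
ConnectedOn {n} H X = ∀ a b → X a ≡ true → X b ≡ true → Reach H X a b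

DisconnectedOn : {n : ℕ} → Adj n → (Fin n → Bool) → Set
DisconnectedOn {n} H X = Σ (Fin n) λ a → Σ (Fin n) λ b →
  X a ≡ true × X b ≡ true × ¬ Reach H X a b

-- θ values: -1 (strongly anti-adjacent), 0 (semi-adjacent), 1 (strongly adjacent)
data Tri : Set where
  anti semi strong : Tri

record Trigraph (n : ℕ) : Set where
  field
    θ : Fin n → Fin n → Tri          -- values on the diagonal are irrelevant
    θ-sym : ∀ u v → θ u v ≡ θ v u
open Trigraph public

isAdjᵇ : Tri → Bool
isAdjᵇ anti = false
isAdjᵇ semi = true
isAdjᵇ strong = true

full : {n : ℕ} → Trigraph n → Adj n
full G u v = not (u == v) ∧ isAdjᵇ (θ G u v)

IsRealization : {n : ℕ} → Trigraph n → Adj n → Set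
IsRealization {n} G R = IsGraph R ×
  (∀ u v → u ≢ v → θ G u v ≡ strong → R u v ≡ true) ×
  (∀ u v → u ≢ v → θ G u v ≡ anti → R u v ≡ false)

ISK4WheelFree : {n : ℕ} → Trigraph n → Set
ISK4WheelFree {n} G = ∀ (R : Adj n) → IsRealization G R → ¬ HasISK4 R × ¬ HasWheel R

SeriesParallel : {n : ℕ} → Trigraph n → Set
SeriesParallel G = ¬ HasSubdivK4Subgraph (full G)

compl : {n : ℕ} → (Fin n → Bool) → (Fin n → Bool)
compl X x = not (X x)

IsCutset : {n : ℕ} → Trigraph n → (Fin n → Bool) → Set
IsCutset G C = DisconnectedOn (full G) (compl C)

HasCliqueCutset : {n : ℕ} → Trigraph n → Set
HasCliqueCutset {n} G = Σ (Fin n → Bool) λ C →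
  (∀ u v → C u ≡ true → C v ≡ true → u ≢ v → θ G u v ≡ strong) × IsCutset G C

HasStable2Cutset : {n : ℕ} → Trigraph n → Set
HasStable2Cutset {n} G = Σ (Fin n) λ a → Σ (Fin n) λ b →
  a ≢ b × θ G a b ≢ strong × IsCutset G (λ x → (x == a) ∨ (x == b))

ThickCompleteBipartite : {n : ℕ} → Trigraph n → Set
ThickCompleteBipartite {n} G = Σ (Fin n → Bool) λ A →
  (∀ u v → u ≢ v → A u ≡ A v → θ G u v ≡ anti) ×
  (∀ u v → A u ≡ true → A v ≡ false → θ G u v ≡ strong) ×
  3 ≤ count A × 3 ≤ count (compl A)

HasCycleIn : {m : ℕ} → Adj m → (Fin m → Bool) → Set
HasCycleIn {m} H X = Σ ℕ λ k → 3 ≤ k × Σ (Fin k → Fin m) λ c → InjectiveFn c ×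
  (∀ i → X (c i) ≡ true) × (∀ i j → cycAdj k i j ≡ true → H (c i) (c j) ≡ true)

Chordless : {m : ℕ} → Adj m → Set
Chordless {m} H = ∀ (k : ℕ) → 3 ≤ k → (c : Fin k → Fin m) → InjectiveFn c →
  (∀ i j → cycAdj k i j ≡ true → H (c i) (c j) ≡ true) →
  ∀ i j → H (c i) (c j) ≡ true → cycAdj k i j ≡ true

MaxDegreeAtMost3 : {m : ℕ} → Adj m → Set
MaxDegreeAtMost3 {m} H = ∀ x → count (H x) ≤ 3

IsCycle : {m : ℕ} → Adj m → Set
IsCycle {m} H = Iso (cycAdj m) H

all : {m : ℕ} → Fin m → Bool
all _ = true

TwoConnected : {m : ℕ} → Adj m → Set
TwoConnected {m} H = 3 ≤ m × ConnectedOn H all × (∀ x → ConnectedOn H (λ y → not (y == x)))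

CyclicTwoSeparation : {m : ℕ} → Adj m → (Fin m → Bool) → (Fin m → Bool) → Set
CyclicTwoSeparation {m} H A B =
  (∀ x → (A x ∨ B x) ≡ true) ×
  (∀ x y → (A x ∧ not (B x)) ≡ true → (B y ∧ not (A y)) ≡ true → H x y ≡ false) ×
  count (λ x → A x ∧ B x) ≤ 2 ×
  HasCycleIn H A × HasCycleIn H B

CyclicallyThreeConnected : {m : ℕ} → Adj m → Set
CyclicallyThreeConnected {m} H = TwoConnected H × ¬ IsCycle H ×
  (∀ A B → ¬ CyclicTwoSeparation H A B)

SameEdge : {m : ℕ} → Fin m × Fin m → Fin m × Fin m → Set
SameEdge (a , b) (c , d) = (a ≡ c × b ≡ d) ⊎ (a ≡ d × b ≡ c)

meetᵇ : {m : ℕ} → Fin m × Fin m → Fin m × Fin m → Bool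
meetᵇ (a , b) (c , d) = (a == c) ∨ (a == d) ∨ (b == c) ∨ (b == d)

-- G is a line trigraph of H: via e (vertex of G ↦ its edge of H, as endpoint pair)
-- the full realization of G is isomorphic to L(H), and all triangles of G are strong
IsLineTrigraphOf : {n m : ℕ} → Trigraph n → Adj m → Set
IsLineTrigraphOf {n} {m} G H =
  (Σ (Fin n → Fin m × Fin m) λ e →
     (∀ v → H (proj₁ (e v)) (proj₂ (e v)) ≡ true) ×
     (∀ u v → SameEdge (e u) (e v) → u ≡ v) ×
     (∀ x y → H x y ≡ true → Σ (Fin n) λ v → SameEdge (e v) (x , y)) ×
     (∀ u v → u ≢ v → full G u v ≡ meetᵇ (e u) (e v))) ×
  (∀ u v w → full G u v ≡ true → full G v w ≡ true → full G u w ≡ true →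
     θ G u v ≡ strong × θ G v w ≡ strong × θ G u w ≡ strong)

LineTrigraphOfC3CChordlessDeg3 : {n : ℕ} → Trigraph n → Set
LineTrigraphOfC3CChordlessDeg3 G = Σ ℕ λ m → Σ (Adj m) λ H →
  IsGraph H × CyclicallyThreeConnected H × Chordless H × MaxDegreeAtMost3 H ×
  IsLineTrigraphOf G H

{-# OPTIONS --safe #-}

-- The heart of the matter is that in an {ISK4, wheel}-free graph no connected set disjoint from a hole Q attaches to Q
-- at exactly three vertices.  Consequently a set that attaches to at least three vertices attaches to a fourth one, and
-- then, unless there is an induced K₃,₃, it contains a path whose two ends each see two adjacent vertices of Q.
--
-- Let R be the full realization, with at least four vertices.  A cutset of R with at most two vertices is a clique-cutset
-- or a stable 2-cutset, so let R be 3-connected.  Then every edge of R lies in at most one triangle.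
--   * If R contains K₃,₃, every connected set outside the maximal complete bipartite graph around it attaches to at most
--     one vertex of each side, so by 3-connectivity there is nothing outside.
--   * Otherwise all triangles are strong: were the edge ab of a triangle abc semi-adjacent, deleting it would create a
--     hole through a, c, b, and the main lemma would give a second triangle on ac or bc.  If no triangle is a cutset,
--     R has no claw: a claw at v gives a hole Q through v and a third neighbour c of v, the main lemma gives a triangle
--     vzt with z on Q and t off Q, and leaving c without crossing vzt yields a set with exactly three attachments or a
--     second triangle on vz.  So each vertex lies in exactly two maximal cliques, and R is the line graph of the
--     intersection graph of its maximal cliques.
module Submission where

open import Defs hiding (all)
open import Data.Nat using (ℕ; zero; suc; _≤_; _<_; z≤n; s≤s; _+_; _≡ᵇ_)
open import Data.Fin using (Fin; zero; suc; toℕ; fromℕ; fromℕ<; inject₁; inject≤) renaming (_<_ to _<ᶠ_; _≤_ to _≤ᶠ_)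
open import Data.Bool using (Bool; true; false; _∧_; _∨_; not; T)
open import Data.List using (List; []; _∷_; _++_; [_]; reverse; length; lookup; _ʳ++_; filter; filterᵇ; tabulate; cartesianProduct)
open import Data.List.Membership.Propositional using (_∈_; _∉_)
open import Data.List.Membership.Propositional.Properties using (∈-++⁺ˡ; ∈-++⁺ʳ; ∈-++⁻; ∈-∃++; ∈-lookup; ∈-tabulate⁺; ∈-tabulate⁻; ∈-filter⁺; ∈-filter⁻; ∈-cartesianProduct⁺)
open import Data.List.Relation.Unary.Any using (Any; here; there)
open import Data.List.Relation.Unary.All using (All; []; _∷_)
open import Data.List.Relation.Unary.AllPairs using (AllPairs; []; _∷_)
open import Data.List.Relation.Unary.Unique.Propositional using (Unique)
open import Data.List.Relation.Binary.Permutation.Propositional using (_↭_; ↭-sym; ↭-trans; ↭-refl; ↭⇒↭ₛ)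
open import Data.Product using (Σ; ∃; _×_; _,_; proj₁; proj₂)
open import Data.Sum using (_⊎_; inj₁; inj₂; [_,_]′; swap)
open import Data.Unit using (⊤; tt)
open import Data.Empty using (⊥; ⊥-elim)
open import Relation.Nullary using (¬_; Dec; yes; no)
open import Relation.Nullary.Decidable using (_×-dec_; _⊎-dec_; _→-dec_; ¬?; ⌊_⌋)
open import Relation.Unary using (Decidable)
open import Relation.Binary.Definitions using (tri<; tri≈; tri>)
open import Relation.Binary.PropositionalEquality using (_≡_; _≢_; refl; sym; trans; cong; cong₂; ≢-sym; subst; subst₂; setoid)
import Algebra.Solver.CommutativeMonoid as CMSolver
import Data.Nat.Properties as ℕ
import Data.Fin.Properties as F
import Data.Bool.Properties as B
import Data.List.Properties as L
import Data.List.Relation.Unary.Any as Any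
import Data.List.Relation.Unary.Any.Properties as AnyP
import Data.List.Relation.Unary.All as All
import Data.List.Relation.Unary.Unique.Propositional.Properties as U
import Data.List.Relation.Binary.Permutation.Propositional.Properties as Perm
import Data.List.Relation.Binary.Permutation.Setoid.Properties as PermS

-- Lists, induced paths and holes

-- Why three attachments are fatal: inside a connected set attached at x, y, z there is either a
-- smaller such set or one of three shapes, namely a path, a tree with one branch vertex, or a
-- triangle with three tails. A tree forms with the hole an induced subdivision of K₄ in which the
-- hole is the subdivided triangle. In the remaining cases the hole is rerouted through the attached
-- set, and the rerouted hole carries such a subdivision or is the rim of a wheel. A single vertex
-- off a hole sees at most two of its vertices, since three would make a wheel. So a set that grows
-- vertex by vertex and may not stop at three attachments has to jump from two to four, by a vertex
-- with exactly two new neighbours; this is the origin of the paths with two neighbours on the hole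
-- at each end. The trigraph enters through two kinds of realizations: the full one, and the one in
-- which a single semi-adjacent pair becomes a non-edge. Comparing them shows that the pairs in
-- question are strong. The series-parallel outcome is returned below four vertices; from four
-- vertices on, a graph without a subdivided K₄ has a cutset of at most two vertices.

module _ {A : Set} where

  pairs : List A → List (A × A)
  pairs []          = []
  pairs (x ∷ [])    = []
  pairs (x ∷ y ∷ l) = (x , y) ∷ pairs (y ∷ l)

  Edge : List (A × A) → A → A → Set
  Edge E a b = (a , b) ∈ E ⊎ (b , a) ∈ E

  Starts : List A → A → Set
  Starts l h = ∃ λ t → l ≡ h ∷ t

  Ends : List A → A → Set
  Ends l e = ∃ λ i → l ≡ i ++ [ e ]

  pairs-split : ∀ xs {y : A} {ys} → pairs (xs ++ y ∷ ys) ≡ pairs (xs ++ [ y ]) ++ pairs (y ∷ ys)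
  pairs-split []           = refl
  pairs-split (x ∷ [])     = refl
  pairs-split (x ∷ z ∷ xs) = cong ((x , z) ∷_) (pairs-split (z ∷ xs))

  pairs-∈ : ∀ {l} {a b : A} → (a , b) ∈ pairs l → a ∈ l × b ∈ l
  pairs-∈ {x ∷ y ∷ l} (here refl) = here refl , there (here refl)
  pairs-∈ {x ∷ y ∷ l} (there p) with pairs-∈ p
  ... | u , v = there u , there v

  pairs-++⁻ : ∀ {xs ys} {a b : A} → (a , b) ∈ pairs (xs ++ ys) →
    (a , b) ∈ pairs xs ⊎ (a , b) ∈ pairs ys ⊎ (Ends xs a × Starts ys b)
  pairs-++⁻ {[]} p = inj₂ (inj₁ p)
  pairs-++⁻ {x ∷ []} {y ∷ ys} (here refl) = inj₂ (inj₂ (([] , refl) , (ys , refl)))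
  pairs-++⁻ {x ∷ []} {y ∷ ys} (there p) = inj₂ (inj₁ p)
  pairs-++⁻ {x ∷ z ∷ xs} (here refl) = inj₁ (here refl)
  pairs-++⁻ {x ∷ z ∷ xs} (there p) with pairs-++⁻ {z ∷ xs} p
  ... | inj₁ q = inj₁ (there q)
  ... | inj₂ (inj₁ q) = inj₂ (inj₁ q)
  ... | inj₂ (inj₂ ((i , eq) , s)) = inj₂ (inj₂ ((x ∷ i , cong (x ∷_) eq) , s))

  pairs-++ˡ : ∀ {xs ys} {a b : A} → (a , b) ∈ pairs xs → (a , b) ∈ pairs (xs ++ ys)
  pairs-++ˡ {x ∷ y ∷ xs} (here refl) = here refl
  pairs-++ˡ {x ∷ y ∷ xs} (there p) = there (pairs-++ˡ p)

  pairs-∷ : ∀ {x xs} {a b : A} → (a , b) ∈ pairs xs → (a , b) ∈ pairs (x ∷ xs)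
  pairs-∷ {xs = y ∷ xs} p = there p

  pairs-++ʳ : ∀ xs {ys} {a b : A} → (a , b) ∈ pairs ys → (a , b) ∈ pairs (xs ++ ys)
  pairs-++ʳ [] p = p
  pairs-++ʳ (x ∷ xs) p = pairs-∷ {x} (pairs-++ʳ xs p)

  pairs-bridge : ∀ {xs ys} {e h : A} → Ends xs e → Starts ys h → (e , h) ∈ pairs (xs ++ ys)
  pairs-bridge {e = e} {h} (i , refl) (t , refl) =
    subst (_ ∈_) (sym (trans (cong pairs (L.++-assoc i [ e ] (h ∷ t))) (pairs-split i))) (∈-++⁺ʳ (pairs (i ++ [ e ])) (here refl))

  pairs-reverse : ∀ {l} {a b : A} → (a , b) ∈ pairs l → (b , a) ∈ pairs (reverse l)
  pairs-reverse {x ∷ y ∷ l} (here refl) rewrite L.unfold-reverse x (y ∷ l) | L.unfold-reverse y l =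
    pairs-bridge {reverse l ++ [ y ]} {[ x ]} (reverse l , refl) ([] , refl)
  pairs-reverse {x ∷ y ∷ l} (there p) rewrite L.unfold-reverse x (y ∷ l) = pairs-++ˡ (pairs-reverse p)

  Edge-reverse : ∀ {l} {a b : A} → Edge (pairs l) a b → Edge (pairs (reverse l)) a b
  Edge-reverse (inj₁ p) = inj₂ (pairs-reverse p)
  Edge-reverse (inj₂ p) = inj₁ (pairs-reverse p)

  Edge-sym : ∀ {E} {a b : A} → Edge E a b → Edge E b a
  Edge-sym = swap

  Edge-mono : ∀ {E F} {a b : A} → (∀ {p} → p ∈ E → p ∈ F) → Edge E a b → Edge F a b
  Edge-mono f (inj₁ p) = inj₁ (f p)
  Edge-mono f (inj₂ p) = inj₂ (f p)

  starts∈ : ∀ {l} {h : A} → Starts l h → h ∈ l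
  starts∈ (t , refl) = here refl

  ends∈ : ∀ {l} {e : A} → Ends l e → e ∈ l
  ends∈ (i , refl) = ∈-++⁺ʳ i (here refl)

  starts-reverse : ∀ {l} {e : A} → Ends l e → Starts (reverse l) e
  starts-reverse {e = e} (i , refl) = reverse i , L.reverse-++ i [ e ]

  ends-reverse : ∀ {l} {h : A} → Starts l h → Ends (reverse l) h
  ends-reverse {h = h} (t , refl) = reverse t , L.unfold-reverse h t

  starts-unique : ∀ {l} {h h' : A} → Starts l h → Starts l h' → h ≡ h'
  starts-unique (_ , refl) (_ , refl) = refl

  ends-unique : ∀ {l} {e e' : A} → Ends l e → Ends l e' → e ≡ e'
  ends-unique (i , refl) (j , eq) = L.∷ʳ-injectiveʳ i j eq

  has-end : ∀ (x : A) l → ∃ (Ends (x ∷ l))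
  has-end x [] = x , [] , refl
  has-end x (y ∷ l) with has-end y l
  ... | e , i , eq = e , x ∷ i , cong (x ∷_) eq

  starts-++ : ∀ {l m} {h : A} → Starts l h → Starts (l ++ m) h
  starts-++ {m = m} (t , refl) = t ++ m , refl

  ends-++ : ∀ l {m} {e : A} → Ends m e → Ends (l ++ m) e
  ends-++ l {e = e} (i , refl) = l ++ i , sym (L.++-assoc l i [ e ])

  starts-prefix : ∀ l {p m} {h : A} → Starts (l ++ p ∷ m) h → Starts (l ++ [ p ]) h
  starts-prefix [] (_ , refl) = _ , refl
  starts-prefix (_ ∷ l) (_ , refl) = _ , refl

  ends-suffix : ∀ l {p m} {e : A} → Ends (l ++ p ∷ m) e → Ends (p ∷ m) e
  ends-suffix l {p} {m} en with has-end p m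
  ... | e' , en' with ends-unique en (ends-++ l en')
  ... | refl = en'

  ∈-prefix : ∀ l {p m} {x : A} → x ∈ l ++ [ p ] → x ∈ l ++ p ∷ m
  ∈-prefix l q with ∈-++⁻ l q
  ... | inj₁ r = ∈-++⁺ˡ r
  ... | inj₂ (here refl) = ∈-++⁺ʳ l (here refl)

  ∈-reverse : ∀ {l} {x : A} → x ∈ l → x ∈ reverse l
  ∈-reverse {l} = AnyP.reverse⁺

  ∈-reverse⁻ : ∀ {l} {x : A} → x ∈ reverse l → x ∈ l
  ∈-reverse⁻ {l} = AnyP.reverse⁻

  unique-resp : ∀ {xs ys : List A} → xs ↭ ys → Unique xs → Unique ys
  unique-resp p = PermS.Unique-resp-↭ (setoid A) (↭⇒↭ₛ p)

  unique-++ˡ : ∀ {xs ys : List A} → Unique (xs ++ ys) → Unique xs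
  unique-++ˡ {[]} u = []
  unique-++ˡ {x ∷ xs} (p ∷ u) = All.tabulate (λ q → All.lookup p (∈-++⁺ˡ q)) ∷ unique-++ˡ u

  unique-++ʳ : ∀ xs {ys : List A} → Unique (xs ++ ys) → Unique ys
  unique-++ʳ [] u = u
  unique-++ʳ (x ∷ xs) (_ ∷ u) = unique-++ʳ xs u

  unique-disjoint : ∀ {xs ys : List A} {x} → Unique (xs ++ ys) → x ∈ xs → x ∈ ys → ⊥
  unique-disjoint {z ∷ xs} (p ∷ u) (here refl) q = All.lookup p (∈-++⁺ʳ xs q) refl
  unique-disjoint {z ∷ xs} (p ∷ u) (there r) q = unique-disjoint u r q

  unique-cons : ∀ {x : A} {xs} → x ∉ xs → Unique xs → Unique (x ∷ xs)
  unique-cons n u = All.tabulate (λ { q refl → n q }) ∷ u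

  unique-join : ∀ {xs ys : List A} → Unique xs → Unique ys → (∀ {a} → a ∈ xs → a ∈ ys → ⊥) → Unique (xs ++ ys)
  unique-join u v d = U.++⁺ u v (λ (p , q) → d p q)

  unique-reverse : ∀ {xs : List A} → Unique xs → Unique (reverse xs)
  unique-reverse {xs} = unique-resp (↭-sym (Perm.↭-reverse xs))

  unique-⊆-length : ∀ {xs ys : List A} → Unique xs → (∀ {a} → a ∈ xs → a ∈ ys) → length xs ≤ length ys
  unique-⊆-length {[]} u s = z≤n
  unique-⊆-length {x ∷ xs} {ys} (p ∷ u) s with ∈-∃++ (s (here refl))
  ... | as , bs , refl = subst (suc (length xs) ≤_) (sym (trans (L.length-++ as) (trans (ℕ.+-suc _ _) (cong suc (sym (L.length-++ as))))))
          (s≤s (unique-⊆-length u sub))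
    where
    sub : ∀ {a} → a ∈ xs → a ∈ as ++ bs
    sub q with ∈-++⁻ as (s (there q))
    ... | inj₁ r = ∈-++⁺ˡ r
    ... | inj₂ (here refl) = ⊥-elim (All.lookup p q refl)
    ... | inj₂ (there r) = ∈-++⁺ʳ as r

  split-first : ∀ {P : A → Set} → Decidable P → ∀ {l} → Any P l →
    ∃ λ xs → ∃ λ y → ∃ λ ys → l ≡ xs ++ y ∷ ys × P y × (∀ {a} → a ∈ xs → ¬ P a)
  split-first P? {x ∷ l} any with P? x
  ... | yes p = [] , x , l , refl , p , λ ()
  split-first P? {x ∷ l} (here p) | no np = ⊥-elim (np p)
  split-first P? {x ∷ l} (there any) | no np with split-first P? any
  ... | xs , y , ys , refl , p , f = x ∷ xs , y , ys , refl , p , λ { (here refl) → np ; (there q) → f q }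

  split-last : ∀ {P : A → Set} → Decidable P → ∀ {l} → Any P l →
    ∃ λ xs → ∃ λ y → ∃ λ ys → l ≡ xs ++ y ∷ ys × P y × (∀ {a} → a ∈ ys → ¬ P a)
  split-last P? {x ∷ l} any with Any.any? P? l
  ... | yes a with split-last P? a
  ... | xs , y , ys , refl , p , f = x ∷ xs , y , ys , refl , p , f
  split-last P? {x ∷ l} (here p) | no na = [] , x , l , refl , p , λ q r → na (Any.map (λ { refl → r }) q)
  split-last P? {x ∷ l} (there a) | no na = ⊥-elim (na a)

  any-∈ : ∀ {P : A → Set} {a l} → a ∈ l → P a → Any P l
  any-∈ q p = Any.map (λ { refl → p }) q

  ∈-any : ∀ {P : A → Set} {l} → Any P l → ∃ λ a → a ∈ l × P a
  ∈-any (here p) = _ , here refl , p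
  ∈-any (there q) with ∈-any q
  ... | a , r , p = a , there r , p

module _ {n : ℕ} where

  _∈?_ : (x : Fin n) (l : List (Fin n)) → Dec (x ∈ l)
  x ∈? l = Any.any? (x F.≟_) l

  unique-length≤ : ∀ {l : List (Fin n)} → Unique l → length l ≤ n
  unique-length≤ {l} u = subst (length l ≤_) (L.length-tabulate {n = n} (λ i → i)) (unique-⊆-length u (λ {a} _ → ∈-tabulate⁺ a))

module _ {A : Set} where

  cyc : List A → List (A × A)
  cyc []      = []
  cyc (x ∷ l) = pairs (x ∷ l ++ [ x ])

  cyc⁻ : ∀ {l h e} {a b : A} → Starts l h → Ends l e → (a , b) ∈ cyc l → (a , b) ∈ pairs l ⊎ (a ≡ e × b ≡ h)
  cyc⁻ {h ∷ t} (_ , refl) en p with pairs-++⁻ {xs = h ∷ t} {[ h ]} p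
  ... | inj₁ q = inj₁ q
  ... | inj₂ (inj₂ (en' , (_ , refl))) = inj₂ (ends-unique en' en , refl)

  cyc⁺ : ∀ {l} {a b : A} → (a , b) ∈ pairs l → (a , b) ∈ cyc l
  cyc⁺ {h ∷ t} p = pairs-++ˡ {xs = h ∷ t} p

  cyc-close : ∀ {l} {h e : A} → Starts l h → Ends l e → (e , h) ∈ cyc l
  cyc-close {h ∷ t} (_ , refl) en = pairs-bridge {xs = h ∷ t} {[ h ]} en ([] , refl)

  -- Both arcs keep both cut vertices, so each edge of the cycle lies on one of them. Most adjacency
  -- arguments on a hole reduce to this equation.
  cyc-arcs : ∀ (x : A) A y B → cyc (x ∷ A ++ y ∷ B) ≡ pairs (x ∷ A ++ [ y ]) ++ pairs (y ∷ B ++ [ x ])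
  cyc-arcs x A y B = trans (cong (λ l → pairs (x ∷ l)) (L.++-assoc A (y ∷ B) [ x ])) (pairs-split (x ∷ A))

  cyc-rotate : ∀ xs ys {p : A × A} → p ∈ cyc (xs ++ ys) → p ∈ cyc (ys ++ xs)
  cyc-rotate [] ys {p} m = subst (λ l → p ∈ cyc l) (sym (L.++-identityʳ ys)) m
  cyc-rotate xs@(_ ∷ _) [] {p} m = subst (λ l → p ∈ cyc l) (L.++-identityʳ xs) m
  cyc-rotate (x ∷ xs) (y ∷ ys) m
    with ∈-++⁻ (pairs (x ∷ xs ++ [ y ])) (subst (_ ∈_) (cyc-arcs x xs y ys) m)
  ... | inj₁ q = subst (_ ∈_) (sym (cyc-arcs y ys x xs)) (∈-++⁺ʳ (pairs (y ∷ ys ++ [ x ])) q)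
  ... | inj₂ q = subst (_ ∈_) (sym (cyc-arcs y ys x xs)) (∈-++⁺ˡ q)

  -- This shows that the two ends of an arc are not consecutive on it once something lies between
  -- them.
  pairs-inner : ∀ {x c y : A} {C a b} → (a , b) ∈ pairs (x ∷ (c ∷ C) ++ [ y ]) → a ∈ c ∷ C ⊎ b ∈ c ∷ C
  pairs-inner (here refl) = inj₂ (here refl)
  pairs-inner {C = []} (there (here refl)) = inj₁ (here refl)
  pairs-inner {C = d ∷ C} (there (here refl)) = inj₁ (here refl)
  -- The head `d` is doubled, so that the shorter list again consists of a head, a non-empty inner
  -- part and a last vertex.
  pairs-inner {C = d ∷ C} (there (there p)) with pairs-inner {x = d} {C = C} {a = _} (there' p)
    where
    there' : ∀ {q : A × A} → q ∈ pairs (d ∷ C ++ [ _ ]) → q ∈ pairs (d ∷ d ∷ C ++ [ _ ])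
    there' p = there p
  ... | inj₁ q = inj₁ (there q)
  ... | inj₂ q = inj₂ (there q)

  Edge-inner : ∀ {x c y : A} {C a b} → Edge (pairs (x ∷ (c ∷ C) ++ [ y ])) a b → a ∈ c ∷ C ⊎ b ∈ c ∷ C
  Edge-inner (inj₁ p) = pairs-inner p
  Edge-inner (inj₂ p) = swap (pairs-inner p)

  Edge-++⁻ : ∀ E {F} {a b : A} → Edge (E ++ F) a b → Edge E a b ⊎ Edge F a b
  Edge-++⁻ E (inj₁ p) with ∈-++⁻ E p
  ... | inj₁ q = inj₁ (inj₁ q)
  ... | inj₂ q = inj₂ (inj₁ q)
  Edge-++⁻ E (inj₂ p) with ∈-++⁻ E p
  ... | inj₁ q = inj₁ (inj₂ q)
  ... | inj₂ q = inj₂ (inj₂ q)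

  Edge-∈ : ∀ {l} {a b : A} → Edge (pairs l) a b → a ∈ l × b ∈ l
  Edge-∈ (inj₁ p) = pairs-∈ p
  Edge-∈ (inj₂ p) with pairs-∈ p
  ... | u , v = v , u

  lookup-injective : ∀ {l : List A} → Unique l → ∀ {i j} → lookup l i ≡ lookup l j → i ≡ j
  lookup-injective {x ∷ l} (p ∷ u) {zero} {zero} eq = refl
  lookup-injective {x ∷ l} (p ∷ u) {zero} {suc j} eq = ⊥-elim (All.lookup p (∈-lookup j) eq)
  lookup-injective {x ∷ l} (p ∷ u) {suc i} {zero} eq = ⊥-elim (All.lookup p (∈-lookup i) (sym eq))
  lookup-injective {x ∷ l} (p ∷ u) {suc i} {suc j} eq = cong suc (lookup-injective u eq)

  -- These index lemmas connect holes given as lists with the rim of `HasWheel`, which is a function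
  -- on `Fin k` with adjacency `cycAdj`.
  pairs-lookup⁺ : ∀ (l : List A) i j → suc (toℕ i) ≡ toℕ j → (lookup l i , lookup l j) ∈ pairs l
  pairs-lookup⁺ (x ∷ y ∷ l) zero (suc zero) eq = here refl
  pairs-lookup⁺ (x ∷ y ∷ l) (suc i) (suc j) eq = there (pairs-lookup⁺ (y ∷ l) i j (ℕ.suc-injective eq))

  pairs-lookup⁻ : ∀ {l : List A} → Unique l → ∀ i j → (lookup l i , lookup l j) ∈ pairs l → suc (toℕ i) ≡ toℕ j
  pairs-lookup⁻ {x ∷ y ∷ l} (p ∷ u) zero (suc zero) m = refl
  pairs-lookup⁻ {x ∷ y ∷ l} (p ∷ u) zero (suc (suc j)) (here eq) with u | cong proj₂ eq
  ... | q ∷ _ | eq' = ⊥-elim (All.lookup q (∈-lookup j) (sym eq'))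
  pairs-lookup⁻ {x ∷ y ∷ l} (p ∷ u) zero (suc (suc j)) (there m) = ⊥-elim (All.lookup p (proj₁ (pairs-∈ {l = y ∷ l} m)) refl)
  pairs-lookup⁻ {x ∷ y ∷ l} (p ∷ u) zero zero (here eq) = ⊥-elim (All.lookup p (here refl) (cong proj₂ eq))
  pairs-lookup⁻ {x ∷ y ∷ l} (p ∷ u) zero zero (there m) = ⊥-elim (All.lookup p (proj₁ (pairs-∈ {l = y ∷ l} m)) refl)
  pairs-lookup⁻ {x ∷ y ∷ l} (p ∷ u) (suc i) j (here eq) = ⊥-elim (All.lookup p (∈-lookup i) (sym (cong proj₁ eq)))
  pairs-lookup⁻ {x ∷ y ∷ l} (p ∷ u) (suc i) zero (there m) = ⊥-elim (All.lookup p (proj₂ (pairs-∈ {l = y ∷ l} m)) refl)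
  pairs-lookup⁻ {x ∷ y ∷ l} (p ∷ u) (suc i) (suc j) (there m) = cong suc (pairs-lookup⁻ u i j m)

  ends-lookup⁺ : ∀ (l : List A) i → suc (toℕ i) ≡ length l → Ends l (lookup l i)
  ends-lookup⁺ (x ∷ []) zero eq = [] , refl
  ends-lookup⁺ (x ∷ y ∷ l) (suc i) eq with ends-lookup⁺ (y ∷ l) i (ℕ.suc-injective eq)
  ... | j , eq' = x ∷ j , cong (x ∷_) eq'

  last-index : ∀ (x : A) l → ∃ λ (i : Fin (suc (length l))) → toℕ i ≡ length l
  last-index x [] = zero , refl
  last-index x (y ∷ l) with last-index y l
  ... | i , eq = suc i , cong suc eq

  ends-lookup⁻ : ∀ {l : List A} → Unique l → ∀ i → Ends l (lookup l i) → suc (toℕ i) ≡ length l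
  ends-lookup⁻ {x ∷ l} u i en with last-index x l
  ... | j , eq = cong suc (trans (cong toℕ (lookup-injective u {i} {j} (ends-unique en (ends-lookup⁺ (x ∷ l) j (cong suc eq))))) eq)

-- Booleans, counting and consecutive indices

∨-true⁻ : ∀ a {b} → a ∨ b ≡ true → a ≡ true ⊎ b ≡ true
∨-true⁻ true p = inj₁ refl
∨-true⁻ false p = inj₂ p

∨-trueˡ : ∀ {a b} → a ≡ true → a ∨ b ≡ true
∨-trueˡ refl = refl

∨-trueʳ : ∀ a {b} → b ≡ true → a ∨ b ≡ true
∨-trueʳ a refl = B.∨-zeroʳ a

∧-true⁻ : ∀ a {b} → a ∧ b ≡ true → a ≡ true × b ≡ true
∧-true⁻ true p = refl , p

∧-true⁺ : ∀ {a b} → a ≡ true → b ≡ true → a ∧ b ≡ true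
∧-true⁺ refl refl = refl

bool-ext : ∀ {a b} → (a ≡ true → b ≡ true) → (b ≡ true → a ≡ true) → a ≡ b
bool-ext {true} {true} f g = refl
bool-ext {false} {false} f g = refl
bool-ext {true} {false} f g = sym (f refl)
bool-ext {false} {true} f g = g refl

≡ᵇ-true⁻ : ∀ {m k} → (m ≡ᵇ k) ≡ true → m ≡ k
≡ᵇ-true⁻ {m} {k} p = ℕ.≡ᵇ⇒≡ m k (subst T (sym p) tt)

≡ᵇ-true⁺ : ∀ {m k} → m ≡ k → (m ≡ᵇ k) ≡ true
≡ᵇ-true⁺ {m} refl with m ≡ᵇ m | ℕ.≡⇒≡ᵇ m m refl
... | true | _ = refl

next⁻ : ∀ {k} {i j : Fin k} → next k i j ≡ true → suc (toℕ i) ≡ toℕ j ⊎ (suc (toℕ i) ≡ k × toℕ j ≡ 0)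
next⁻ {k} {i} {j} p with ∨-true⁻ (suc (toℕ i) ≡ᵇ toℕ j) p
... | inj₁ q = inj₁ (≡ᵇ-true⁻ q)
... | inj₂ q with ∧-true⁻ (suc (toℕ i) ≡ᵇ k) q
... | r , s = inj₂ (≡ᵇ-true⁻ {suc (toℕ i)} r , ≡ᵇ-true⁻ {toℕ j} s)

next⁺ : ∀ {k} {i j : Fin k} → suc (toℕ i) ≡ toℕ j ⊎ (suc (toℕ i) ≡ k × toℕ j ≡ 0) → next k i j ≡ true
next⁺ (inj₁ q) = ∨-trueˡ (≡ᵇ-true⁺ q)
next⁺ {k} {i} {j} (inj₂ (r , s)) = ∨-trueʳ (suc (toℕ i) ≡ᵇ toℕ j) (∧-true⁺ (≡ᵇ-true⁺ r) (≡ᵇ-true⁺ s))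

count≥3 : ∀ {k} (p : Fin k → Bool) {i j l} → i ≢ j → i ≢ l → j ≢ l →
  p i ≡ true → p j ≡ true → p l ≡ true → 3 ≤ count p
count≥3 {k} p {i} {j} {l} ij il jl pi pj pl =
  unique-⊆-length ((ij ∷ il ∷ []) ∷ (jl ∷ []) ∷ [] ∷ []) sub
  where
  mem : ∀ x → p x ≡ true → x ∈ filterᵇ p (allFin k)
  mem x q = ∈-filter⁺ (λ y → B.T? (p y)) (∈-tabulate⁺ x) (subst T (sym q) tt)
  sub : ∀ {a} → a ∈ i ∷ j ∷ l ∷ [] → a ∈ filterᵇ p (allFin k)
  sub (here refl) = mem i pi
  sub (there (here refl)) = mem j pj
  sub (there (there (here refl))) = mem l pl

∈⇒lookup : ∀ {A : Set} {x : A} {l} → x ∈ l → ∃ λ i → lookup l i ≡ x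
∈⇒lookup (here refl) = zero , refl
∈⇒lookup (there p) with ∈⇒lookup p
... | i , eq = suc i , eq

module Graph {n : ℕ} (R : Adj n) (isg : IsGraph R) where

  V : Set
  V = Fin n

  infix 4 _~_ _~?_

  _~_ : V → V → Set
  a ~ b = R a b ≡ true

  _~?_ : ∀ a b → Dec (a ~ b)
  a ~? b = R a b B.≟ true

  ~-sym : ∀ {a b} → a ~ b → b ~ a
  ~-sym {a} {b} p = trans (proj₁ isg b a) p

  ~-irrefl : ∀ {a b} → a ~ b → a ≢ b
  ~-irrefl {a} p refl with trans (sym p) (proj₂ isg a)
  ... | ()

  record Path (l : List V) : Set where
    field
      uniq : Unique l
      only : ∀ {a b} → a ∈ l → b ∈ l → a ~ b → Edge (pairs l) a b
      edge : ∀ {a b} → (a , b) ∈ pairs l → a ~ b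
  open Path public

  -- The bound four is the one for the rim in `HasWheel`. A vertex joined to all of a triangle is a
  -- `K4` and falls under the subdivisions instead.
  record Hole (l : List V) : Set where
    field
      uniqᴴ : Unique l
      long  : 4 ≤ length l
      onlyᴴ : ∀ {a b} → a ∈ l → b ∈ l → a ~ b → Edge (cyc l) a b
      edgeᴴ : ∀ {a b} → (a , b) ∈ cyc l → a ~ b
  open Hole public

  path-single : ∀ x → Path [ x ]
  path-single x .uniq = [] ∷ []
  path-single x .only (here refl) (here refl) p = ⊥-elim (~-irrefl p refl)
  path-single x .edge ()

  path-++ˡ : ∀ {xs ys} → Path (xs ++ ys) → Path xs
  path-++ˡ p .uniq = unique-++ˡ (p .uniq)
  path-++ˡ {xs} {ys} p .only {a} {b} q r s = go (p .only (∈-++⁺ˡ q) (∈-++⁺ˡ r) s)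
    where
    half : ∀ {a b} → a ∈ xs → b ∈ xs → (a , b) ∈ pairs (xs ++ ys) → (a , b) ∈ pairs xs
    half q r m with pairs-++⁻ {xs = xs} m
    ... | inj₁ k = k
    ... | inj₂ (inj₁ k) = ⊥-elim (unique-disjoint (p .uniq) q (proj₁ (pairs-∈ k)))
    ... | inj₂ (inj₂ (_ , k)) = ⊥-elim (unique-disjoint (p .uniq) r (starts∈ k))
    go : Edge (pairs (xs ++ ys)) a b → Edge (pairs xs) a b
    go (inj₁ m) = inj₁ (half q r m)
    go (inj₂ m) = inj₂ (half r q m)
  path-++ˡ p .edge m = p .edge (pairs-++ˡ m)

  path-++ʳ : ∀ xs {ys} → Path (xs ++ ys) → Path ys
  path-++ʳ xs p .uniq = unique-++ʳ xs (p .uniq)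
  path-++ʳ xs {ys} p .only {a} {b} q r s = go (p .only (∈-++⁺ʳ xs q) (∈-++⁺ʳ xs r) s)
    where
    half : ∀ {a b} → a ∈ ys → b ∈ ys → (a , b) ∈ pairs (xs ++ ys) → (a , b) ∈ pairs ys
    half q r m with pairs-++⁻ {xs = xs} m
    ... | inj₁ k = ⊥-elim (unique-disjoint (p .uniq) (proj₁ (pairs-∈ k)) q)
    ... | inj₂ (inj₁ k) = k
    ... | inj₂ (inj₂ (k , _)) = ⊥-elim (unique-disjoint (p .uniq) (ends∈ k) q)
    go : Edge (pairs (xs ++ ys)) a b → Edge (pairs ys) a b
    go (inj₁ m) = inj₁ (half q r m)
    go (inj₂ m) = inj₂ (half r q m)
  path-++ʳ xs p .edge m = p .edge (pairs-++ʳ xs m)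

  path-reverse : ∀ {l} → Path l → Path (reverse l)
  path-reverse p .uniq = unique-reverse (p .uniq)
  path-reverse p .only q r s = Edge-reverse (p .only (∈-reverse⁻ q) (∈-reverse⁻ r) s)
  path-reverse {l} p .edge {a} {b} m = ~-sym (p .edge (subst (λ k → (b , a) ∈ pairs k) (L.reverse-involutive l) (pairs-reverse m)))

  path-join : ∀ {xs ys e h} → Path xs → Path ys → Ends xs e → Starts ys h → e ~ h →
    (∀ {a} → a ∈ xs → a ∈ ys → ⊥) →
    (∀ {a b} → a ∈ xs → b ∈ ys → a ~ b → a ≡ e × b ≡ h) → Path (xs ++ ys)
  path-join p q en st eh dis cr .uniq = unique-join (p .uniq) (q .uniq) dis
  path-join {xs} {ys} p q en st eh dis cr .only {a} {b} u v s with ∈-++⁻ xs u | ∈-++⁻ xs v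
  ... | inj₁ u' | inj₁ v' = Edge-mono pairs-++ˡ (p .only u' v' s)
  ... | inj₂ u' | inj₂ v' = Edge-mono (pairs-++ʳ xs) (q .only u' v' s)
  ... | inj₁ u' | inj₂ v' with cr u' v' s
  ... | refl , refl = inj₁ (pairs-bridge en st)
  path-join {xs} {ys} p q en st eh dis cr .only {a} {b} u v s | inj₂ u' | inj₁ v' with cr v' u' (~-sym s)
  ... | refl , refl = inj₂ (pairs-bridge en st)
  path-join {xs} {ys} p q en st eh dis cr .edge m with pairs-++⁻ {xs = xs} m
  ... | inj₁ k = p .edge k
  ... | inj₂ (inj₁ k) = q .edge k
  ... | inj₂ (inj₂ (en' , st')) rewrite ends-unique en' en | starts-unique st' st = eh

  hole-join : ∀ {xs ys h e h' e'} → Path xs → Path ys → Starts xs h → Ends xs e → Starts ys h' → Ends ys e' →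
    e ~ h' → e' ~ h → 4 ≤ length (xs ++ ys) →
    (∀ {a} → a ∈ xs → a ∈ ys → ⊥) →
    (∀ {a b} → a ∈ xs → b ∈ ys → a ~ b → (a ≡ e × b ≡ h') ⊎ (a ≡ h × b ≡ e')) → Hole (xs ++ ys)
  hole-join p q st en st' en' c c' lg dis cr .uniqᴴ = unique-join (p .uniq) (q .uniq) dis
  hole-join p q st en st' en' c c' lg dis cr .long = lg
  hole-join {xs} {ys} p q st en st' en' c c' lg dis cr .onlyᴴ {a} {b} u v s with ∈-++⁻ xs u | ∈-++⁻ xs v
  ... | inj₁ u' | inj₁ v' = Edge-mono (λ m → cyc⁺ (pairs-++ˡ m)) (p .only u' v' s)
  ... | inj₂ u' | inj₂ v' = Edge-mono (λ m → cyc⁺ (pairs-++ʳ xs m)) (q .only u' v' s)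
  ... | inj₁ u' | inj₂ v' with cr u' v' s
  ... | inj₁ (refl , refl) = inj₁ (cyc⁺ (pairs-bridge en st'))
  ... | inj₂ (refl , refl) = inj₂ (cyc-close (starts-++ st) (ends-++ xs en'))
  hole-join {xs} {ys} p q st en st' en' c c' lg dis cr .onlyᴴ {a} {b} u v s | inj₂ u' | inj₁ v' with cr v' u' (~-sym s)
  ... | inj₁ (refl , refl) = inj₂ (cyc⁺ (pairs-bridge en st'))
  ... | inj₂ (refl , refl) = inj₁ (cyc-close (starts-++ st) (ends-++ xs en'))
  hole-join {xs} {ys} p q st en st' en' c c' lg dis cr .edgeᴴ m with cyc⁻ (starts-++ st) (ends-++ xs en') m
  ... | inj₂ (refl , refl) = c'
  ... | inj₁ m' with pairs-++⁻ {xs = xs} m'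
  ... | inj₁ k = p .edge k
  ... | inj₂ (inj₁ k) = q .edge k
  ... | inj₂ (inj₂ (f , g)) rewrite ends-unique f en | starts-unique g st' = c

  hole-rotate : ∀ xs {ys} → Hole (xs ++ ys) → Hole (ys ++ xs)
  hole-rotate xs {ys} H .uniqᴴ = unique-resp (Perm.++-comm xs ys) (H .uniqᴴ)
  hole-rotate xs {ys} H .long = subst (4 ≤_) (trans (L.length-++ xs) (trans (ℕ.+-comm (length xs) _) (sym (L.length-++ ys)))) (H .long)
  hole-rotate xs {ys} H .onlyᴴ p q s = Edge-mono (cyc-rotate xs ys) (H .onlyᴴ (AnyP.++-comm ys xs p) (AnyP.++-comm ys xs q) s)
  hole-rotate xs {ys} H .edgeᴴ m = H .edgeᴴ (cyc-rotate ys xs m)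

  hole-reverse : ∀ {x l} → Hole (x ∷ l) → Hole (x ∷ reverse l)
  hole-reverse {x} {l} H = record
    { uniqᴴ = uniq' (H .uniqᴴ)
    ; long = subst (λ k → 4 ≤ suc k) (sym (L.length-reverse l)) (H .long)
    ; onlyᴴ = λ p q s → Edge-flip (H .onlyᴴ (mem p) (mem q) s)
    ; edgeᴴ = λ {a} {b} m → ~-sym (H .edgeᴴ (subst (λ k → (b , a) ∈ pairs (x ∷ k ++ [ x ])) (L.reverse-involutive l) (flip {l = reverse l} m))) }
    where
    mem : ∀ {a} → a ∈ x ∷ reverse l → a ∈ x ∷ l
    mem (here e) = here e
    mem (there m) = there (∈-reverse⁻ m)
    uniq' : Unique (x ∷ l) → Unique (x ∷ reverse l)
    uniq' (p ∷ u) = unique-cons (λ m → All.lookup p (∈-reverse⁻ m) refl) (unique-reverse u)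
    flip : ∀ {l a b} → (a , b) ∈ cyc (x ∷ l) → (b , a) ∈ cyc (x ∷ reverse l)
    flip {l} m = subst (λ k → _ ∈ pairs k) (trans (L.unfold-reverse x (l ++ [ x ])) (cong (_++ [ x ]) (L.reverse-++ l [ x ]))) (pairs-reverse m)
    Edge-flip : ∀ {a b} → Edge (cyc (x ∷ l)) a b → Edge (cyc (x ∷ reverse l)) a b
    Edge-flip (inj₁ p) = inj₂ (flip p)
    Edge-flip (inj₂ p) = inj₁ (flip p)

  -- Removing a non-empty segment opens the cycle: the closing pair ends in the removed head `x`, so
  -- the other pairs are those of a path, which stays induced.
  hole-path : ∀ {x xs ys} → Hole ((x ∷ xs) ++ ys) → Path ys
  hole-path {x} {xs} H .uniq = unique-++ʳ (x ∷ xs) (H .uniqᴴ)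
  hole-path {x} {xs} {ys} H .only {a} {b} q r s = go (H .onlyᴴ (∈-++⁺ʳ (x ∷ xs) q) (∈-++⁺ʳ (x ∷ xs) r) s)
    where
    half : ∀ {a b} → a ∈ ys → b ∈ ys → (a , b) ∈ cyc ((x ∷ xs) ++ ys) → (a , b) ∈ pairs ys
    half q r m with cyc⁻ {l = (x ∷ xs) ++ ys} (_ , refl) (proj₂ (has-end x (xs ++ ys))) m
    ... | inj₂ (_ , refl) = ⊥-elim (unique-disjoint {xs = x ∷ xs} (H .uniqᴴ) (here refl) r)
    ... | inj₁ m' with pairs-++⁻ {xs = x ∷ xs} m'
    ... | inj₁ k = ⊥-elim (unique-disjoint {xs = x ∷ xs} (H .uniqᴴ) (proj₁ (pairs-∈ k)) q)
    ... | inj₂ (inj₁ k) = k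
    ... | inj₂ (inj₂ (k , _)) = ⊥-elim (unique-disjoint {xs = x ∷ xs} (H .uniqᴴ) (ends∈ k) q)
    go : Edge (cyc ((x ∷ xs) ++ ys)) a b → Edge (pairs ys) a b
    go (inj₁ m) = inj₁ (half q r m)
    go (inj₂ m) = inj₂ (half r q m)
  hole-path {x} {xs} H .edge m = H .edgeᴴ (cyc⁺ (pairs-++ʳ (x ∷ xs) m))

  SameMem : List V → List V → Set
  SameMem xs ys = ∀ {a} → (a ∈ xs → a ∈ ys) × (a ∈ ys → a ∈ xs)

  hole-at : ∀ {Q x} → Hole Q → x ∈ Q → ∃ λ A → Hole (x ∷ A) × SameMem Q (x ∷ A)
  hole-at {x = x} H m with ∈-∃++ m
  ... | xs , ys , refl = ys ++ xs , hole-rotate xs H , (AnyP.++-comm xs (x ∷ ys) , AnyP.++-comm (x ∷ ys) xs)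

  hole-at₂ : ∀ {Q x y} → Hole Q → x ∈ Q → y ∈ Q → x ≢ y → ∃ λ A → ∃ λ B → Hole (x ∷ A ++ y ∷ B) × SameMem Q (x ∷ A ++ y ∷ B)
  hole-at₂ H mx my x≢y with hole-at H mx
  ... | A , H' , sm with proj₁ sm my
  ... | here refl = ⊥-elim (x≢y refl)
  ... | there my' with ∈-∃++ my'
  ... | xs , ys , refl = xs , ys , H' , sm

  -- If z is met before y on the way from x, the hole is traversed backwards with x fixed. Hence the
  -- single cyclic order x, y, z suffices wherever three vertices of a hole are considered.
  hole-at₃ : ∀ {Q x y z} → Hole Q → x ∈ Q → y ∈ Q → z ∈ Q → x ≢ y → x ≢ z → y ≢ z →
    ∃ λ A → ∃ λ B → ∃ λ C → Hole (x ∷ A ++ y ∷ B ++ z ∷ C) × SameMem Q (x ∷ A ++ y ∷ B ++ z ∷ C)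
  hole-at₃ {Q} {x} {y} {z} H mx my mz xy xz yz with hole-at₂ H mx my xy
  ... | A , B , H' , sm with proj₁ sm mz
  ... | here refl = ⊥-elim (xz refl)
  ... | there mz' with ∈-++⁻ A mz'
  ... | inj₂ (here refl) = ⊥-elim (yz refl)
  ... | inj₂ (there mz'') with ∈-∃++ mz''
  ... | B' , C , refl = A , B' , C , H' , sm
  hole-at₃ {Q} {x} {y} {z} H mx my mz xy xz yz | A , B , H' , sm | there mz' | inj₁ mz'' with ∈-∃++ mz''
  ... | A₁ , A₂ , refl = reverse B , reverse A₂ , reverse A₁ , subst (λ l → Hole (x ∷ l)) eq (hole-reverse H') ,
    λ {a} → (λ m → subst (λ l → a ∈ x ∷ l) eq (rv (proj₁ sm m))) , (λ m → proj₂ sm (rv⁻ (subst (λ l → a ∈ x ∷ l) (sym eq) m)))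
    where
    eq : reverse ((A₁ ++ z ∷ A₂) ++ y ∷ B) ≡ reverse B ++ y ∷ reverse A₂ ++ z ∷ reverse A₁
    eq = trans (L.reverse-++ (A₁ ++ z ∷ A₂) (y ∷ B))
      (trans (cong₂ _++_ (L.unfold-reverse y B) (trans (L.reverse-++ A₁ (z ∷ A₂))
        (trans (cong (_++ reverse A₁) (L.unfold-reverse z A₂)) (L.++-assoc (reverse A₂) [ z ] (reverse A₁)))))
      (L.++-assoc (reverse B) [ y ] _))
    rv : ∀ {a l} → a ∈ x ∷ l → a ∈ x ∷ reverse l
    rv (here e) = here e
    rv (there m) = there (∈-reverse m)
    rv⁻ : ∀ {a l} → a ∈ x ∷ reverse l → a ∈ x ∷ l
    rv⁻ (here e) = here e
    rv⁻ (there m) = there (∈-reverse⁻ m)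

  -- Connected sets and induced paths inside them

  data Walk (S : List V) (a : V) : V → Set where
    stop : a ∈ S → Walk S a a
    step : ∀ {b c} → Walk S a b → c ∈ S → b ~ c → Walk S a c

  Conn : List V → Set
  Conn S = ∀ {a b} → a ∈ S → b ∈ S → Walk S a b

  walk-mono : ∀ {S T a b} → (∀ {x} → x ∈ S → x ∈ T) → Walk S a b → Walk T a b
  walk-mono f (stop p) = stop (f p)
  walk-mono f (step w p e) = step (walk-mono f w) (f p) e

  walk-trans : ∀ {S a b c} → Walk S a b → Walk S b c → Walk S a c
  walk-trans w (stop _) = w
  walk-trans w (step v p e) = step (walk-trans w v) p e

  conn-join : ∀ {S T a b} → Conn S → Conn T → a ∈ S → b ∈ T → a ~ b → Conn (S ++ T)
  conn-join {S} {T} cS cT pa pb ab u v with ∈-++⁻ S u | ∈-++⁻ S v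
  ... | inj₁ u' | inj₁ v' = walk-mono ∈-++⁺ˡ (cS u' v')
  ... | inj₂ u' | inj₂ v' = walk-mono (∈-++⁺ʳ S) (cT u' v')
  ... | inj₁ u' | inj₂ v' = walk-trans (step (walk-mono ∈-++⁺ˡ (cS u' pa)) (∈-++⁺ʳ S pb) ab) (walk-mono (∈-++⁺ʳ S) (cT pb v'))
  ... | inj₂ u' | inj₁ v' = walk-trans (step (walk-mono (∈-++⁺ʳ S) (cT u' pb)) (∈-++⁺ˡ pa) (~-sym ab)) (walk-mono ∈-++⁺ˡ (cS pa v'))

  conn-meet : ∀ {S T a} → Conn S → Conn T → a ∈ S → a ∈ T → Conn (S ++ T)
  conn-meet {S} {T} cS cT pa pb u v with ∈-++⁻ S u | ∈-++⁻ S v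
  ... | inj₁ u' | inj₁ v' = walk-mono ∈-++⁺ˡ (cS u' v')
  ... | inj₂ u' | inj₂ v' = walk-mono (∈-++⁺ʳ S) (cT u' v')
  ... | inj₁ u' | inj₂ v' = walk-trans (walk-mono ∈-++⁺ˡ (cS u' pa)) (walk-mono (∈-++⁺ʳ S) (cT pb v'))
  ... | inj₂ u' | inj₁ v' = walk-trans (walk-mono (∈-++⁺ʳ S) (cT u' pb)) (walk-mono ∈-++⁺ˡ (cS pa v'))

  conn-single : ∀ x → Conn [ x ]
  conn-single x (here refl) (here refl) = stop (here refl)

  conn-cons : ∀ {S x y} → Conn S → y ∈ S → x ~ y → Conn (x ∷ S)
  conn-cons {x = x} c p e = conn-join (conn-single x) c (here refl) p e

  path-conn : ∀ {l} → Path l → Conn l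
  path-conn {x ∷ []} p = conn-single x
  path-conn {x ∷ y ∷ l} p = conn-cons (path-conn (path-++ʳ [ x ] p)) (here refl) (p .edge (here refl))

  record PathFrom (S : List V) (a b : V) : Set where
    constructor mkPF
    field
      list   : List V
      path   : Path list
      start  : Starts list a
      end    : Ends list b
      within : ∀ {x} → x ∈ list → x ∈ S

  -- If `c` already lies on the path, the path is cut there. Otherwise it is cut at its first
  -- neighbour of `c`, which makes the new edge the only one at `c` and keeps the path induced.
  path-snoc : ∀ {S a b c} → PathFrom S a b → c ∈ S → b ~ c → PathFrom S a c
  path-snoc {S} {a} {b} {c} (mkPF l p st en sub) cS bc with c ∈? l
  ... | yes m with ∈-∃++ m
  ... | xs , ys , refl = mkPF (xs ++ [ c ]) (path-++ˡ {xs ++ [ c ]} (subst Path (sym (L.++-assoc xs [ c ] ys)) p)) (starts-prefix xs st) (xs , refl) (λ q → sub (∈-prefix xs q))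
  path-snoc {S} {a} {b} {c} (mkPF l p st en sub) cS bc | no ∉l with split-first (λ x → x ~? c) (any-∈ (ends∈ en) bc)
  ... | xs , y , ys , refl , yc , none = mkPF ((xs ++ [ y ]) ++ [ c ])
      (path-join {xs = xs ++ [ y ]} {[ c ]} pre (path-single c) (xs , refl) (_ , refl) yc
        (λ { q (here refl) → ∉l (∈-prefix xs q) }) cr)
      (starts-++ (starts-prefix xs st)) (xs ++ [ y ] , refl) mem
    where
    pre = path-++ˡ {xs ++ [ y ]} (subst Path (sym (L.++-assoc xs [ y ] ys)) p)
    cr : ∀ {u v} → u ∈ xs ++ [ y ] → v ∈ [ c ] → u ~ v → u ≡ y × v ≡ c
    cr q (here refl) e with ∈-++⁻ xs q
    ... | inj₁ r = ⊥-elim (none r e)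
    ... | inj₂ (here refl) = refl , refl
    mem : ∀ {x} → x ∈ (xs ++ [ y ]) ++ [ c ] → x ∈ S
    mem q with ∈-++⁻ (xs ++ [ y ]) q
    ... | inj₁ r = sub (∈-prefix xs r)
    ... | inj₂ (here refl) = cS

  walk-path : ∀ {S a b} → Walk S a b → PathFrom S a b
  walk-path {a = a} (stop p) = mkPF [ a ] (path-single a) (_ , refl) ([] , refl) (λ { (here refl) → p })
  walk-path (step w p e) = path-snoc (walk-path w) p e

  -- With A and B each met at one end only, the path attaches to the surrounding configuration just
  -- there. It may be a single vertex lying in both A and B.
  record Linking (S : List V) (A B : V → Set) : Set where
    field
      {first last} : V
      list    : List V
      path    : Path list
      start   : Starts list first
      end     : Ends list last
      within  : ∀ {x} → x ∈ list → x ∈ S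
      firstA  : A first
      onlyA   : ∀ {x} → x ∈ list → A x → x ≡ first
      lastB   : B last
      onlyB   : ∀ {x} → x ∈ list → B x → x ≡ last

  -- An induced path from A to B is cut at its first vertex in B, and what remains is cut at its
  -- last vertex in A.
  linking : ∀ {S} {A B : V → Set} → Decidable A → Decidable B → Conn S →
    ∀ {a b} → a ∈ S → A a → b ∈ S → B b → Linking S A B
  linking {S} {A} {B} A? B? cS {a} {b} aS Aa bS Bb with walk-path (cS aS bS)
  ... | mkPF l p st en sub with split-first B? (any-∈ (ends∈ en) Bb)
  ... | xs , e , ys , refl , Be , noB with split-last A? (any-∈ {a = a} {l = xs ++ [ e ]} (starts∈ (starts-prefix xs st)) Aa)
  ... | us , h , vs , eq , Ah , noA = record
    { list = h ∷ vs ; path = path-++ʳ us (subst Path eq (path-++ˡ {xs ++ [ e ]} (subst Path (sym (L.++-assoc xs [ e ] ys)) p)))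
    ; start = _ , refl ; end = en'
    ; within = λ q → sub (∈-prefix xs (inc q))
    ; firstA = Ah ; onlyA = λ { (here e) _ → e ; (there q) A → ⊥-elim (noA q A) }
    ; lastB = Be ; onlyB = λ q → oB (inc q) }
    where
    inc : ∀ {x} → x ∈ h ∷ vs → x ∈ xs ++ [ e ]
    inc {x} q = subst (x ∈_) (sym eq) (∈-++⁺ʳ us q)
    oB : ∀ {x} → x ∈ xs ++ [ e ] → B x → x ≡ e
    oB q Bx with ∈-++⁻ xs q
    ... | inj₁ r = ⊥-elim (noB r Bx)
    ... | inj₂ (here refl) = refl
    en' : Ends (h ∷ vs) e
    en' with has-end h vs
    ... | e' , en'' with ends-unique (ends-++ us en'') (xs , sym eq)
    ... | refl = en''

  wheel : ∀ {Q h x y z} → Hole Q → h ∉ Q → x ∈ Q → y ∈ Q → z ∈ Q → x ≢ y → x ≢ z → y ≢ z →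
    h ~ x → h ~ y → h ~ z → HasWheel R
  wheel {Q@(q ∷ Q')} {h} H h∉ mx my mz xy xz yz hx hy hz
    with ∈⇒lookup mx | ∈⇒lookup my | ∈⇒lookup mz
  ... | i , refl | j , refl | k , refl = length Q , H .long , lookup Q , lookup-injective (H .uniqᴴ) , adj ,
      h , (λ { i refl → h∉ (∈-lookup i) }) ,
      count≥3 (λ i → R h (lookup Q i)) {i} {j} {k} (λ e → xy (cong (lookup Q) e)) (λ e → xz (cong (lookup Q) e)) (λ e → yz (cong (lookup Q) e)) hx hy hz
    where
    u = H .uniqᴴ
    nxt : ∀ i j → (lookup Q i , lookup Q j) ∈ cyc Q → next (length Q) i j ≡ true
    nxt i j m with cyc⁻ (Q' , refl) (proj₂ (has-end q Q')) m
    ... | inj₁ p = next⁺ {i = i} {j} (inj₁ (pairs-lookup⁻ u i j p))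
    ... | inj₂ (p , r) = next⁺ {i = i} {j} (inj₂ (ends-lookup⁻ u i (subst (Ends Q) (sym p) (proj₂ (has-end q Q'))) ,
            cong toℕ (lookup-injective u {j} {zero} r)))
    nxt⁻ : ∀ i j → next (length Q) i j ≡ true → (lookup Q i , lookup Q j) ∈ cyc Q
    nxt⁻ i j p with next⁻ {i = i} {j} p
    ... | inj₁ e = cyc⁺ (pairs-lookup⁺ Q i j e)
    nxt⁻ i zero p | inj₂ (e , _) = cyc-close {l = Q} (Q' , refl) (ends-lookup⁺ Q i e)
    adj : ∀ i j → R (lookup Q i) (lookup Q j) ≡ cycAdj (length Q) i j
    adj i j = bool-ext fw bw
      where
      fw : lookup Q i ~ lookup Q j → cycAdj (length Q) i j ≡ true
      fw e with H .onlyᴴ (∈-lookup i) (∈-lookup j) e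
      ... | inj₁ m = ∨-trueˡ (nxt i j m)
      ... | inj₂ m = ∨-trueʳ (next (length Q) i j) (nxt j i m)
      bw : cycAdj (length Q) i j ≡ true → lookup Q i ~ lookup Q j
      bw e with ∨-true⁻ (next (length Q) i j) e
      ... | inj₁ p = H .edgeᴴ (nxt⁻ i j p)
      ... | inj₂ p = ~-sym (H .edgeᴴ (nxt⁻ j i p))

-- Subdivisions of K₄

==⁻ : ∀ {k} {i j : Fin k} → (i == j) ≡ true → i ≡ j
==⁻ {i = i} {j} p with i F.≟ j
... | yes e = e

==-refl : ∀ {k} (i : Fin k) → (i == i) ≡ true
==-refl i with i F.≟ i
... | yes e = refl
... | no ne = ⊥-elim (ne refl)

==-neq : ∀ {k} {i j : Fin k} → i ≢ j → (i == j) ≡ false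
==-neq {i = i} {j} ne with i F.≟ j
... | yes e = ⊥-elim (ne e)
... | no _ = refl

not-true⁻ : ∀ {b} → not b ≡ true → b ≡ false
not-true⁻ {false} p = refl

not-true⁺ : ∀ {b} → (b ≡ true → ⊥) → not b ≡ true
not-true⁺ {false} f = refl
not-true⁺ {true} f = ⊥-elim (f refl)

true≢false : ∀ {b} → b ≡ true → b ≡ false → ⊥
true≢false refl ()

module _ {V : Set} where

  Apart : V × V → V × V → Set
  Apart (a , b) (c , d) = ((a , b) ≢ (c , d)) × ((a , b) ≢ (d , c))

  apart-sym : ∀ {p q} → Apart p q → Apart q p
  apart-sym (f , g) = (λ { refl → f refl }) , (λ { refl → g refl })

  -- The inductive `SubdivK4` has abstract indices; here its vertices and edges are named. Each edge
  -- is listed once and in one orientation (`simple`), because `subdivide` deletes the adjacency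
  -- outright and a second copy in E would no longer be an edge.
  record SubdividedK4 (X : List V) (E : List (V × V)) : Set where
    field
      graph  : Adj (length X)
      subdiv : SubdivK4 (length X) graph
      edge⁻  : ∀ i j → graph i j ≡ true → Edge E (lookup X i) (lookup X j)
      edge⁺  : ∀ i j → Edge E (lookup X i) (lookup X j) → graph i j ≡ true
      inside : ∀ {a b} → (a , b) ∈ E → a ∈ X × b ∈ X
      simple : AllPairs Apart E
      noloop : ∀ {a} → (a , a) ∉ E
  open SubdividedK4 public

  sk4-perm : ∀ {X E E'} → E ↭ E' → SubdividedK4 X E → SubdividedK4 X E'
  sk4-perm p K .graph = K .graph
  sk4-perm p K .subdiv = K .subdiv
  sk4-perm p K .edge⁻ i j e = Edge-mono (Perm.∈-resp-↭ p) (K .edge⁻ i j e)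
  sk4-perm p K .edge⁺ i j e = K .edge⁺ i j (Edge-mono (Perm.∈-resp-↭ (↭-sym p)) e)
  sk4-perm p K .inside m = K .inside (Perm.∈-resp-↭ (↭-sym p) m)
  sk4-perm p K .simple = PermS.AllPairs-resp-↭ (setoid (V × V)) (λ {p} {q} → apart-sym {p} {q}) ((λ { refl r → r }) , (λ { refl r → r })) (↭⇒↭ₛ p) (K .simple)
  sk4-perm p K .noloop m = K .noloop (Perm.∈-resp-↭ (↭-sym p) m)

  sk4-step : ∀ {X d u v E} → Unique X → d ∉ X → SubdividedK4 X ((u , v) ∷ E) → SubdividedK4 (d ∷ X) ((u , d) ∷ (d , v) ∷ E)
  sk4-step {X} {d} {u} {v} {E} uX d∉ K with ∈⇒lookup (proj₁ (K .inside (here refl))) | ∈⇒lookup (proj₂ (K .inside (here refl)))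
  ... | iu , refl | iv , refl = record
    { graph = subdivide (K .graph) iu iv
    ; subdiv = step (K .subdiv) iu iv (K .edge⁺ iu iv (inj₁ (here refl))) ((λ x → x) , (λ e → e) , (λ x y → refl))
    ; edge⁻ = e⁻ ; edge⁺ = e⁺ ; inside = ins ; simple = smp (K .simple) ; noloop = nl }
    where
    E″ = (u , d) ∷ (d , v) ∷ E
    H' = subdivide (K .graph) iu iv
    inE : ∀ {a b} → (a , b) ∈ E → a ∈ X × b ∈ X
    inE m = K .inside (there m)
    swapped : Fin (length X) → Fin (length X) → Bool
    swapped x y = ((x == iu) ∧ (y == iv)) ∨ ((x == iv) ∧ (y == iu))
    keep : ∀ {x y} → (swapped x y ≡ true → ⊥) → Edge ((u , v) ∷ E) (lookup X x) (lookup X y) → Edge E″ (lookup X x) (lookup X y)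
    keep {x} {y} ns (inj₁ (here e)) with lookup-injective uX {x} {iu} (cong proj₁ e) | lookup-injective uX {y} {iv} (cong proj₂ e)
    ... | refl | refl = ⊥-elim (ns (∨-trueˡ (∧-true⁺ (==-refl iu) (==-refl iv))))
    keep ns (inj₁ (there m)) = inj₁ (there (there m))
    keep {x} {y} ns (inj₂ (here e)) with lookup-injective uX {y} {iu} (cong proj₁ e) | lookup-injective uX {x} {iv} (cong proj₂ e)
    ... | refl | refl = ⊥-elim (ns (∨-trueʳ _ (∧-true⁺ (==-refl iv) (==-refl iu))))
    keep ns (inj₂ (there m)) = inj₂ (there (there m))
    e⁻ : ∀ i j → H' i j ≡ true → Edge E″ (lookup (d ∷ X) i) (lookup (d ∷ X) j)
    e⁻ zero (suc y) p with ∨-true⁻ (y == iu) p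
    ... | inj₁ q rewrite ==⁻ {i = y} q = inj₂ (here refl)
    ... | inj₂ q rewrite ==⁻ {i = y} q = inj₁ (there (here refl))
    e⁻ (suc x) zero p with ∨-true⁻ (x == iu) p
    ... | inj₁ q rewrite ==⁻ {i = x} q = inj₁ (here refl)
    ... | inj₂ q rewrite ==⁻ {i = x} q = inj₂ (there (here refl))
    e⁻ (suc x) (suc y) p with ∧-true⁻ (K .graph x y) p
    ... | h , s = keep {x} {y} (λ t → true≢false t (not-true⁻ s)) (K .edge⁻ x y h)
    old : ∀ {a b} → a ∈ X → b ∈ X → (a , b) ∈ E″ → (a , b) ∈ E
    old ma mb (here refl) = ⊥-elim (d∉ mb)
    old ma mb (there (here refl)) = ⊥-elim (d∉ ma)
    old ma mb (there (there m)) = m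
    dz : ∀ y → (d , lookup X y) ∈ E″ → lookup X y ≡ v
    dz y (here e) = ⊥-elim (d∉ (subst (_∈ X) (cong proj₂ e) (∈-lookup y)))
    dz y (there (here e)) = cong proj₂ e
    dz y (there (there m)) = ⊥-elim (d∉ (proj₁ (inE m)))
    zd : ∀ y → (lookup X y , d) ∈ E″ → lookup X y ≡ u
    zd y (here e) = cong proj₁ e
    zd y (there (here e)) = ⊥-elim (d∉ (subst (_∈ X) (cong proj₁ e) (∈-lookup y)))
    zd y (there (there m)) = ⊥-elim (d∉ (proj₂ (inE m)))
    nb : ∀ y → Edge E″ d (lookup X y) → (y == iu) ∨ (y == iv) ≡ true
    nb y (inj₁ m) rewrite lookup-injective uX {y} {iv} (dz y m) = ∨-trueʳ _ (==-refl iv)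
    nb y (inj₂ m) rewrite lookup-injective uX {y} {iu} (zd y m) = ∨-trueˡ (==-refl iu)
    apartE : ∀ {p} → AllPairs Apart ((u , v) ∷ E) → p ∈ E → Apart (u , v) p
    apartE (q ∷ _) m = All.lookup q m
    ns : ∀ {x y} → (lookup X x , lookup X y) ∈ E → swapped x y ≡ true → ⊥
    ns {x} {y} m s with ∨-true⁻ ((x == iu) ∧ (y == iv)) s
    ... | inj₁ t with ∧-true⁻ (x == iu) t
    ... | f , g with ==⁻ {i = x} f | ==⁻ {i = y} g
    ... | refl | refl = proj₁ (apartE (K .simple) m) refl
    ns {x} {y} m s | inj₂ t with ∧-true⁻ (x == iv) t
    ... | f , g with ==⁻ {i = x} f | ==⁻ {i = y} g
    ... | refl | refl = proj₂ (apartE (K .simple) m) refl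
    flip-swapped : ∀ x y → swapped x y ≡ true → swapped y x ≡ true
    flip-swapped x y s with ∨-true⁻ ((x == iu) ∧ (y == iv)) s
    ... | inj₁ t with ∧-true⁻ (x == iu) t
    ... | f , g = ∨-trueʳ _ (∧-true⁺ g f)
    flip-swapped x y s | inj₂ t with ∧-true⁻ (x == iv) t
    ... | f , g = ∨-trueˡ (∧-true⁺ g f)
    e⁺ : ∀ i j → Edge E″ (lookup (d ∷ X) i) (lookup (d ∷ X) j) → H' i j ≡ true
    e⁺ zero zero (inj₁ m) = ⊥-elim (nl m)
      where
      nl : (d , d) ∉ E″
      nl (here e) = d∉ (subst (_∈ X) (sym (cong proj₁ e)) (∈-lookup iu))
      nl (there (here e)) = d∉ (subst (_∈ X) (sym (cong proj₂ e)) (∈-lookup iv))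
      nl (there (there m)) = d∉ (proj₁ (inE m))
    e⁺ zero zero (inj₂ m) = e⁺ zero zero (inj₁ m)
    e⁺ zero (suc y) m = nb y m
    e⁺ (suc x) zero m = nb x (Edge-sym m)
    e⁺ (suc x) (suc y) (inj₁ m) with old (∈-lookup x) (∈-lookup y) m
    ... | m' = ∧-true⁺ (K .edge⁺ x y (inj₁ (there m'))) (not-true⁺ (ns {x} {y} m'))
    e⁺ (suc x) (suc y) (inj₂ m) with old (∈-lookup y) (∈-lookup x) m
    ... | m' = ∧-true⁺ (K .edge⁺ x y (inj₂ (there m'))) (not-true⁺ (λ s → ns {y} {x} m' (flip-swapped x y s)))
    ins : ∀ {a b} → (a , b) ∈ E″ → a ∈ d ∷ X × b ∈ d ∷ X
    ins (here refl) = there (∈-lookup iu) , here refl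
    ins (there (here refl)) = here refl , there (∈-lookup iv)
    ins (there (there m)) with inE m
    ... | p , q = there p , there q
    u≢v : u ≢ v
    u≢v e = K .noloop (here (cong (u ,_) e))
    smp : AllPairs Apart ((u , v) ∷ E) → AllPairs Apart E″
    smp (_ ∷ ps) =
      (((λ e → d∉ (subst (_∈ X) (cong proj₁ e) (∈-lookup iu))) , (λ e → u≢v (cong proj₁ e))) ∷
        All.tabulate (λ m → (λ { refl → d∉ (proj₂ (inE m)) }) , (λ { refl → d∉ (proj₁ (inE m)) }))) ∷
      All.tabulate (λ m → (λ { refl → d∉ (proj₁ (inE m)) }) , (λ { refl → d∉ (proj₂ (inE m)) })) ∷ ps
    nl : ∀ {a} → (a , a) ∉ E″
    nl (here e) = d∉ (subst (_∈ X) (trans (sym (cong proj₁ e)) (cong proj₂ e)) (∈-lookup iu))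
    nl (there (here e)) = d∉ (subst (_∈ X) (trans (sym (cong proj₂ e)) (cong proj₁ e)) (∈-lookup iv))
    nl (there (there m)) = K .noloop (there m)

  unique-ʳ++ : ∀ A {X : List V} → Unique (A ʳ++ X) → Unique X
  unique-ʳ++ A {X} u = unique-++ʳ A (unique-resp (↭-sym (Perm.++↭ʳ++ A X)) u)

  -- The pairs of the new path go to the end of the edge list, so the next original edge comes to
  -- the head and six successive uses treat all six edges. Each single subdivision puts its vertex
  -- in front of X, whence the reverse-append.
  sk4-path : ∀ A {X u v E} → Unique (A ʳ++ X) → SubdividedK4 X ((u , v) ∷ E) → SubdividedK4 (A ʳ++ X) (E ++ pairs (u ∷ A ++ [ v ]))
  sk4-path [] {E = E} un K = sk4-perm (Perm.++-comm [ _ ] E) K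
  sk4-path (a ∷ A) {X} {u} {v} {E} un K with unique-ʳ++ A un
  ... | p ∷ uX = sk4-perm perm (sk4-path A un
        (sk4-perm (Perm.shift (a , v) [ (u , a) ] E) (sk4-step uX (λ m → All.lookup p m refl) K)))
    where
    perm : ((u , a) ∷ E) ++ pairs (a ∷ A ++ [ v ]) ↭ E ++ (u , a) ∷ pairs (a ∷ A ++ [ v ])
    perm = ↭-sym (Perm.shift (u , a) E _)

  -- The order of the edges is the order of subdivision in `hasISK4`: first the triangle xyz, which
  -- becomes the hole, then the three spokes at w, which become the legs.
  sk4-base : ∀ {w x y z} → Unique (w ∷ x ∷ y ∷ z ∷ []) →
    SubdividedK4 (w ∷ x ∷ y ∷ z ∷ []) ((x , y) ∷ (y , z) ∷ (z , x) ∷ (w , x) ∷ (w , y) ∷ (w , z) ∷ [])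
  sk4-base {w} {x} {y} {z} ((wx ∷ wy ∷ wz ∷ []) ∷ (xy ∷ xz ∷ []) ∷ (yz ∷ []) ∷ [] ∷ []) = record
    { graph = K4 ; subdiv = base K4 ((λ x → x) , (λ e → e) , (λ _ _ → refl))
    ; edge⁻ = e⁻ ; edge⁺ = e⁺ ; inside = ins ; simple = smp ; noloop = nl }
    where
    X = w ∷ x ∷ y ∷ z ∷ []
    E₀ = (x , y) ∷ (y , z) ∷ (z , x) ∷ (w , x) ∷ (w , y) ∷ (w , z) ∷ []
    0∈ : ∀ {A : Set} {a : A} {l} → a ∈ a ∷ l
    0∈ = here refl
    nl : ∀ {a} → (a , a) ∉ E₀
    nl (here refl) = xy refl
    nl (there (here refl)) = yz refl
    nl (there (there (here refl))) = xz refl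
    nl (there (there (there (here refl)))) = wx refl
    nl (there (there (there (there (here refl))))) = wy refl
    nl (there (there (there (there (there (here refl)))))) = wz refl
    ins : ∀ {a b} → (a , b) ∈ E₀ → a ∈ X × b ∈ X
    ins (here refl) = there 0∈ , there (there 0∈)
    ins (there (here refl)) = there (there 0∈) , there (there (there 0∈))
    ins (there (there (here refl))) = there (there (there 0∈)) , there 0∈
    ins (there (there (there (here refl)))) = 0∈ , there 0∈
    ins (there (there (there (there (here refl))))) = 0∈ , there (there 0∈)
    ins (there (there (there (there (there (here refl)))))) = 0∈ , there (there (there 0∈))
    smp : AllPairs Apart E₀
    smp = (((λ { refl → xy refl }) , (λ { refl → xz refl })) ∷ ((λ { refl → xz refl }) , (λ { refl → yz refl })) ∷ ((λ { refl → wx refl }) , (λ { refl → wy refl })) ∷ ((λ { refl → wx refl }) , (λ { refl → wy refl })) ∷ ((λ { refl → wx refl }) , (λ { refl → wy refl })) ∷ [])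
        ∷ (((λ { refl → yz refl }) , (λ { refl → xy refl })) ∷ ((λ { refl → wy refl }) , (λ { refl → wz refl })) ∷ ((λ { refl → wy refl }) , (λ { refl → wz refl })) ∷ ((λ { refl → wy refl }) , (λ { refl → wz refl })) ∷ [])
        ∷ (((λ { refl → wz refl }) , (λ { refl → wx refl })) ∷ ((λ { refl → wz refl }) , (λ { refl → wx refl })) ∷ ((λ { refl → wz refl }) , (λ { refl → wx refl })) ∷ [])
        ∷ (((λ { refl → xy refl }) , (λ { refl → wx refl })) ∷ ((λ { refl → xz refl }) , (λ { refl → wx refl })) ∷ [])
        ∷ (((λ { refl → yz refl }) , (λ { refl → wy refl })) ∷ []) ∷ [] ∷ []
    e⁻ : ∀ i j → K4 i j ≡ true → Edge E₀ (lookup X i) (lookup X j)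
    e⁻ zero (suc zero) p = inj₁ (there (there (there 0∈)))
    e⁻ zero (suc (suc zero)) p = inj₁ (there (there (there (there 0∈))))
    e⁻ zero (suc (suc (suc zero))) p = inj₁ (there (there (there (there (there 0∈)))))
    e⁻ (suc zero) zero p = inj₂ (there (there (there 0∈)))
    e⁻ (suc zero) (suc (suc zero)) p = inj₁ 0∈
    e⁻ (suc zero) (suc (suc (suc zero))) p = inj₂ (there (there 0∈))
    e⁻ (suc (suc zero)) zero p = inj₂ (there (there (there (there 0∈))))
    e⁻ (suc (suc zero)) (suc zero) p = inj₂ 0∈
    e⁻ (suc (suc zero)) (suc (suc (suc zero))) p = inj₁ (there 0∈)
    e⁻ (suc (suc (suc zero))) zero p = inj₂ (there (there (there (there (there 0∈)))))
    e⁻ (suc (suc (suc zero))) (suc zero) p = inj₁ (there (there 0∈))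
    e⁻ (suc (suc (suc zero))) (suc (suc zero)) p = inj₂ (there 0∈)
    e⁻ (suc (suc (suc zero))) (suc (suc (suc zero))) ()
    e⁺ : ∀ i j → Edge E₀ (lookup X i) (lookup X j) → K4 i j ≡ true
    e⁺ i j m with i F.≟ j
    ... | no _ = refl
    ... | yes refl with m
    ... | inj₁ q = ⊥-elim (nl q)
    ... | inj₂ q = ⊥-elim (nl q)

module Subdivisions {n : ℕ} (R : Adj n) (isg : IsGraph R) where
  open Graph R isg

  -- Three paths leaving w, disjoint and mutually non-adjacent apart from w, ending at neighbours of x, y, z on the hole Q.
  record Legs (Q : List V) (x y z w : V) (L₁ L₂ L₃ : List V) : Set where
    field
      {e₁ e₂ e₃} : V
      end₁   : Ends (w ∷ L₁) e₁
      end₂   : Ends (w ∷ L₂) e₂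
      end₃   : Ends (w ∷ L₃) e₃
      e₁~x   : e₁ ~ x
      e₂~y   : e₂ ~ y
      e₃~z   : e₃ ~ z
      uniqᵀ  : Unique (w ∷ L₁ ++ L₂ ++ L₃)
      offQ   : ∀ {a} → a ∈ w ∷ L₁ ++ L₂ ++ L₃ → a ∉ Q
      onlyᵀ  : ∀ {a b} → a ∈ w ∷ L₁ ++ L₂ ++ L₃ → b ∈ w ∷ L₁ ++ L₂ ++ L₃ → a ~ b →
               Edge (pairs (w ∷ L₁)) a b ⊎ Edge (pairs (w ∷ L₂)) a b ⊎ Edge (pairs (w ∷ L₃)) a b
      edge₁  : ∀ {a b} → (a , b) ∈ pairs (w ∷ L₁) → a ~ b
      edge₂  : ∀ {a b} → (a , b) ∈ pairs (w ∷ L₂) → a ~ b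
      edge₃  : ∀ {a b} → (a , b) ∈ pairs (w ∷ L₃) → a ~ b
      cross  : ∀ {a q} → a ∈ w ∷ L₁ ++ L₂ ++ L₃ → q ∈ Q → a ~ q → (a ≡ e₁ × q ≡ x) ⊎ (a ≡ e₂ × q ≡ y) ⊎ (a ≡ e₃ × q ≡ z)
  open Legs public

  pairs-leg⁻ : ∀ {w L e x} {a b : V} → Ends (w ∷ L) e → (a , b) ∈ pairs (w ∷ L ++ [ x ]) → (a , b) ∈ pairs (w ∷ L) ⊎ (a ≡ e × b ≡ x)
  pairs-leg⁻ {w} {L} {e} {x} en m with pairs-++⁻ {xs = w ∷ L} {[ x ]} m
  ... | inj₁ p = inj₁ p
  ... | inj₂ (inj₂ (en' , (_ , refl))) = inj₂ (ends-unique en' en , refl)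

  -- The hole subdivides the triangle xyz and the legs subdivide the spokes at `w`. The conditions
  -- in `Legs` and `Hole` leave no further edge, so the subdivision is induced.
  hasISK4 : ∀ {Q x y z w L₁ L₂ L₃} → Hole Q → x ∈ Q → y ∈ Q → z ∈ Q → x ≢ y → x ≢ z → y ≢ z →
    Legs Q x y z w L₁ L₂ L₃ → HasISK4 R
  hasISK4 {Q} {x} {y} {z} {w} {L₁} {L₂} {L₃} hole mx my mz xy xz yz T with hole-at₃ hole mx my mz xy xz yz
  ... | A , B , C , hole' , sm = length X , K .graph , K .subdiv , lookup X , lookup-injective unX , adj
    where
    -- The vertices appear in the order in which `sk4-path` inserts them: the arcs A, B, C, then the
    -- three legs, each reversed onto the front.
    X = L₃ ʳ++ (L₂ ʳ++ (L₁ ʳ++ (C ʳ++ (B ʳ++ (A ʳ++ (w ∷ x ∷ y ∷ z ∷ []))))))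
    Q' = x ∷ A ++ y ∷ B ++ z ∷ C
    Tr = w ∷ L₁ ++ L₂ ++ L₃
    rev : ∀ (xs : List V) {ys zs} → ys ↭ zs → xs ʳ++ ys ↭ xs ++ zs
    rev xs p = ↭-trans (↭-sym (Perm.++↭ʳ++ xs _)) (Perm.++⁺ˡ xs p)
    module S = CMSolver (Perm.++-commutativeMonoid {A = V})
    perm : X ↭ Tr ++ Q'
    perm = ↭-trans (rev L₃ (rev L₂ (rev L₁ (rev C (rev B (rev A ↭-refl))))))
      (S.solve 10 (λ l₃ l₂ l₁ c b a w x y z → l₃ S.⊕ (l₂ S.⊕ (l₁ S.⊕ (c S.⊕ (b S.⊕ (a S.⊕ (w S.⊕ (x S.⊕ (y S.⊕ z))))))))
        S.⊜ (w S.⊕ (l₁ S.⊕ (l₂ S.⊕ l₃))) S.⊕ (x S.⊕ (a S.⊕ (y S.⊕ (b S.⊕ (z S.⊕ c)))))) ↭-refl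
        L₃ L₂ L₁ C B A [ w ] [ x ] [ y ] [ z ])
    unX : Unique X
    unX = unique-resp (↭-sym perm) (unique-join (T .uniqᵀ) (hole' .uniqᴴ) (λ p q → T .offQ p (proj₂ sm q)))
    u₅ = unique-ʳ++ L₃ unX
    u₄ = unique-ʳ++ L₂ u₅
    u₃ = unique-ʳ++ L₁ u₄
    u₂ = unique-ʳ++ C u₃
    u₁ = unique-ʳ++ B u₂
    K = sk4-path L₃ unX (sk4-path L₂ u₅ (sk4-path L₁ u₄ (sk4-path C u₃ (sk4-path B u₂ (sk4-path A u₁ (sk4-base (unique-ʳ++ A u₁)))))))
    P₁ = pairs (x ∷ A ++ [ y ])
    P₂ = pairs (y ∷ B ++ [ z ])
    P₃ = pairs (z ∷ C ++ [ x ])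
    P₄ = pairs (w ∷ L₁ ++ [ x ])
    P₅ = pairs (w ∷ L₂ ++ [ y ])
    P₆ = pairs (w ∷ L₃ ++ [ z ])
    E = ((((P₁ ++ P₂) ++ P₃) ++ P₄) ++ P₅) ++ P₆
    cycEq : cyc Q' ≡ P₁ ++ P₂ ++ P₃
    cycEq = trans (cyc-arcs x A y (B ++ z ∷ C)) (cong (P₁ ++_) (trans (cong (λ l → pairs (y ∷ l)) (L.++-assoc B (z ∷ C) [ x ])) (pairs-split (y ∷ B))))
    in₄ : ∀ {p} → p ∈ P₄ → p ∈ E
    in₄ m = ∈-++⁺ˡ (∈-++⁺ˡ (∈-++⁺ʳ ((P₁ ++ P₂) ++ P₃) m))
    in₅ : ∀ {p} → p ∈ P₅ → p ∈ E
    in₅ m = ∈-++⁺ˡ (∈-++⁺ʳ (((P₁ ++ P₂) ++ P₃) ++ P₄) m)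
    in₆ : ∀ {p} → p ∈ P₆ → p ∈ E
    in₆ m = ∈-++⁺ʳ ((((P₁ ++ P₂) ++ P₃) ++ P₄) ++ P₅) m
    inQ : ∀ {p} → p ∈ cyc Q' → p ∈ E
    inQ {p} m = ∈-++⁺ˡ (∈-++⁺ˡ (∈-++⁺ˡ (subst (p ∈_) (trans cycEq (sym (L.++-assoc P₁ P₂ P₃))) m)))
    leg : ∀ {L x a b} → Edge (pairs (w ∷ L)) a b → Edge (pairs (w ∷ L ++ [ x ])) a b
    leg {L} = Edge-mono (pairs-++ˡ {xs = w ∷ L})
    tree : ∀ {a b} → a ∈ Tr → b ∈ Tr → a ~ b → Edge E a b
    tree p q s with T .onlyᵀ p q s
    ... | inj₁ e = Edge-mono in₄ (leg {L₁} e)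
    ... | inj₂ (inj₁ e) = Edge-mono in₅ (leg {L₂} e)
    ... | inj₂ (inj₂ e) = Edge-mono in₆ (leg {L₃} e)
    crs : ∀ {a q} → a ∈ Tr → q ∈ Q → a ~ q → Edge E a q
    crs p q s with T .cross p q s
    ... | inj₁ (refl , refl) = inj₁ (in₄ (pairs-bridge {xs = w ∷ L₁} (T .end₁) ([] , refl)))
    ... | inj₂ (inj₁ (refl , refl)) = inj₁ (in₅ (pairs-bridge {xs = w ∷ L₂} (T .end₂) ([] , refl)))
    ... | inj₂ (inj₂ (refl , refl)) = inj₁ (in₆ (pairs-bridge {xs = w ∷ L₃} (T .end₃) ([] , refl)))
    fw' : ∀ {a b} → a ∈ X → b ∈ X → a ~ b → Edge E a b
    fw' p q s with ∈-++⁻ Tr (Perm.∈-resp-↭ perm p) | ∈-++⁻ Tr (Perm.∈-resp-↭ perm q)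
    ... | inj₁ p' | inj₁ q' = tree p' q' s
    ... | inj₁ p' | inj₂ q' = crs p' (proj₂ sm q') s
    ... | inj₂ p' | inj₁ q' = Edge-sym (crs q' (proj₂ sm p') (~-sym s))
    ... | inj₂ p' | inj₂ q' = Edge-mono inQ (hole' .onlyᴴ p' q' s)
    isE : ∀ {a b} → (a , b) ∈ E → a ~ b
    isE m with ∈-++⁻ ((((P₁ ++ P₂) ++ P₃) ++ P₄) ++ P₅) m
    isE m | inj₂ m₆ with pairs-leg⁻ {L = L₃} (T .end₃) m₆
    ... | inj₁ k = T .edge₃ k
    ... | inj₂ (refl , refl) = T .e₃~z
    isE m | inj₁ m₅ with ∈-++⁻ (((P₁ ++ P₂) ++ P₃) ++ P₄) m₅
    isE m | inj₁ m₅ | inj₂ k' with pairs-leg⁻ {L = L₂} (T .end₂) k'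
    ... | inj₁ k = T .edge₂ k
    ... | inj₂ (refl , refl) = T .e₂~y
    isE m | inj₁ m₅ | inj₁ m₄ with ∈-++⁻ ((P₁ ++ P₂) ++ P₃) m₄
    isE m | inj₁ m₅ | inj₁ m₄ | inj₂ k' with pairs-leg⁻ {L = L₁} (T .end₁) k'
    ... | inj₁ k = T .edge₁ k
    ... | inj₂ (refl , refl) = T .e₁~x
    isE {a} {b} m | inj₁ m₅ | inj₁ m₄ | inj₁ m₃ = hole' .edgeᴴ (subst ((a , b) ∈_) (trans (L.++-assoc P₁ P₂ P₃) (sym cycEq)) m₃)
    adj : ∀ i j → R (lookup X i) (lookup X j) ≡ K .graph i j
    adj i j = bool-ext (λ s → K .edge⁺ i j (fw' (∈-lookup i) (∈-lookup j) s)) (λ h → bw (K .edge⁻ i j h))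
      where
      bw : Edge E (lookup X i) (lookup X j) → lookup X i ~ lookup X j
      bw (inj₁ m) = isE m
      bw (inj₂ m) = ~-sym (isE m)

  -- Two of the three legs consist of `w` alone, which sees x and y itself.
  hasISK4-path : ∀ {Q x y z w L e} → Hole Q → x ∈ Q → y ∈ Q → z ∈ Q → x ≢ y → x ≢ z → y ≢ z →
    Path (w ∷ L) → Ends (w ∷ L) e → (∀ {a} → a ∈ w ∷ L → a ∉ Q) → w ~ x → w ~ y → e ~ z →
    (∀ {a q} → a ∈ w ∷ L → q ∈ Q → a ~ q → (a ≡ w × q ≡ x) ⊎ (a ≡ w × q ≡ y) ⊎ (a ≡ e × q ≡ z)) → HasISK4 R
  hasISK4-path {w = w} {L} hole mx my mz xy xz yz p en off wx wy ez cr = hasISK4 {L₁ = []} {[]} {L} hole mx my mz xy xz yz record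
    { end₁ = [] , refl ; end₂ = [] , refl ; end₃ = en ; e₁~x = wx ; e₂~y = wy ; e₃~z = ez
    ; uniqᵀ = p .uniq ; offQ = off ; onlyᵀ = λ u v s → inj₂ (inj₂ (p .only u v s))
    ; edge₁ = λ () ; edge₂ = λ () ; edge₃ = p .edge ; cross = cr }

-- Connected sets attached to a hole

-- Length is the measure of the induction on attached sets. Only the smaller list has to be free of
-- repetitions; the larger one may contain some.
unique-smaller : ∀ {A : Set} {xs ys : List A} {y} → Unique xs → (∀ {a} → a ∈ xs → a ∈ ys) → y ∈ ys → y ∉ xs → length xs < length ys
unique-smaller u sub m n = unique-⊆-length (unique-cons n u) (λ { (here refl) → m ; (there q) → sub q })

∈-∷ʳ⁻ : ∀ {A : Set} xs {x y : A} → x ∈ xs ++ [ y ] → x ∈ xs ⊎ x ≡ y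
∈-∷ʳ⁻ xs m with ∈-++⁻ xs m
... | inj₁ p = inj₁ p
... | inj₂ (here e) = inj₂ e

edge-head : ∀ {A : Set} {x y : A} {l a} → Unique (x ∷ y ∷ l) → Edge (pairs (x ∷ y ∷ l)) a x → a ≡ y
edge-head ((n ∷ _) ∷ u) (inj₁ (here refl)) = ⊥-elim (n refl)
edge-head {l = l} (p ∷ u) (inj₁ (there m)) = ⊥-elim (All.lookup p (proj₂ (pairs-∈ {l = _ ∷ l} m)) refl)
edge-head u (inj₂ (here refl)) = refl
edge-head {l = l} (p ∷ u) (inj₂ (there m)) = ⊥-elim (All.lookup p (proj₁ (pairs-∈ {l = _ ∷ l} m)) refl)

module Attachments {n : ℕ} (R : Adj n) (isg : IsGraph R) (noISK4 : ¬ HasISK4 R) (noWheel : ¬ HasWheel R) where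
  open Graph R isg
  open Subdivisions R isg

  hole-path′ : ∀ {xs ys c} → Hole (xs ++ ys) → c ∈ xs → Path ys
  hole-path′ {x ∷ xs} H _ = hole-path {x} {xs} H

  record Spot (Q : List V) (x y z : V) : Set where
    constructor spot
    field
      hole : Hole Q
      mx   : x ∈ Q
      my   : y ∈ Q
      mz   : z ∈ Q
      xy   : x ≢ y
      xz   : x ≢ z
      yz   : y ≢ z
  open Spot public

  spot-swap : ∀ {Q x y z} → Spot Q x y z → Spot Q y x z
  spot-swap (spot h a b c p q r) = spot h b a c (≢-sym p) r q

  spot-flip : ∀ {Q x y z} → Spot Q x y z → Spot Q x z y
  spot-flip (spot h a b c p q r) = spot h a c b q p (≢-sym r)

  -- The only edges of a hole are those of its cycle. With z on the other side, an edge xy can only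
  -- be the whole arc from x to y that avoids z.
  arc-empty : ∀ {x A y B z C} → Hole (x ∷ A ++ y ∷ B ++ z ∷ C) → x ~ y → A ≡ []
  arc-empty {A = []} H e = refl
  arc-empty {x} {a ∷ A} {y} {B} {z} {C} H e = ⊥-elim (go (H .onlyᴴ (here refl) (there (∈-++⁺ʳ (a ∷ A) (here refl))) e))
    where
    u = H .uniqᴴ
    eq : cyc (x ∷ (a ∷ A) ++ y ∷ B ++ z ∷ C) ≡ pairs (x ∷ (a ∷ A) ++ [ y ]) ++ pairs (y ∷ B ++ [ z ]) ++ pairs (z ∷ C ++ [ x ])
    eq = trans (cyc-arcs x (a ∷ A) y (B ++ z ∷ C)) (cong (pairs (x ∷ (a ∷ A) ++ [ y ]) ++_) (trans (cong (λ l → pairs (y ∷ l)) (L.++-assoc B (z ∷ C) [ x ])) (pairs-split (y ∷ B))))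
    y∉ : y ∉ z ∷ C
    y∉ m = U.Unique[x∷xs]⇒x∉xs (unique-++ʳ (x ∷ (a ∷ A)) u) (∈-++⁺ʳ B m)
    x∉ : x ∉ (a ∷ A) ++ y ∷ B ++ z ∷ C
    x∉ m = U.Unique[x∷xs]⇒x∉xs u m
    go : Edge (cyc (x ∷ (a ∷ A) ++ y ∷ B ++ z ∷ C)) x y → ⊥
    go m with Edge-++⁻ (pairs (x ∷ (a ∷ A) ++ [ y ])) (subst (λ E → Edge E x y) eq m)
    ... | inj₁ k with Edge-inner {C = A} k
    ... | inj₁ p = x∉ (∈-++⁺ˡ p)
    ... | inj₂ p = unique-disjoint (unique-++ʳ [ x ] u) p (here refl)
    go m | inj₂ k with Edge-++⁻ (pairs (y ∷ B ++ [ z ])) k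
    ... | inj₁ k' = x∉ (∈-++⁺ʳ (a ∷ A) (∈-prefix (y ∷ B) (proj₁ (Edge-∈ {l = y ∷ B ++ [ z ]} k'))))
    ... | inj₂ k' with ∈-∷ʳ⁻ (z ∷ C) (proj₂ (Edge-∈ {l = z ∷ C ++ [ x ]} k'))
    ... | inj₁ q = y∉ q
    ... | inj₂ refl = x∉ (∈-++⁺ʳ (a ∷ A) (here refl))

  -- By `arc-empty` all three arcs would be empty and the hole would have three vertices.
  not-triangle : ∀ {Q x y z} → Spot Q x y z → x ~ y → x ~ z → y ~ z → ⊥
  not-triangle {Q} {x} {y} {z} s exy exz eyz with hole-at₃ (s .hole) (s .mx) (s .my) (s .mz) (s .xy) (s .xz) (s .yz)
  ... | A , B , C , H , _ with arc-empty {x} {A} {y} {B} {z} {C} H exy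
  ... | refl with arc-empty {y} {B} {z} {C} {x} {[]} (subst (λ l → Hole (y ∷ l)) (L.++-assoc B (z ∷ C) [ x ]) (hole-rotate [ x ] H)) eyz
  ... | refl with arc-empty {z} {C} {x} {[]} {y} {[]} (hole-rotate (x ∷ y ∷ []) H) (~-sym exz)
  ... | refl with H .long
  ... | s≤s (s≤s (s≤s ()))

  -- The tree shape of an attached set: a path joining x to y with a branch at `g` leading to z.
  -- Taking `g` as centre, the first half of the path is read backwards to become a leg.
  claw : ∀ {Q x y z L₁ g L₂ L₃ h e e₃} → Spot Q x y z → Path (L₁ ++ g ∷ L₂) → Starts (L₁ ++ g ∷ L₂) h → Ends (L₁ ++ g ∷ L₂) e →
    Path (g ∷ L₃) → Ends (g ∷ L₃) e₃ → (∀ {a} → a ∈ L₃ → a ∉ L₁ ++ g ∷ L₂) →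
    (∀ {a b} → a ∈ L₁ ++ g ∷ L₂ → b ∈ L₃ → a ~ b → a ≡ g) →
    (∀ {a} → a ∈ L₁ ++ g ∷ L₂ → a ∉ Q) → (∀ {a} → a ∈ L₃ → a ∉ Q) →
    h ~ x → e ~ y → e₃ ~ z →
    (∀ {a q} → a ∈ L₁ ++ g ∷ L₂ → q ∈ Q → a ~ q → (a ≡ h × q ≡ x) ⊎ (a ≡ e × q ≡ y) ⊎ (a ≡ e₃ × q ≡ z)) →
    (∀ {a q} → a ∈ L₃ → q ∈ Q → a ~ q → a ≡ e₃ × q ≡ z) → ⊥
  claw {Q} {x} {y} {z} {L₁} {g} {L₂} {L₃} {h} {e} {e₃} s p st en p₃ en₃ dis cr off off₃ hx ey ez lab lab₃ =
    noISK4 (hasISK4 {L₁ = reverse L₁} {L₂} {L₃} (s .hole) (s .mx) (s .my) (s .mz) (s .xy) (s .xz) (s .yz) record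
      { end₁ = end1 ; end₂ = ends-suffix L₁ en ; end₃ = en₃ ; e₁~x = hx ; e₂~y = ey ; e₃~z = ez
      ; uniqᵀ = unT ; offQ = λ m → offT (mem m) ; onlyᵀ = λ a b → on (mem a) (mem b)
      ; edge₁ = λ {a} {b} m → ~-sym (p .edge (subst (λ l → (b , a) ∈ pairs l) eqL (pairs-++ˡ (subst (λ l → (b , a) ∈ pairs l) (trans (cong reverse (sym rv)) (L.reverse-involutive (L₁ ++ [ g ]))) (pairs-reverse m)))))
      ; edge₂ = λ m → p .edge (pairs-++ʳ L₁ m) ; edge₃ = p₃ .edge
      ; cross = λ m → crs (mem m) })
    where
    eqL : (L₁ ++ [ g ]) ++ L₂ ≡ L₁ ++ g ∷ L₂
    eqL = L.++-assoc L₁ [ g ] L₂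
    rv : reverse (L₁ ++ [ g ]) ≡ g ∷ reverse L₁
    rv = L.reverse-++ L₁ [ g ]
    end1 : Ends (g ∷ reverse L₁) h
    end1 = subst (λ l → Ends l h) rv (ends-reverse (starts-prefix L₁ st))
    Tr = g ∷ reverse L₁ ++ L₂ ++ L₃
    mem : ∀ {a} → a ∈ Tr → a ∈ L₁ ++ g ∷ L₂ ⊎ a ∈ L₃
    mem (here e) = inj₁ (∈-++⁺ʳ L₁ (here e))
    mem (there m) with ∈-++⁻ (reverse L₁) m
    ... | inj₁ q = inj₁ (∈-++⁺ˡ (∈-reverse⁻ {l = L₁} q))
    ... | inj₂ q with ∈-++⁻ L₂ q
    ... | inj₁ r = inj₁ (∈-++⁺ʳ L₁ (there r))
    ... | inj₂ r = inj₂ r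
    offT : ∀ {a} → a ∈ L₁ ++ g ∷ L₂ ⊎ a ∈ L₃ → a ∉ Q
    offT (inj₁ m) = off m
    offT (inj₂ m) = off₃ m
    module S = CMSolver (Perm.++-commutativeMonoid {A = V})
    unT : Unique Tr
    unT = unique-resp (↭-trans (S.solve 4 (λ a b c d → (a S.⊕ (b S.⊕ c)) S.⊕ d S.⊜ a S.⊕ (b S.⊕ (c S.⊕ d))) ↭-refl L₁ [ g ] L₂ L₃)
            (↭-trans (Perm.++⁺ʳ ([ g ] ++ L₂ ++ L₃) (↭-sym (Perm.↭-reverse L₁))) (Perm.shift g (reverse L₁) (L₂ ++ L₃))))
          (unique-join (p .uniq) (unique-++ʳ [ g ] (p₃ .uniq)) (λ a b → dis b a))
    eqP : pairs (L₁ ++ g ∷ L₂) ≡ pairs (L₁ ++ [ g ]) ++ pairs (g ∷ L₂)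
    eqP = pairs-split L₁
    g₃ : ∀ {a b} → a ∈ L₁ ++ g ∷ L₂ → b ∈ L₃ → a ~ b → Edge (pairs (g ∷ L₃)) a b
    g₃ q r e with cr q r e
    ... | refl = p₃ .only (here refl) (there r) e
    on : ∀ {a b} → a ∈ L₁ ++ g ∷ L₂ ⊎ a ∈ L₃ → b ∈ L₁ ++ g ∷ L₂ ⊎ b ∈ L₃ → a ~ b →
      Edge (pairs (g ∷ reverse L₁)) a b ⊎ Edge (pairs (g ∷ L₂)) a b ⊎ Edge (pairs (g ∷ L₃)) a b
    on {a} {b} (inj₁ q) (inj₁ r) e with Edge-++⁻ (pairs (L₁ ++ [ g ])) (subst (λ E → Edge E a b) eqP (p .only q r e))
    ... | inj₁ k = inj₁ (subst (λ l → Edge (pairs l) a b) rv (Edge-reverse k))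
    ... | inj₂ k = inj₂ (inj₁ k)
    on (inj₁ q) (inj₂ r) e = inj₂ (inj₂ (g₃ q r e))
    on (inj₂ q) (inj₁ r) e = inj₂ (inj₂ (Edge-sym (g₃ r q (~-sym e))))
    on (inj₂ q) (inj₂ r) e = inj₂ (inj₂ (p₃ .only (there q) (there r) e))
    crs : ∀ {a q} → a ∈ L₁ ++ g ∷ L₂ ⊎ a ∈ L₃ → q ∈ Q → a ~ q → (a ≡ h × q ≡ x) ⊎ (a ≡ e × q ≡ y) ⊎ (a ≡ e₃ × q ≡ z)
    crs (inj₁ m) q e = lab m q e
    crs (inj₂ m) q e = inj₂ (inj₂ (lab₃ m q e))

  -- The path shape of an attached set. The neighbours of z on it are left unrestricted; their
  -- number decides between `ear-one` and `ear-many`.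
  record Ear (Q : List V) (x y z : V) (l : List V) : Set where
    field
      {first last} : V
      path   : Path l
      start  : Starts l first
      end    : Ends l last
      off    : ∀ {a} → a ∈ l → a ∉ Q
      atx    : first ~ x
      onlyx  : ∀ {a} → a ∈ l → a ~ x → a ≡ first
      aty    : last ~ y
      onlyy  : ∀ {a} → a ∈ l → a ~ y → a ≡ last
      atts   : ∀ {a q} → a ∈ l → q ∈ Q → a ~ q → q ≡ x ⊎ q ≡ y ⊎ q ≡ z

  -- A single neighbour `g` of z makes the ear a `claw` whose third branch is `g` alone.
  ear-one : ∀ {Q x y z L₁ g L₂} → Spot Q x y z → Ear Q x y z (L₁ ++ g ∷ L₂) → g ~ z →
    (∀ {a} → a ∈ L₁ ++ g ∷ L₂ → a ~ z → a ≡ g) → ⊥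
  ear-one {Q} {x} {y} {z} {L₁} {g} {L₂} s E gz onlyz = claw {L₁ = L₁} {g} {L₂} {[]} s path start end (path-single g) ([] , refl) (λ ()) (λ _ ())
      off (λ ()) atx aty gz lab (λ ())
    where
    open Ear E
    lab : ∀ {a q} → a ∈ L₁ ++ g ∷ L₂ → q ∈ Q → a ~ q → (a ≡ first × q ≡ x) ⊎ (a ≡ last × q ≡ y) ⊎ (a ≡ g × q ≡ z)
    lab m q e with atts m q e
    ... | inj₁ refl = inj₁ (onlyx m e , refl)
    ... | inj₂ (inj₁ refl) = inj₂ (inj₁ (onlyy m e , refl))
    ... | inj₂ (inj₂ refl) = inj₂ (inj₂ (onlyz m e , refl))

  -- With two or more neighbours of z on the ear, replace the arc of Q through z by the ear and let z be the hub.
  ear-many : ∀ {Q x y z L₁ g M g' L₂} → Spot Q x y z → Ear Q x y z (L₁ ++ g ∷ M ++ g' ∷ L₂) → g ~ z → g' ~ z →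
    (∀ {a} → a ∈ L₁ → ¬ a ~ z) → (∀ {a} → a ∈ M → ¬ a ~ z) → ⊥
  ear-many {Q} {x} {y} {z} {L₁} {g} {M} {g'} {L₂} s E gz g'z no₁ noM
    with hole-at₃ (s .hole) (s .mx) (s .my) (s .mz) (s .xy) (s .xz) (s .yz)
  ... | A , B , C , H , sm = final
    where
    open Ear E
    l = L₁ ++ g ∷ M ++ g' ∷ L₂
    Q' = x ∷ A ++ y ∷ B ++ z ∷ C
    N⁻ = x ∷ A ++ [ y ]
    N = reverse N⁻
    eq₁ : Q' ≡ N⁻ ++ (B ++ z ∷ C)
    eq₁ = sym (cong (x ∷_) (L.++-assoc A [ y ] (B ++ z ∷ C)))
    u = H .uniqᴴ
    disN : ∀ {a} → a ∈ N⁻ → a ∈ B ++ z ∷ C → ⊥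
    disN = unique-disjoint (subst Unique eq₁ u)
    pN⁻ : Path N⁻
    pN⁻ = hole-path′ {B ++ z ∷ C} (hole-rotate N⁻ (subst Hole eq₁ H)) (∈-++⁺ʳ B (here refl))
    pB : Path (B ++ [ z ])
    pB = hole-path′ {C ++ N⁻} (subst Hole (sym (L.++-assoc C N⁻ (B ++ [ z ])))
           (hole-rotate (N⁻ ++ (B ++ [ z ])) (subst Hole (trans eq₁ (trans (cong (N⁻ ++_) (sym (L.++-assoc B [ z ] C))) (sym (L.++-assoc N⁻ (B ++ [ z ]) C)))) H)))
         (∈-++⁺ʳ C (here refl))
    N⊆Q : ∀ {a} → a ∈ N → a ∈ Q
    N⊆Q {a} m = proj₂ sm (subst (a ∈_) (sym eq₁) (∈-++⁺ˡ (∈-reverse⁻ {l = N⁻} m)))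
    g∈ : g ∈ l
    g∈ = ∈-++⁺ʳ L₁ (here refl)
    g'∈ : g' ∈ l
    g'∈ = ∈-++⁺ʳ L₁ (there (∈-++⁺ʳ M (here refl)))
    g≢g' : g ≢ g'
    g≢g' e = U.Unique[x∷xs]⇒x∉xs (unique-++ʳ L₁ (path .uniq)) (subst (_∈ M ++ g' ∷ L₂) (sym e) (∈-++⁺ʳ M (here refl)))
    x∈N : x ∈ N
    x∈N = ∈-reverse {l = N⁻} (here refl)
    y∈N : y ∈ N
    y∈N = ∈-reverse {l = N⁻} (∈-++⁺ʳ (x ∷ A) (here refl))
    ne : ∀ {a q} → a ∈ l → q ∈ Q → a ≢ q
    ne p q refl = off p q
    lg : 4 ≤ length (l ++ N)
    lg = unique-⊆-length {xs = g ∷ g' ∷ x ∷ y ∷ []}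
      ((g≢g' ∷ ne g∈ (s .mx) ∷ ne g∈ (s .my) ∷ []) ∷ (ne g'∈ (s .mx) ∷ ne g'∈ (s .my) ∷ []) ∷ (s .xy ∷ []) ∷ [] ∷ [])
      (λ { (here refl) → ∈-++⁺ˡ g∈ ; (there (here refl)) → ∈-++⁺ˡ g'∈ ; (there (there (here refl))) → ∈-++⁺ʳ l x∈N ; (there (there (there (here refl)))) → ∈-++⁺ʳ l y∈N })
    z∉N : z ∉ N
    z∉N m = disN (∈-reverse⁻ {l = N⁻} m) (∈-++⁺ʳ B (here refl))
    crN : ∀ {a b} → a ∈ l → b ∈ N → a ~ b → (a ≡ last × b ≡ y) ⊎ (a ≡ first × b ≡ x)
    crN p q e with atts p (N⊆Q q) e
    ... | inj₁ refl = inj₂ (onlyx p e , refl)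
    ... | inj₂ (inj₁ refl) = inj₁ (onlyy p e , refl)
    ... | inj₂ (inj₂ refl) = ⊥-elim (z∉N q)
    -- The rerouted hole: the ear from x to y, closed by the arc of Q from y back to x that misses
    -- z.
    D = l ++ N
    hD : Hole D
    hD = hole-join path (path-reverse pN⁻) start end (starts-reverse {l = N⁻} (x ∷ A , refl)) (ends-reverse {l = N⁻} (A ++ [ y ] , refl)) aty (~-sym atx) lg
           (λ p q → off p (N⊆Q q)) crN
    z∉D : z ∉ D
    z∉D m with ∈-++⁻ l m
    ... | inj₁ p = off p (s .mz)
    ... | inj₂ p = z∉N p
    -- A third neighbour of z on D would make z the hub of a wheel. So `g` and `g'` are its only
    -- neighbours there; in particular z sees neither x nor y.
    wh : ∀ {c} → c ∈ D → g ≢ c → g' ≢ c → z ~ c → ⊥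
    wh m n n' e = noWheel (wheel hD z∉D (∈-++⁺ˡ g∈) (∈-++⁺ˡ g'∈) m g≢g' n n' (~-sym gz) (~-sym g'z) e)
    noz₂ : ∀ {a} → a ∈ L₂ → a ~ z → ⊥
    noz₂ m e = wh (∈-++⁺ˡ (∈-++⁺ʳ L₁ (there (∈-++⁺ʳ M (there m)))))
      (λ { refl → U.Unique[x∷xs]⇒x∉xs (unique-++ʳ L₁ (path .uniq)) (∈-++⁺ʳ M (there m)) })
      (λ { refl → U.Unique[x∷xs]⇒x∉xs (unique-++ʳ M (unique-++ʳ [ g ] (unique-++ʳ L₁ (path .uniq)))) m }) (~-sym e)
    noy : z ~ y → ⊥
    noy = wh (∈-++⁺ʳ l y∈N) (ne g∈ (s .my)) (ne g'∈ (s .my))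
    nox : z ~ x → ⊥
    nox = wh (∈-++⁺ʳ l x∈N) (ne g∈ (s .mx)) (ne g'∈ (s .mx))
    zonly : ∀ {q} → q ∈ l → z ~ q → q ≡ g ⊎ q ≡ g'
    zonly m e with ∈-++⁻ L₁ m
    ... | inj₁ p = ⊥-elim (no₁ p (~-sym e))
    ... | inj₂ (here refl) = inj₁ refl
    ... | inj₂ (there m') with ∈-++⁻ M m'
    ... | inj₁ p = ⊥-elim (noM p (~-sym e))
    ... | inj₂ (here refl) = inj₂ refl
    ... | inj₂ (there p) = ⊥-elim (noz₂ p (~-sym e))
    leg : ∀ B → B ≡ [] ⊎ ∃ (Starts B)
    leg [] = inj₁ refl
    leg (b ∷ B) = inj₂ (b , B , refl)
    cEq : cyc Q' ≡ pairs N⁻ ++ pairs (y ∷ B ++ [ z ]) ++ pairs (z ∷ C ++ [ x ])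
    cEq = trans (cyc-arcs x A y (B ++ z ∷ C)) (cong (pairs N⁻ ++_) (trans (cong (λ l → pairs (y ∷ l)) (L.++-assoc B (z ∷ C) [ x ])) (pairs-split (y ∷ B))))
    B⊆ : ∀ {a} → a ∈ z ∷ reverse B → a ∈ B ++ z ∷ C
    B⊆ (here refl) = ∈-++⁺ʳ B (here refl)
    B⊆ (there m) = ∈-++⁺ˡ (∈-reverse⁻ {l = B} m)
    inQ : ∀ {a} → a ∈ B ++ z ∷ C → a ∈ Q'
    inQ m = there (∈-++⁺ʳ A (there m))
    uB : Unique (B ++ z ∷ C)
    uB = unique-++ʳ N⁻ (subst Unique eq₁ u)
    final : ⊥
    final with leg B
    ... | inj₁ refl = noy (~-sym (H .edgeᴴ (cyc⁺ (pairs-++ʳ (x ∷ A) (here refl)))))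
    -- From the centre z two legs are trivial and end at `g` and `g'`; the third follows Q from z to
    -- `b`, the neighbour of y on that arc.
    ... | inj₂ (b , B' , refl) = noISK4 (hasISK4-path {L = reverse B} {e = b} hD (∈-++⁺ˡ g∈) (∈-++⁺ˡ g'∈) (∈-++⁺ʳ l y∈N) g≢g' (ne g∈ (s .my)) (ne g'∈ (s .my))
         pL enL offL (~-sym gz) (~-sym g'z) (~-sym (H .edgeᴴ (cyc⁺ (pairs-++ʳ (x ∷ A) (here refl))))) crL)
      where
      pL : Path (z ∷ reverse B)
      pL = subst Path (L.reverse-++ B [ z ]) (path-reverse pB)
      enL : Ends (z ∷ reverse B) b
      enL = subst (λ l → Ends l b) (L.reverse-++ B [ z ]) (ends-reverse {l = B ++ [ z ]} (B' ++ [ z ] , refl))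
      offL : ∀ {a} → a ∈ z ∷ reverse B → a ∉ D
      offL m k with ∈-++⁻ l k
      ... | inj₁ p = off p (proj₂ sm (inQ (B⊆ m)))
      ... | inj₂ p = disN (∈-reverse⁻ {l = N⁻} p) (B⊆ m)
      crL : ∀ {a q} → a ∈ z ∷ reverse B → q ∈ D → a ~ q → (a ≡ z × q ≡ g) ⊎ (a ≡ z × q ≡ g') ⊎ (a ≡ b × q ≡ y)
      crL {a} {q} m k e with ∈-++⁻ l k
      ... | inj₁ p with atts p (proj₂ sm (inQ (B⊆ m))) (~-sym e)
      ... | inj₁ refl = ⊥-elim (disN (here refl) (B⊆ m))
      ... | inj₂ (inj₁ refl) = ⊥-elim (disN (∈-++⁺ʳ (x ∷ A) (here refl)) (B⊆ m))
      ... | inj₂ (inj₂ refl) with zonly p e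
      ... | inj₁ eq = inj₁ (refl , eq)
      ... | inj₂ eq = inj₂ (inj₁ (refl , eq))
      crL {a} {q} m k e | inj₂ p with Edge-++⁻ (pairs N⁻) (subst (λ E → Edge E a q) cEq (H .onlyᴴ (inQ (B⊆ m)) (proj₁ sm (N⊆Q p)) e))
      ... | inj₁ t = ⊥-elim (disN (proj₁ (Edge-∈ t)) (B⊆ m))
      ... | inj₂ t with Edge-++⁻ (pairs (y ∷ B ++ [ z ])) t
      ... | inj₂ t' with Edge-∈ {l = z ∷ C ++ [ x ]} t'
      ... | a∈ , q∈ with ∈-∷ʳ⁻ (z ∷ C) q∈
      ... | inj₁ q∈' = ⊥-elim (disN (∈-reverse⁻ {l = N⁻} p) (∈-++⁺ʳ B q∈'))
      ... | inj₂ refl with ∈-∷ʳ⁻ (z ∷ C) a∈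
      ... | inj₂ refl = ⊥-elim (~-irrefl e refl)
      ... | inj₁ (here refl) = ⊥-elim (nox e)
      ... | inj₁ (there a∈C) with m
      ... | here refl = ⊥-elim (nox e)
      ... | there m' = ⊥-elim (unique-disjoint uB (∈-reverse⁻ {l = B} m') (there a∈C))
      crL {a} {q} m k e | inj₂ p | inj₂ t | inj₁ t' with proj₂ (Edge-∈ {l = y ∷ B ++ [ z ]} t')
      ... | there q∈ = ⊥-elim (disN (∈-reverse⁻ {l = N⁻} p) (∈-prefix B q∈))
      ... | here refl = inj₂ (inj₂ (edge-head (unique-++ˡ {xs = y ∷ B ++ [ z ]} (subst Unique (cong (y ∷_) (sym (L.++-assoc B [ z ] C))) (unique-++ʳ (x ∷ A) u))) t' , refl))

  ear-⊥ : ∀ {Q x y z l} → Spot Q x y z → Ear Q x y z l → Any (_~ z) l → ⊥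
  ear-⊥ {Q} {x} {y} {z} s E any with split-first (_~? z) any
  ... | L₁ , g , L' , refl , gz , no₁ with Any.any? (_~? z) L'
  ... | no none = ear-one {L₁ = L₁} {g} {L'} s E gz only'
    where
    only' : ∀ {a} → a ∈ L₁ ++ g ∷ L' → a ~ z → a ≡ g
    only' m e with ∈-++⁻ L₁ m
    ... | inj₁ p = ⊥-elim (no₁ p e)
    ... | inj₂ (here eq) = eq
    ... | inj₂ (there p) = ⊥-elim (none (any-∈ p e))
  ... | yes any' with split-first (_~? z) any'
  ... | M , g' , L₂ , refl , g'z , noM = ear-many {L₁ = L₁} {g} {M} {g'} {L₂} s E gz g'z no₁ noM

-- No connected set attaches to a hole at exactly three vertices

module ThreeAttachments {n : ℕ} (R : Adj n) (isg : IsGraph R) (noISK4 : ¬ HasISK4 R) (noWheel : ¬ HasWheel R) where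
  open Graph R isg
  open Subdivisions R isg
  open Attachments R isg noISK4 noWheel

  record Tail (Q : List V) (x : V) (T : List V) (t e : V) : Set where
    field
      path  : Path T
      start : Starts T t
      end   : Ends T e
      off   : ∀ {a} → a ∈ T → a ∉ Q
      atx   : e ~ x
      lab   : ∀ {a q} → a ∈ T → q ∈ Q → a ~ q → a ≡ e × q ≡ x

  -- Three pairwise touching tails are the remaining shape of an attached set: a triangle t₁, t₂, t₃
  -- with disjoint paths from its corners to x, y and z.
  record Touch (T T' : List V) (t t' : V) : Set where
    field
      dis : ∀ {a} → a ∈ T → a ∈ T' → ⊥
      t~t : t ~ t'
      cr  : ∀ {a b} → a ∈ T → b ∈ T' → a ~ b → a ≡ t × b ≡ t'

  touch-sym : ∀ {T T' t t'} → Touch T T' t t' → Touch T' T t' t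
  touch-sym t = record { dis = λ p q → dis q p ; t~t = ~-sym t~t ; cr = λ p q e → let (u , v) = cr q p (~-sym e) in v , u }
    where open Touch t

  -- Since x and y are not adjacent, the tails at x and y close up to a hole through the arc of Q containing z,
  -- and the third tail attaches to it at t₁, t₂ and z.
  tails-nonadj : ∀ {Q x y z T₁ t₁ e₁ T₂ t₂ e₂ T₃ t₃ e₃} → Spot Q x y z →
    Tail Q x T₁ t₁ e₁ → Tail Q y T₂ t₂ e₂ → Tail Q z T₃ t₃ e₃ →
    Touch T₁ T₂ t₁ t₂ → Touch T₁ T₃ t₁ t₃ → Touch T₂ T₃ t₂ t₃ → ¬ x ~ y → ⊥
  tails-nonadj {Q} {x} {y} {z} {T₁} {t₁} {e₁} {T₂} {t₂} {e₂} {T₃} {t₃} {e₃} s τ₁ τ₂ τ₃ c₁₂ c₁₃ c₂₃ x≁y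
    with hole-at₃ (s .hole) (s .mx) (s .my) (s .mz) (s .xy) (s .xz) (s .yz)
  ... | [] , B , C , H , sm = x≁y (H .edgeᴴ (here refl))
  ... | a ∷ A , B , C , H , sm = go (τ₃ .Tail.start)
    where
    module τ₁ = Tail τ₁
    module τ₂ = Tail τ₂
    module τ₃ = Tail τ₃
    module c₁₂ = Touch c₁₂
    module c₁₃ = Touch c₁₃
    module c₂₃ = Touch c₂₃
    W = y ∷ B ++ z ∷ C
    N = W ++ [ x ]
    pN : Path N
    pN = hole-path′ {a ∷ A} (subst Hole (L.++-assoc (a ∷ A) W [ x ]) (hole-rotate [ x ] H)) (here refl)
    N⊆Q : ∀ {b} → b ∈ N → b ∈ Q
    N⊆Q m with ∈-∷ʳ⁻ W m
    ... | inj₁ p = proj₂ sm (there (∈-++⁺ʳ (a ∷ A) p))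
    ... | inj₂ refl = s .mx
    z∈N : z ∈ N
    z∈N = ∈-++⁺ˡ {xs = W} (there (∈-++⁺ʳ B (here refl)))
    l = reverse T₁ ++ T₂
    pl : Path l
    pl = path-join (path-reverse τ₁.path) τ₂.path (ends-reverse τ₁.start) τ₂.start c₁₂.t~t
          (λ p q → c₁₂.dis (∈-reverse⁻ {l = T₁} p) q) (λ p q e → c₁₂.cr (∈-reverse⁻ {l = T₁} p) q e)
    t₁∈ : t₁ ∈ l
    t₁∈ = ∈-++⁺ˡ (∈-reverse (starts∈ τ₁.start))
    t₂∈ : t₂ ∈ l
    t₂∈ = ∈-++⁺ʳ (reverse T₁) (starts∈ τ₂.start)
    offl : ∀ {b} → b ∈ l → b ∉ Q
    offl m with ∈-++⁻ (reverse T₁) m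
    ... | inj₁ p = τ₁.off (∈-reverse⁻ {l = T₁} p)
    ... | inj₂ p = τ₂.off p
    ne : ∀ {b q} → b ∈ l → q ∈ Q → b ≢ q
    ne p q refl = offl p q
    t₁≢t₂ : t₁ ≢ t₂
    t₁≢t₂ = ~-irrefl c₁₂.t~t
    cr : ∀ {b q} → b ∈ l → q ∈ N → b ~ q → (b ≡ e₂ × q ≡ y) ⊎ (b ≡ e₁ × q ≡ x)
    cr p q e with ∈-++⁻ (reverse T₁) p
    ... | inj₁ p' = inj₂ (τ₁.lab (∈-reverse⁻ {l = T₁} p') (N⊆Q q) e)
    ... | inj₂ p' = inj₁ (τ₂.lab p' (N⊆Q q) e)
    lg : 4 ≤ length (l ++ N)
    lg = unique-⊆-length {xs = t₁ ∷ t₂ ∷ y ∷ z ∷ []}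
      ((t₁≢t₂ ∷ ne t₁∈ (s .my) ∷ ne t₁∈ (s .mz) ∷ []) ∷ (ne t₂∈ (s .my) ∷ ne t₂∈ (s .mz) ∷ []) ∷ (s .yz ∷ []) ∷ [] ∷ [])
      (λ { (here refl) → ∈-++⁺ˡ t₁∈ ; (there (here refl)) → ∈-++⁺ˡ t₂∈ ; (there (there (here refl))) → ∈-++⁺ʳ l (here refl) ; (there (there (there (here refl)))) → ∈-++⁺ʳ l z∈N })
    hD : Hole (l ++ N)
    hD = hole-join pl pN (starts-++ (starts-reverse τ₁.end)) (ends-++ (reverse T₁) τ₂.end) (B ++ z ∷ C ++ [ x ] , cong (y ∷_) (L.++-assoc B (z ∷ C) [ x ])) (W , refl)
           τ₂.atx (~-sym τ₁.atx) lg (λ p q → offl p (N⊆Q q)) cr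
    go : Starts T₃ t₃ → ⊥
    go (U₃ , refl) = noISK4 (hasISK4-path hD (∈-++⁺ˡ t₁∈) (∈-++⁺ˡ t₂∈) (∈-++⁺ʳ l z∈N) t₁≢t₂ (ne t₁∈ (s .mz)) (ne t₂∈ (s .mz))
        τ₃.path τ₃.end off₃ (~-sym c₁₃.t~t) (~-sym c₂₃.t~t) τ₃.atx cr₃)
      where
      off₃ : ∀ {b} → b ∈ T₃ → b ∉ l ++ N
      off₃ m k with ∈-++⁻ l k
      ... | inj₂ q = τ₃.off m (N⊆Q q)
      ... | inj₁ q with ∈-++⁻ (reverse T₁) q
      ... | inj₁ q' = c₁₃.dis (∈-reverse⁻ {l = T₁} q') m
      ... | inj₂ q' = c₂₃.dis q' m
      cr₃ : ∀ {b q} → b ∈ T₃ → q ∈ l ++ N → b ~ q → (b ≡ t₃ × q ≡ t₁) ⊎ (b ≡ t₃ × q ≡ t₂) ⊎ (b ≡ e₃ × q ≡ z)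
      cr₃ m k e with ∈-++⁻ l k
      ... | inj₂ q = inj₂ (inj₂ (τ₃.lab m (N⊆Q q) e))
      ... | inj₁ q with ∈-++⁻ (reverse T₁) q
      ... | inj₁ q' with c₁₃.cr (∈-reverse⁻ {l = T₁} q') m (~-sym e)
      ... | u , v = inj₁ (v , u)
      cr₃ m k e | inj₁ q | inj₂ q' with c₂₃.cr q' m (~-sym e)
      ... | u , v = inj₂ (inj₁ (v , u))

  -- By `not-triangle` some two of x, y, z are non-adjacent, and the configuration is symmetric in
  -- the three tails.
  tails-⊥ : ∀ {Q x y z T₁ t₁ e₁ T₂ t₂ e₂ T₃ t₃ e₃} → Spot Q x y z →
    Tail Q x T₁ t₁ e₁ → Tail Q y T₂ t₂ e₂ → Tail Q z T₃ t₃ e₃ →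
    Touch T₁ T₂ t₁ t₂ → Touch T₁ T₃ t₁ t₃ → Touch T₂ T₃ t₂ t₃ → ⊥
  tails-⊥ {x = x} {y} {z} s τ₁ τ₂ τ₃ c₁₂ c₁₃ c₂₃ with x ~? y
  ... | no ¬xy = tails-nonadj s τ₁ τ₂ τ₃ c₁₂ c₁₃ c₂₃ ¬xy
  ... | yes xy' with x ~? z
  ... | no ¬xz = tails-nonadj (spot-flip s) τ₁ τ₃ τ₂ c₁₃ c₁₂ (touch-sym c₂₃) ¬xz
  ... | yes xz' with y ~? z
  ... | no ¬yz = tails-nonadj (spot-flip (spot-swap s)) τ₂ τ₃ τ₁ c₂₃ (touch-sym c₁₂) (touch-sym c₁₃) ¬yz
  ... | yes yz' = not-triangle s xy' xz' yz'

  record Attaches (Q S : List V) (x y z : V) : Set where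
    constructor attaches
    field
      conn : Conn S
      offS : ∀ {a} → a ∈ S → a ∉ Q
      ax   : Any (_~ x) S
      ay   : Any (_~ y) S
      az   : Any (_~ z) S
      atts : ∀ {a q} → a ∈ S → q ∈ Q → a ~ q → q ≡ x ⊎ q ≡ y ⊎ q ≡ z

  attaches-swap : ∀ {Q S x y z} → Attaches Q S x y z → Attaches Q S y x z
  attaches-swap (attaches c o a b d f) = attaches c o b a d (λ p q e → sw (f p q e))
    where
    sw : ∀ {A B C : Set} → A ⊎ B ⊎ C → B ⊎ A ⊎ C
    sw (inj₁ a) = inj₂ (inj₁ a)
    sw (inj₂ (inj₁ b)) = inj₁ b
    sw (inj₂ (inj₂ c)) = inj₂ (inj₂ c)

  -- Including the vertices of `P` themselves guarantees that a path towards `P` has a target, even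
  -- when `P` is a single vertex; `link-disjoint` shows that the path stops before `P`.
  Near : List V → V → Set
  Near P u = u ∈ P ⊎ Any (_~ u) P

  near? : ∀ P → Decidable (Near P)
  near? P u with u ∈? P
  ... | yes m = yes (inj₁ m)
  ... | no n with Any.any? (_~? u) P
  ... | yes a = yes (inj₂ a)
  ... | no n' = no λ { (inj₁ m) → n m ; (inj₂ a) → n' a }

  linking-reverse : ∀ {S A B} → Linking S A B → Linking S B A
  linking-reverse K = record { list = reverse list ; path = path-reverse path ; start = starts-reverse end ; end = ends-reverse start
    ; within = λ m → within (∈-reverse⁻ {l = list} m) ; firstA = lastB ; onlyA = λ m → onlyB (∈-reverse⁻ {l = list} m)
    ; lastB = firstA ; onlyB = λ m → onlyA (∈-reverse⁻ {l = list} m) }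
    where open Linking K

  linking-map : ∀ {S A B B'} → (∀ {u} → B u → B' u) → (∀ {u} → B' u → B u) → Linking S A B → Linking S A B'
  linking-map f g K = record { list = list ; path = path ; start = start ; end = end ; within = within
    ; firstA = firstA ; onlyA = onlyA ; lastB = f lastB ; onlyB = λ m b → onlyB m (g b) }
    where open Linking K

  near-reverse : ∀ {P u} → Near P u → Near (reverse P) u
  near-reverse (inj₁ m) = inj₁ (∈-reverse m)
  near-reverse (inj₂ a) with ∈-any a
  ... | b , m , e = inj₂ (any-∈ (∈-reverse m) e)

  near-reverse⁻ : ∀ {P u} → Near (reverse P) u → Near P u
  near-reverse⁻ {P} {u} nr = subst (λ l → Near l u) (L.reverse-involutive P) (near-reverse nr)

  module _ {Q S : List V} {x y z : V} (s : Spot Q x y z) (α : Attaches Q S x y z)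
           (P : Linking S (_~ x) (_~ y)) (¬zP : ¬ Any (_~ z) (Linking.list P))
           (K : Linking S (_~ z) (Near (Linking.list P))) where

    private
      module P = Linking P
      module K = Linking K
      module α = Attaches α

    -- Only the last vertex of `K` is near `P`. If it lay on `P`, its predecessor on `K` would be
    -- near `P` as well; and if there is no predecessor, that vertex sees z, which no vertex of `P`
    -- does.
    link-disjoint : ∀ {u} → u ∈ K.list → u ∈ P.list → ⊥
    link-disjoint {u} m p with K.onlyB m (inj₁ p)
    ... | refl with K.end
    ... | i , eq with i
    ... | [] = ¬zP (any-∈ p (subst (_~ z) (starts-unique K.start ([] , eq)) K.firstA))
    ... | j ∷ js with has-end j js
    ... | e' , (k , eq') = ~-irrefl e'~ (K.onlyB (proj₁ (pairs-∈ br)) (inj₂ (any-∈ p (~-sym e'~))))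
      where
      br : (e' , u) ∈ pairs K.list
      br = subst (λ l → (e' , u) ∈ pairs l) (sym eq) (pairs-bridge {xs = j ∷ js} (k , eq') ([] , refl))
      e'~ : e' ~ u
      e'~ = K.path .edge br

    link-nbr : Any (_~ K.last) P.list
    link-nbr with K.lastB
    ... | inj₁ m = ⊥-elim (link-disjoint (ends∈ K.end) m)
    ... | inj₂ a = a

    link-cross : ∀ {a b} → a ∈ K.list → b ∈ P.list → a ~ b → a ≡ K.last
    link-cross m p e = K.onlyB m (inj₂ (any-∈ p (~-sym e)))

    -- The induction hypothesis: Q stays fixed while the attached set shrinks and the three vertices
    -- may change roles.
    Smaller : Set
    Smaller = ∀ {S' x y z} → Spot Q x y z → Attaches Q S' x y z → length S' < length S → ⊥

    link-side : Smaller → Any (_~ x) K.list → ¬ Any (_~ y) K.list → ⊥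
    link-side ih xK ¬yK with P.start
    ... | t , eqP with Any.any? (_~? K.last) t
    ... | yes anyt with ∈-any anyt
    ... | p , p∈ , pe = ih s (attaches cn of' (AnyP.++⁺ʳ t xK) (AnyP.++⁺ˡ (yt t eqP p∈)) (AnyP.++⁺ʳ t (any-∈ (starts∈ K.start) K.firstA)) at')
          (unique-smaller {y = P.first} un inS (P.within (starts∈ P.start)) h∉)
      where
      inP : ∀ {a} → a ∈ t → a ∈ P.list
      inP m = subst (_ ∈_) (sym eqP) (there m)
      pt : Path t
      pt = path-++ʳ [ P.first ] (subst Path eqP P.path)
      cn : Conn (t ++ K.list)
      cn = conn-join (path-conn pt) (path-conn K.path) p∈ (ends∈ K.end) pe
      inS : ∀ {a} → a ∈ t ++ K.list → a ∈ S
      inS m with ∈-++⁻ t m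
      ... | inj₁ q = P.within (inP q)
      ... | inj₂ q = K.within q
      of' : ∀ {a} → a ∈ t ++ K.list → a ∉ Q
      of' m = α.offS (inS m)
      at' : ∀ {a q} → a ∈ t ++ K.list → q ∈ Q → a ~ q → q ≡ x ⊎ q ≡ y ⊎ q ≡ z
      at' m = α.atts (inS m)
      un : Unique (t ++ K.list)
      un = unique-join (pt .uniq) (K.path .uniq) (λ p q → link-disjoint q (inP p))
      h∉ : P.first ∉ t ++ K.list
      h∉ m with ∈-++⁻ t m
      ... | inj₁ q = U.Unique[x∷xs]⇒x∉xs (subst Unique eqP (P.path .uniq)) q
      ... | inj₂ q = link-disjoint q (starts∈ P.start)
      yt : ∀ t → P.list ≡ P.first ∷ t → p ∈ t → Any (_~ y) t
      yt (b ∷ t) eq _ with has-end b t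
      ... | e' , en' = any-∈ (ends∈ en') (subst (_~ y) (ends-unique P.end (subst (λ l → Ends l e') (sym eq) (ends-++ [ P.first ] en'))) P.lastB)
    link-side ih xK ¬yK | t , eqP | no none with ∈-any link-nbr
    ... | p , p∈ , pe = ear-⊥ (spot-flip (spot-swap (spot-flip s))) E (AnyP.++⁺ˡ xK)
      where
      tonly : ∀ {b} → b ∈ P.list → b ~ K.last → b ≡ P.first
      tonly m e with subst (_ ∈_) eqP m
      ... | here eq = eq
      ... | there q = ⊥-elim (none (any-∈ q e))
      l = K.list ++ P.list
      inS : ∀ {a} → a ∈ l → a ∈ S
      inS m with ∈-++⁻ K.list m
      ... | inj₁ q = K.within q
      ... | inj₂ q = P.within q
      perm : ∀ {A B C : Set} → A ⊎ B ⊎ C → C ⊎ B ⊎ A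
      perm (inj₁ a) = inj₂ (inj₂ a)
      perm (inj₂ (inj₁ b)) = inj₂ (inj₁ b)
      perm (inj₂ (inj₂ c)) = inj₁ c
      oz : ∀ {a} → a ∈ l → a ~ z → a ≡ K.first
      oz m e with ∈-++⁻ K.list m
      ... | inj₁ q = K.onlyA q e
      ... | inj₂ q = ⊥-elim (¬zP (any-∈ q e))
      oy : ∀ {a} → a ∈ l → a ~ y → a ≡ P.last
      oy m e with ∈-++⁻ K.list m
      ... | inj₁ q = ⊥-elim (¬yK (any-∈ q e))
      ... | inj₂ q = P.onlyB q e
      cr : ∀ {a b} → a ∈ K.list → b ∈ P.list → a ~ b → a ≡ K.last × b ≡ P.first
      cr m q e with link-cross m q e
      ... | refl = refl , tonly q (~-sym e)
      E : Ear Q z y x l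
      E = record { path = path-join K.path P.path K.end P.start (subst (K.last ~_) (tonly p∈ pe) (~-sym pe)) link-disjoint cr
        ; start = starts-++ K.start ; end = ends-++ K.list P.end ; off = λ m → α.offS (inS m)
        ; atx = K.firstA ; onlyx = oz ; aty = P.lastB ; onlyy = oy ; atts = λ m q e → perm (α.atts (inS m) q e) }

    link-center : Smaller → ¬ Any (_~ x) K.list → ¬ Any (_~ y) K.list → ⊥
    link-center ih ¬xK ¬yK with split-first (_~? K.last) link-nbr
    ... | P₁ , p , P' , eqP , pe , no₁ with Any.any? (_~? K.last) P'
    ... | no none = claw {L₁ = P₁} {p} {P'} {reverse K.list} s (subst Path eqP P.path) (subst (λ l → Starts l P.first) eqP P.start) (subst (λ l → Ends l P.last) eqP P.end)
          (path-join (path-single p) (path-reverse K.path) ([] , refl) (starts-reverse K.end) pe (λ { (here refl) m → link-disjoint (∈-reverse⁻ {l = K.list} m) p∈ })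
            (λ { (here refl) m e → refl , link-cross (∈-reverse⁻ {l = K.list} m) p∈ (~-sym e) }))
          (ends-++ [ p ] (ends-reverse K.start))
          (λ m q → link-disjoint (∈-reverse⁻ {l = K.list} m) (inP q))
          (λ q m e → ponly (inP q) (subst (_ ~_) (link-cross (∈-reverse⁻ {l = K.list} m) (inP q) (~-sym e)) e))
          (λ m → α.offS (P.within (inP m))) (λ m → α.offS (K.within (∈-reverse⁻ {l = K.list} m)))
          P.firstA P.lastB K.firstA (λ m q e → labP (inP m) q e) (λ m q e → labK (∈-reverse⁻ {l = K.list} m) q e)
      where
      inP : ∀ {a} → a ∈ P₁ ++ p ∷ P' → a ∈ P.list
      inP m = subst (_ ∈_) (sym eqP) m
      p∈ : p ∈ P.list
      p∈ = inP (∈-++⁺ʳ P₁ (here refl))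
      ponly : ∀ {b} → b ∈ P.list → b ~ K.last → b ≡ p
      ponly m e with ∈-++⁻ P₁ (subst (_ ∈_) eqP m)
      ... | inj₁ q = ⊥-elim (no₁ q e)
      ... | inj₂ (here eq) = eq
      ... | inj₂ (there q) = ⊥-elim (none (any-∈ q e))
      labP : ∀ {a q} → a ∈ P.list → q ∈ Q → a ~ q → (a ≡ P.first × q ≡ x) ⊎ (a ≡ P.last × q ≡ y) ⊎ (a ≡ K.first × q ≡ z)
      labP m q e with α.atts (P.within m) q e
      ... | inj₁ refl = inj₁ (P.onlyA m e , refl)
      ... | inj₂ (inj₁ refl) = inj₂ (inj₁ (P.onlyB m e , refl))
      ... | inj₂ (inj₂ refl) = ⊥-elim (¬zP (any-∈ m e))
      labK : ∀ {a q} → a ∈ K.list → q ∈ Q → a ~ q → a ≡ K.first × q ≡ z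
      labK m q e with α.atts (K.within m) q e
      ... | inj₁ refl = ⊥-elim (¬xK (any-∈ m e))
      ... | inj₂ (inj₁ refl) = ⊥-elim (¬yK (any-∈ m e))
      ... | inj₂ (inj₂ refl) = K.onlyA m e , refl
    ... | yes any' with split-last (_~? K.last) any'
    ... | [] , p' , P₂ , refl , p'e , no₂ = tails-⊥ s τ₁ τ₂ τ₃ c₁₂ c₁₃ c₂₃
      where
      inP : ∀ {a} → a ∈ P₁ ++ p ∷ p' ∷ P₂ → a ∈ P.list
      inP m = subst (_ ∈_) (sym eqP) m
      uP : Unique (P₁ ++ p ∷ p' ∷ P₂)
      uP = subst Unique eqP (P.path .uniq)
      pP : Path (P₁ ++ p ∷ p' ∷ P₂)
      pP = subst Path eqP P.path
      uP' : Unique ((P₁ ++ [ p ]) ++ p' ∷ P₂)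
      uP' = subst Unique (sym (L.++-assoc P₁ [ p ] _)) uP
      p₁ : Path (P₁ ++ [ p ])
      p₁ = path-++ˡ {P₁ ++ [ p ]} (subst Path (sym (L.++-assoc P₁ [ p ] _)) pP)
      T₁ = reverse (P₁ ++ [ p ])
      in₁ : ∀ {a} → a ∈ P₁ ++ [ p ] → a ∈ P.list
      in₁ m = inP (∈-prefix P₁ m)
      in₂ : ∀ {a} → a ∈ p' ∷ P₂ → a ∈ P.list
      in₂ m = inP (∈-++⁺ʳ P₁ (there m))
      rv : ∀ {a} → a ∈ T₁ → a ∈ P₁ ++ [ p ]
      rv = ∈-reverse⁻ {l = P₁ ++ [ p ]}
      rvK : ∀ {a} → a ∈ reverse K.list → a ∈ K.list
      rvK = ∈-reverse⁻ {l = K.list}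
      st₁ : Starts (P₁ ++ [ p ]) P.first
      st₁ = starts-prefix P₁ (subst (λ l → Starts l P.first) eqP P.start)
      en₂ : Ends (p' ∷ P₂) P.last
      en₂ = ends-suffix (p ∷ []) (ends-suffix P₁ (subst (λ l → Ends l P.last) eqP P.end))
      lab₁ : ∀ {a q} → a ∈ T₁ → q ∈ Q → a ~ q → a ≡ P.first × q ≡ x
      lab₁ m q e with α.atts (P.within (in₁ (rv m))) q e
      ... | inj₁ refl = P.onlyA (in₁ (rv m)) e , refl
      ... | inj₂ (inj₂ refl) = ⊥-elim (¬zP (any-∈ (in₁ (rv m)) e))
      ... | inj₂ (inj₁ refl) with P.onlyB (in₁ (rv m)) e
      ... | refl = ⊥-elim (unique-disjoint uP' (rv m) (ends∈ en₂))
      lab₂ : ∀ {a q} → a ∈ p' ∷ P₂ → q ∈ Q → a ~ q → a ≡ P.last × q ≡ y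
      lab₂ m q e with α.atts (P.within (in₂ m)) q e
      ... | inj₂ (inj₁ refl) = P.onlyB (in₂ m) e , refl
      ... | inj₂ (inj₂ refl) = ⊥-elim (¬zP (any-∈ (in₂ m) e))
      ... | inj₁ refl with P.onlyA (in₂ m) e
      ... | refl = ⊥-elim (unique-disjoint uP' (starts∈ st₁) m)
      lab₃ : ∀ {a q} → a ∈ reverse K.list → q ∈ Q → a ~ q → a ≡ K.first × q ≡ z
      lab₃ m q e with α.atts (K.within (rvK m)) q e
      ... | inj₁ refl = ⊥-elim (¬xK (any-∈ (rvK m) e))
      ... | inj₂ (inj₁ refl) = ⊥-elim (¬yK (any-∈ (rvK m) e))
      ... | inj₂ (inj₂ refl) = K.onlyA (rvK m) e , refl
      τ₁ : Tail Q x T₁ p P.first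
      τ₁ = record { path = path-reverse p₁ ; start = starts-reverse {l = P₁ ++ [ p ]} (P₁ , refl) ; end = ends-reverse st₁
        ; off = λ m → α.offS (P.within (in₁ (rv m))) ; atx = P.firstA ; lab = lab₁ }
      τ₂ : Tail Q y (p' ∷ P₂) p' P.last
      τ₂ = record { path = path-++ʳ [ p ] (path-++ʳ P₁ pP) ; start = P₂ , refl ; end = en₂ ; off = λ m → α.offS (P.within (in₂ m)) ; atx = P.lastB ; lab = lab₂ }
      τ₃ : Tail Q z (reverse K.list) K.last K.first
      τ₃ = record { path = path-reverse K.path ; start = starts-reverse K.end ; end = ends-reverse K.start ; off = λ m → α.offS (K.within (rvK m)) ; atx = K.firstA ; lab = lab₃ }
      cr₁₂ : ∀ {a b} → a ∈ T₁ → b ∈ p' ∷ P₂ → a ~ b → a ≡ p × b ≡ p'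
      cr₁₂ {a} {b} m q e = go (Edge-++⁻ (pairs (P₁ ++ [ p ])) (subst (λ E → Edge E a b) (pairs-split P₁) (pP .only (subst (a ∈_) eqP (in₁ (rv m))) (subst (b ∈_) eqP (in₂ q)) e)))
        where
        go : Edge (pairs (P₁ ++ [ p ])) a b ⊎ Edge (pairs (p ∷ p' ∷ P₂)) a b → a ≡ p × b ≡ p'
        go (inj₁ k) = ⊥-elim (unique-disjoint uP' (proj₂ (Edge-∈ k)) q)
        go (inj₂ k) with proj₁ (Edge-∈ {l = p ∷ p' ∷ P₂} k)
        ... | there r = ⊥-elim (unique-disjoint uP' (rv m) r)
        ... | here refl = refl , edge-head (unique-++ʳ P₁ uP) (Edge-sym k)
      cr₁₃ : ∀ {a b} → a ∈ T₁ → b ∈ reverse K.list → a ~ b → a ≡ p × b ≡ K.last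
      cr₁₃ m q e with link-cross (rvK q) (in₁ (rv m)) (~-sym e)
      ... | refl with ∈-∷ʳ⁻ P₁ (rv m)
      ... | inj₁ r = ⊥-elim (no₁ r e)
      ... | inj₂ r = r , refl
      cr₂₃ : ∀ {a b} → a ∈ p' ∷ P₂ → b ∈ reverse K.list → a ~ b → a ≡ p' × b ≡ K.last
      cr₂₃ m q e with link-cross (rvK q) (in₂ m) (~-sym e)
      cr₂₃ (here eq) q e | refl = eq , refl
      cr₂₃ (there r) q e | refl = ⊥-elim (no₂ r e)
      c₁₂ : Touch T₁ (p' ∷ P₂) p p'
      c₁₂ = record { dis = λ m q → unique-disjoint uP' (rv m) q ; t~t = pP .edge (pairs-++ʳ P₁ (here refl)) ; cr = cr₁₂ }
      c₁₃ : Touch T₁ (reverse K.list) p K.last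
      c₁₃ = record { dis = λ m q → link-disjoint (rvK q) (in₁ (rv m)) ; t~t = pe ; cr = cr₁₃ }
      c₂₃ : Touch (p' ∷ P₂) (reverse K.list) p' K.last
      c₂₃ = record { dis = λ m q → link-disjoint (rvK q) (in₂ m) ; t~t = p'e ; cr = cr₂₃ }
    ... | m ∷ M , p' , P₂ , refl , p'e , no₂ = ih s (attaches cn (λ q → α.offS (inS q)) (AnyP.++⁺ˡ (any-∈ (starts∈ st₁) P.firstA))
          (AnyP.++⁺ʳ (P₁ ++ [ p ]) (AnyP.++⁺ʳ K.list (any-∈ (ends∈ en₂) P.lastB))) (AnyP.++⁺ʳ (P₁ ++ [ p ]) (AnyP.++⁺ˡ (any-∈ (starts∈ K.start) K.firstA)))
          (λ q → α.atts (inS q)))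
          (unique-smaller {y = m} un inS (P.within (inP m∈)) m∉)
      where
      l = P₁ ++ p ∷ m ∷ M ++ p' ∷ P₂
      S' = (P₁ ++ [ p ]) ++ (K.list ++ p' ∷ P₂)
      inP : ∀ {a} → a ∈ l → a ∈ P.list
      inP q = subst (_ ∈_) (sym eqP) q
      m∈ : m ∈ l
      m∈ = ∈-++⁺ʳ P₁ (there (here refl))
      pP : Path l
      pP = subst Path eqP P.path
      p₁ : Path (P₁ ++ [ p ])
      p₁ = path-++ˡ {P₁ ++ [ p ]} (subst Path (sym (L.++-assoc P₁ [ p ] _)) pP)
      p₂ : Path (p' ∷ P₂)
      p₂ = path-++ʳ (p ∷ m ∷ M) (path-++ʳ P₁ pP)
      uP' : Unique ((P₁ ++ [ p ]) ++ m ∷ M ++ p' ∷ P₂)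
      uP' = subst Unique (sym (L.++-assoc P₁ [ p ] _)) (pP .uniq)
      in₁ : ∀ {a} → a ∈ P₁ ++ [ p ] → a ∈ P.list
      in₁ q = inP (∈-prefix P₁ q)
      in₂ : ∀ {a} → a ∈ p' ∷ P₂ → a ∈ P.list
      in₂ q = inP (∈-++⁺ʳ P₁ (there (there (∈-++⁺ʳ M q))))
      st₁ : Starts (P₁ ++ [ p ]) P.first
      st₁ = starts-prefix P₁ (subst (λ l → Starts l P.first) eqP P.start)
      en₂ : Ends (p' ∷ P₂) P.last
      en₂ = ends-suffix (p ∷ m ∷ M) (ends-suffix P₁ (subst (λ l → Ends l P.last) eqP P.end))
      inS : ∀ {a} → a ∈ S' → a ∈ S
      inS q with ∈-++⁻ (P₁ ++ [ p ]) q
      ... | inj₁ r = P.within (in₁ r)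
      ... | inj₂ r with ∈-++⁻ K.list r
      ... | inj₁ t = K.within t
      ... | inj₂ t = P.within (in₂ t)
      cn : Conn S'
      cn = conn-join (path-conn p₁) (conn-join (path-conn K.path) (path-conn p₂) (ends∈ K.end) (here refl) (~-sym p'e))
             (∈-++⁺ʳ P₁ (here refl)) (∈-++⁺ˡ (ends∈ K.end)) pe
      un : Unique S'
      un = unique-join (p₁ .uniq) (unique-join (K.path .uniq) (p₂ .uniq) (λ a b → link-disjoint a (in₂ b)))
             λ a b → [ (λ b' → link-disjoint b' (in₁ a)) , (λ b' → unique-disjoint uP' a (there (∈-++⁺ʳ M b'))) ]′ (∈-++⁻ K.list b)
      m∉ : m ∉ S'
      m∉ q with ∈-++⁻ (P₁ ++ [ p ]) q
      ... | inj₁ r = unique-disjoint uP' r (here refl)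
      ... | inj₂ r with ∈-++⁻ K.list r
      ... | inj₁ t = link-disjoint t (inP m∈)
      ... | inj₂ t = U.Unique[x∷xs]⇒x∉xs (unique-++ʳ (P₁ ++ [ p ]) uP') (∈-++⁺ʳ M t)

  -- Induction on the length of `S`. A path `P` links neighbours of x and y. If z sees `P`, it is an
  -- ear; if not, a second path `K` leads from a neighbour of z to the vicinity of `P`, and the
  -- cases ask whether `K` sees x or y.
  no-three-attachments : ∀ {Q S x y z} → Spot Q x y z → Attaches Q S x y z → ⊥
  no-three-attachments {Q} {S} = go (suc (length S)) ℕ.≤-refl
    where
    go : ∀ k {S x y z} → length S < k → Spot Q x y z → Attaches Q S x y z → ⊥
    go (suc k) {S} {x} {y} {z} (s≤s lt) s α with ∈-any (Attaches.ax α) | ∈-any (Attaches.ay α) | ∈-any (Attaches.az α)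
    ... | a , a∈ , ea | b , b∈ , eb | c , c∈ , ec = main
      where
      module α = Attaches α
      ih : ∀ {S' x y z} → Spot Q x y z → Attaches Q S' x y z → length S' < length S → ⊥
      ih s α l = go k (ℕ.<-≤-trans l lt) s α
      P : Linking S (_~ x) (_~ y)
      P = linking (_~? x) (_~? y) α.conn a∈ ea b∈ eb
      module P = Linking P
      main : ⊥
      main with Any.any? (_~? z) P.list
      ... | yes zP = ear-⊥ s record { path = P.path ; start = P.start ; end = P.end ; off = λ m → α.offS (P.within m)
              ; atx = P.firstA ; onlyx = P.onlyA ; aty = P.lastB ; onlyy = P.onlyB ; atts = λ m → α.atts (P.within m) } zP
      ... | no ¬zP with linking (_~? z) (near? P.list) α.conn c∈ ec (P.within (starts∈ P.start)) (inj₁ (starts∈ P.start))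
      ... | K with Any.any? (_~? x) (Linking.list K) | Any.any? (_~? y) (Linking.list K)
      ... | yes xK | no ¬yK = link-side s α P ¬zP K ih xK ¬yK
      ... | no ¬xK | no ¬yK = link-center s α P ¬zP K ih ¬xK ¬yK
      ... | no ¬xK | yes yK = link-side (spot-swap s) (attaches-swap α) (linking-reverse P) (λ q → ¬zP (rev q)) (linking-map near-reverse near-reverse⁻ K) ih yK ¬xK
        where
        rev : Any (_~ z) (reverse P.list) → Any (_~ z) P.list
        rev q with ∈-any q
        ... | a , m , e = any-∈ (∈-reverse⁻ {l = P.list} m) e
      -- Here `K` alone is connected, attaches at all three vertices and misses the first vertex of
      -- `P`.
      ... | yes xK | yes yK = ih s (attaches (path-conn K.path) (λ m → α.offS (K.within m)) xK yK (any-∈ (starts∈ K.start) K.firstA) (λ m → α.atts (K.within m)))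
              (unique-smaller {y = P.first} (K.path .uniq) K.within (P.within (starts∈ P.start)) (λ m → link-disjoint s α P ¬zP K m (starts∈ P.start)))
        where module K = Linking K

edge-last : ∀ {A : Set} {l : List A} {z u} → Unique (l ++ [ z ]) → Edge (pairs (l ++ [ z ])) u z → Ends l u
edge-last {l = l} {z} un (inj₁ m) with pairs-++⁻ {xs = l} {[ z ]} m
... | inj₁ k = ⊥-elim (unique-disjoint un (proj₂ (pairs-∈ k)) (here refl))
... | inj₂ (inj₂ (en , _)) = en
edge-last {l = l} {z} un (inj₂ m) with pairs-++⁻ {xs = l} {[ z ]} m
... | inj₁ k = ⊥-elim (unique-disjoint un (proj₁ (pairs-∈ k)) (here refl))
... | inj₂ (inj₂ (en , _)) = ⊥-elim (unique-disjoint un (ends∈ en) (here refl))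

-- Paths with two neighbours on the hole at each end

module Flags {n : ℕ} (R : Adj n) (isg : IsGraph R) (noISK4 : ¬ HasISK4 R) (noWheel : ¬ HasWheel R) where
  open Graph R isg
  open Attachments R isg noISK4 noWheel
  open ThreeAttachments R isg noISK4 noWheel

  record K33 : Set where
    field
      a₁ a₂ a₃ b₁ b₂ b₃ : V
      a₁₂ : a₁ ≢ a₂
      a₁₃ : a₁ ≢ a₃
      a₂₃ : a₂ ≢ a₃
      b₁₂ : b₁ ≢ b₂
      b₁₃ : b₁ ≢ b₃
      b₂₃ : b₂ ≢ b₃
      ¬a₁₂ : ¬ a₁ ~ a₂
      ¬a₁₃ : ¬ a₁ ~ a₃
      ¬a₂₃ : ¬ a₂ ~ a₃
      ¬b₁₂ : ¬ b₁ ~ b₂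
      ¬b₁₃ : ¬ b₁ ~ b₃
      ¬b₂₃ : ¬ b₂ ~ b₃
      e₁₁ : a₁ ~ b₁
      e₁₂ : a₁ ~ b₂
      e₁₃ : a₁ ~ b₃
      e₂₁ : a₂ ~ b₁
      e₂₂ : a₂ ~ b₂
      e₂₃ : a₂ ~ b₃
      e₃₁ : a₃ ~ b₁
      e₃₂ : a₃ ~ b₂
      e₃₃ : a₃ ~ b₃

  square : ∀ {a b c d} → a ~ b → b ~ c → c ~ d → d ~ a → a ≢ c → b ≢ d → ¬ a ~ c → ¬ b ~ d → Hole (a ∷ b ∷ c ∷ d ∷ [])
  square {a} {b} {c} {d} ab bc cd da ac bd ¬ac ¬bd = record
    { uniqᴴ = (~-irrefl ab ∷ ac ∷ (λ e → ~-irrefl da (sym e)) ∷ []) ∷ (~-irrefl bc ∷ bd ∷ []) ∷ (~-irrefl cd ∷ []) ∷ [] ∷ []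
    ; long = ℕ.≤-refl ; onlyᴴ = on ; edgeᴴ = λ { (here refl) → ab ; (there (here refl)) → bc ; (there (there (here refl))) → cd ; (there (there (there (here refl)))) → da } }
    where
    0∈ : ∀ {A : Set} {x : A} {l} → x ∈ x ∷ l
    0∈ = here refl
    on : ∀ {u v} → u ∈ a ∷ b ∷ c ∷ d ∷ [] → v ∈ a ∷ b ∷ c ∷ d ∷ [] → u ~ v → Edge (cyc (a ∷ b ∷ c ∷ d ∷ [])) u v
    on (here refl) (here refl) e = ⊥-elim (~-irrefl e refl)
    on (here refl) (there (here refl)) e = inj₁ 0∈
    on (here refl) (there (there (here refl))) e = ⊥-elim (¬ac e)
    on (here refl) (there (there (there (here refl)))) e = inj₂ (there (there (there 0∈)))
    on (there (here refl)) (here refl) e = inj₂ 0∈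
    on (there (here refl)) (there (here refl)) e = ⊥-elim (~-irrefl e refl)
    on (there (here refl)) (there (there (here refl))) e = inj₁ (there 0∈)
    on (there (here refl)) (there (there (there (here refl)))) e = ⊥-elim (¬bd e)
    on (there (there (here refl))) (here refl) e = ⊥-elim (¬ac (~-sym e))
    on (there (there (here refl))) (there (here refl)) e = inj₂ (there 0∈)
    on (there (there (here refl))) (there (there (here refl))) e = ⊥-elim (~-irrefl e refl)
    on (there (there (here refl))) (there (there (there (here refl)))) e = inj₁ (there (there 0∈))
    on (there (there (there (here refl)))) (here refl) e = inj₁ (there (there (there 0∈)))
    on (there (there (there (here refl)))) (there (here refl)) e = ⊥-elim (¬bd (~-sym e))
    on (there (there (there (here refl)))) (there (there (here refl))) e = inj₂ (there (there 0∈))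
    on (there (there (there (here refl)))) (there (there (there (here refl)))) e = ⊥-elim (~-irrefl e refl)

  -- The path runs from d, which sees just x and y on Q, to t, which sees just v and z. That t lies
  -- in `S` is recorded because `S` is later chosen to avoid the third vertex of a given triangle.
  record Pinch (Q : List V) (x y v z d t : V) (S : List V) : Set where
    field
      hole   : Hole Q
      x∈     : x ∈ Q
      y∈     : y ∈ Q
      v∈     : v ∈ Q
      z∈     : z ∈ Q
      xy     : x ≢ y
      xv     : x ≢ v
      xz     : x ≢ z
      yv     : y ≢ v
      yz     : y ≢ z
      vz     : v ≢ z
      list   : List V
      path   : Path list
      start  : Starts list d
      end    : Ends list t
      off    : ∀ {a} → a ∈ list → a ∉ Q
      t∈     : t ∈ S
      d≢t    : d ≢ t
      d~x    : d ~ x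
      d~y    : d ~ y
      t~v    : t ~ v
      t~z    : t ~ z
      labels : ∀ {u q} → u ∈ list → q ∈ Q → u ~ q → (u ≡ d × (q ≡ x ⊎ q ≡ y)) ⊎ (u ≡ t × (q ≡ v ⊎ q ≡ z))

  LabIn : List V → List V → V → V → Set
  LabIn Q S v z = ∀ {u q} → u ∈ S → q ∈ Q → u ~ q → q ≡ v ⊎ q ≡ z

  Off : List V → List V → Set
  Off Q S = ∀ {u} → u ∈ S → u ∉ Q

  -- Take a path from d to the first neighbour t of v. If no vertex of it sees z, it attaches
  -- exactly at x, y, v. If some vertex before t sees z, the piece up to the first such vertex
  -- attaches exactly at x, y, z. So t is the only vertex of the path that sees z.
  pinch : ∀ {Q S x y v z d c s} → Hole Q → x ∈ Q → y ∈ Q → v ∈ Q → z ∈ Q →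
    x ≢ y → x ≢ v → x ≢ z → y ≢ v → y ≢ z → v ≢ z →
    Conn S → Off Q S → LabIn Q S v z → c ∈ S → c ~ v → d ∉ Q → s ∈ S → s ~ d →
    d ~ x → d ~ y → (∀ {q} → q ∈ Q → d ~ q → q ≡ x ⊎ q ≡ y) → ∃ λ t → Pinch Q x y v z d t S
  pinch {Q} {S} {x} {y} {v} {z} {d} {c} {s} H x∈ y∈ v∈ z∈ xy xv xz yv yz vz cS offS labS c∈ cv d∉ s∈ sd dx dy labd = go
    where
    cdS : Conn (d ∷ S)
    cdS = conn-cons cS s∈ (~-sym sd)
    K = linking {A = _≡ d} {B = _~ v} (F._≟ d) (_~? v) cdS (here refl) refl (there c∈) cv
    module K = Linking K
    l = K.list
    t = K.last
    st : Starts l d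
    st = subst (Starts l) K.firstA K.start
    inS : ∀ {u} → u ∈ l → u ≢ d → u ∈ S
    inS m ne with K.within m
    ... | here e = ⊥-elim (ne e)
    ... | there k = k
    offl : ∀ {u} → u ∈ l → u ∉ Q
    offl m with K.within m
    ... | here refl = d∉
    ... | there k = offS k
    lab : ∀ {u q} → u ∈ l → q ∈ Q → u ~ q → (u ≡ d × (q ≡ x ⊎ q ≡ y)) ⊎ (q ≡ v ⊎ q ≡ z)
    lab m q e with K.within m
    ... | here refl = inj₁ (refl , labd q e)
    ... | there k = inj₂ (labS k q e)
    d≁v : ¬ d ~ v
    d≁v e with labd v∈ e
    ... | inj₁ eq = xv (sym eq)
    ... | inj₂ eq = yv (sym eq)
    t∈S : t ∈ S
    t∈S = inS (ends∈ K.end) (λ e → d≁v (subst (_~ v) e K.lastB))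
    go : ∃ λ t → Pinch Q x y v z d t S
    go with Any.any? (_~? z) l
    ... | no none = ⊥-elim (no-three-attachments {S = l} (spot H x∈ y∈ v∈ xy xv yv)
            (attaches (path-conn K.path) offl (any-∈ (starts∈ st) dx) (any-∈ (starts∈ st) dy) (any-∈ (ends∈ K.end) K.lastB) at))
      where
      at : ∀ {u q} → u ∈ l → q ∈ Q → u ~ q → q ≡ x ⊎ q ≡ y ⊎ q ≡ v
      at m q e with lab m q e
      ... | inj₁ (_ , inj₁ eq) = inj₁ eq
      ... | inj₁ (_ , inj₂ eq) = inj₂ (inj₁ eq)
      ... | inj₂ (inj₁ eq) = inj₂ (inj₂ eq)
      ... | inj₂ (inj₂ refl) = ⊥-elim (none (any-∈ m e))
    ... | yes some with split-first (_~? z) some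
    ... | L₁ , g , [] , eq , gz , no₁ with ends-unique K.end (L₁ , eq)
    ... | refl = t , record { hole = H ; x∈ = x∈ ; y∈ = y∈ ; v∈ = v∈ ; z∈ = z∈ ; xy = xy ; xv = xv ; xz = xz ; yv = yv ; yz = yz ; vz = vz
            ; list = l ; path = K.path ; start = st ; end = K.end ; off = offl ; t∈ = t∈S ; d≢t = (λ e → d≁v (subst (_~ v) (sym e) K.lastB)) ; d~x = dx ; d~y = dy ; t~v = K.lastB ; t~z = gz ; labels = lb }
      where
      lb : ∀ {u q} → u ∈ l → q ∈ Q → u ~ q → (u ≡ d × (q ≡ x ⊎ q ≡ y)) ⊎ (u ≡ t × (q ≡ v ⊎ q ≡ z))
      lb {u} m q e with lab m q e
      ... | inj₁ r = inj₁ r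
      ... | inj₂ (inj₁ refl) = inj₂ (K.onlyB m e , inj₁ refl)
      ... | inj₂ (inj₂ refl) with ∈-∷ʳ⁻ L₁ (subst (u ∈_) eq m)
      ... | inj₁ r = ⊥-elim (no₁ r e)
      ... | inj₂ r = inj₂ (r , inj₂ refl)
    go | yes some | L₁ , g , w ∷ L₂ , eq , gz , no₁ = ⊥-elim (no-three-attachments {S = L₁ ++ [ g ]} (spot H x∈ y∈ z∈ xy xz yz)
          (attaches (path-conn pre) (λ m → offl (inl m)) (any-∈ (starts∈ (starts-prefix L₁ (subst (λ l → Starts l d) eq st))) dx) (any-∈ (starts∈ (starts-prefix L₁ (subst (λ l → Starts l d) eq st))) dy)
            (any-∈ (∈-++⁺ʳ L₁ (here refl)) gz) at))
      where
      eq' : l ≡ (L₁ ++ [ g ]) ++ w ∷ L₂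
      eq' = trans eq (sym (L.++-assoc L₁ [ g ] (w ∷ L₂)))
      pre : Path (L₁ ++ [ g ])
      pre = path-++ˡ {L₁ ++ [ g ]} (subst Path eq' K.path)
      inl : ∀ {u} → u ∈ L₁ ++ [ g ] → u ∈ l
      inl m = subst (_ ∈_) (sym eq') (∈-++⁺ˡ m)
      t∉ : t ∉ L₁ ++ [ g ]
      t∉ m with has-end w L₂
      ... | e' , en' with ends-unique (subst (λ l → Ends l t) eq' K.end) (ends-++ (L₁ ++ [ g ]) en')
      ... | refl = unique-disjoint (subst Unique eq' (K.path .uniq)) m (ends∈ en')
      at : ∀ {u q} → u ∈ L₁ ++ [ g ] → q ∈ Q → u ~ q → q ≡ x ⊎ q ≡ y ⊎ q ≡ z
      at m q e with lab (inl m) q e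
      ... | inj₁ (_ , inj₁ r) = inj₁ r
      ... | inj₁ (_ , inj₂ r) = inj₂ (inj₁ r)
      ... | inj₂ (inj₂ r) = inj₂ (inj₂ r)
      ... | inj₂ (inj₁ refl) with K.onlyB (inl m) e
      ... | refl = ⊥-elim (t∉ m)

  pinch-swap-vz : ∀ {Q x y v z d t S} → Pinch Q x y v z d t S → Pinch Q x y z v d t S
  pinch-swap-vz p = record { hole = p.hole ; x∈ = p.x∈ ; y∈ = p.y∈ ; v∈ = p.z∈ ; z∈ = p.v∈ ; xy = p.xy ; xv = p.xz ; xz = p.xv ; yv = p.yz ; yz = p.yv ; vz = λ e → p.vz (sym e)
    ; list = p.list ; path = p.path ; start = p.start ; end = p.end ; off = p.off ; t∈ = p.t∈ ; d≢t = p.d≢t ; d~x = p.d~x ; d~y = p.d~y ; t~v = p.t~z ; t~z = p.t~v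
    ; labels = λ m q e → lb (p.labels m q e) }
    where
    module p = Pinch p
    lb : ∀ {A B C D : Set} → A ⊎ (B × (C ⊎ D)) → A ⊎ (B × (D ⊎ C))
    lb (inj₁ a) = inj₁ a
    lb (inj₂ (b , c)) = inj₂ (b , swap c)

  pinch-swap-xy : ∀ {Q x y v z d t S} → Pinch Q x y v z d t S → Pinch Q y x v z d t S
  pinch-swap-xy p = record { hole = p.hole ; x∈ = p.y∈ ; y∈ = p.x∈ ; v∈ = p.v∈ ; z∈ = p.z∈ ; xy = λ e → p.xy (sym e) ; xv = p.yv ; xz = p.yz ; yv = p.xv ; yz = p.xz ; vz = p.vz
    ; list = p.list ; path = p.path ; start = p.start ; end = p.end ; off = p.off ; t∈ = p.t∈ ; d≢t = p.d≢t ; d~x = p.d~y ; d~y = p.d~x ; t~v = p.t~v ; t~z = p.t~z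
    ; labels = λ m q e → lb (p.labels m q e) }
    where
    module p = Pinch p
    lb : ∀ {A B C D : Set} → (B × (C ⊎ D)) ⊎ A → (B × (D ⊎ C)) ⊎ A
    lb (inj₂ a) = inj₂ a
    lb (inj₁ (b , c)) = inj₁ (b , swap c)

  -- Replacing the arc A of the hole between v and z by the vertex t.
  module Shortcut {Q x y v z d t S} (p : Pinch Q x y v z d t S) (v≁z : ¬ v ~ z)
                  {A B} (H : Hole (v ∷ A ++ z ∷ B)) (sm : SameMem Q (v ∷ A ++ z ∷ B)) where
    private
      module p = Pinch p

    N D : List V
    N = z ∷ B ++ [ v ]
    D = t ∷ N

    private
      A∋ : ∃ (_∈ A)
      A∋ = go A H
        where
        go : ∀ A → Hole (v ∷ A ++ z ∷ B) → ∃ (_∈ A)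
        go [] H = ⊥-elim (v≁z (H .edgeᴴ (here refl)))
        go (a ∷ A) _ = a , here refl

      B∋ : ∃ (_∈ B)
      B∋ = go B H
        where
        go : ∀ B → Hole (v ∷ A ++ z ∷ B) → ∃ (_∈ B)
        go [] H = ⊥-elim (v≁z (~-sym (H .edgeᴴ (cyc-close {l = v ∷ A ++ [ z ]} (A ++ [ z ] , refl) (v ∷ A , refl)))))
        go (b ∷ B) _ = b , here refl

    u : Unique (v ∷ A ++ z ∷ B)
    u = H .uniqᴴ

    N⊆ : ∀ {a} → a ∈ N → a ∈ v ∷ A ++ z ∷ B
    N⊆ m with ∈-∷ʳ⁻ (z ∷ B) m
    ... | inj₁ q = there (∈-++⁺ʳ A q)
    ... | inj₂ refl = here refl

    N⊆Q : ∀ {a} → a ∈ N → a ∈ Q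
    N⊆Q m = proj₂ sm (N⊆ m)

    A∉N : ∀ {a} → a ∈ A → a ∉ N
    A∉N m k with ∈-∷ʳ⁻ (z ∷ B) k
    ... | inj₁ q = unique-disjoint (unique-++ʳ [ v ] u) m q
    ... | inj₂ refl = U.Unique[x∷xs]⇒x∉xs u (∈-++⁺ˡ m)

    pN : Path N
    pN = hole-path′ {A} (subst Hole (L.++-assoc A (z ∷ B) [ v ]) (hole-rotate [ v ] H)) (proj₂ A∋)

    t∉Q : t ∉ Q
    t∉Q = p.off (ends∈ p.end)

    t-lab : ∀ {q} → q ∈ Q → t ~ q → q ≡ v ⊎ q ≡ z
    t-lab q e with p.labels (ends∈ p.end) q e
    ... | inj₁ (eq , _) = ⊥-elim (p.d≢t (sym eq))
    ... | inj₂ (_ , r) = r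

    z∈N : z ∈ N
    z∈N = here refl

    v∈N : v ∈ N
    v∈N = ∈-++⁺ʳ (z ∷ B) (here refl)

    B∈N : ∀ {b} → b ∈ B → b ∈ N
    B∈N m = there (∈-++⁺ˡ m)

    hD : Hole D
    hD = hole-join {xs = [ t ]} (path-single t) pN ([] , refl) ([] , refl) (B ++ [ v ] , refl) (z ∷ B , refl) p.t~z (~-sym p.t~v) (len B B∋)
           (λ { (here refl) m → t∉Q (N⊆Q m) }) cr
      where
      cr : ∀ {a b} → a ∈ [ t ] → b ∈ N → a ~ b → (a ≡ t × b ≡ z) ⊎ (a ≡ t × b ≡ v)
      cr (here refl) m e with t-lab (N⊆Q m) e
      ... | inj₁ eq = inj₂ (refl , eq)
      ... | inj₂ eq = inj₁ (refl , eq)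
      len : ∀ B → ∃ (_∈ B) → 4 ≤ length (t ∷ z ∷ B ++ [ v ])
      len (b ∷ B') _ = s≤s (s≤s (s≤s (subst (1 ≤_) (trans (ℕ.+-comm 1 (length B')) (sym (L.length-++ B'))) (s≤s z≤n))))

    i : List V
    i = proj₁ p.end

    l≡ : p.list ≡ i ++ [ t ]
    l≡ = proj₂ p.end

    pi : Path i
    pi = path-++ˡ (subst Path l≡ p.path)

    i⊆ : ∀ {a} → a ∈ i → a ∈ p.list
    i⊆ m = subst (_ ∈_) (sym l≡) (∈-++⁺ˡ m)

    t∉i : t ∉ i
    t∉i m = unique-disjoint (subst Unique l≡ (p.path .uniq)) m (here refl)

    d∈i : d ∈ i
    d∈i with ∈-∷ʳ⁻ i (subst (d ∈_) l≡ (starts∈ p.start))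
    ... | inj₁ m = m
    ... | inj₂ eq = ⊥-elim (p.d≢t eq)

    i-t : Any (_~ t) i
    i-t with i | l≡ | d∈i
    ... | b ∷ bs | eq | _ with has-end b bs
    ... | e' , en = any-∈ (ends∈ en) (p.path .edge (subst (λ l → (e' , t) ∈ pairs l) (sym eq) (pairs-bridge en ([] , refl))))

    i-lab : ∀ {a q} → a ∈ i → q ∈ Q → a ~ q → a ≡ d × (q ≡ x ⊎ q ≡ y)
    i-lab m q e with p.labels (i⊆ m) q e
    ... | inj₁ r = r
    ... | inj₂ (refl , _) = ⊥-elim (t∉i m)

    i∉D : ∀ {a} → a ∈ i → a ∉ D
    i∉D m (here refl) = t∉i m
    i∉D m (there k) = p.off (i⊆ m) (N⊆Q k)

    neQ : ∀ {q} → q ∈ Q → q ≢ t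
    neQ m refl = t∉Q m

    -- The path without `t` attaches to the shortened hole exactly at x, y and the new vertex `t`.
    same-arc-⊥ : x ∈ B → y ∈ B → ⊥
    same-arc-⊥ x∈B y∈B = no-three-attachments {S = i} (spot hD (there (B∈N x∈B)) (there (B∈N y∈B)) (here refl) p.xy (neQ p.x∈) (neQ p.y∈))
        (attaches (path-conn pi) i∉D (any-∈ d∈i p.d~x) (any-∈ d∈i p.d~y) i-t at)
      where
      at : ∀ {a q} → a ∈ i → q ∈ D → a ~ q → q ≡ x ⊎ q ≡ y ⊎ q ≡ t
      at m (here eq) e = inj₂ (inj₂ eq)
      at m (there k) e with proj₂ (i-lab m (N⊆Q k) e)
      ... | inj₁ r = inj₁ r
      ... | inj₂ r = inj₂ (inj₁ r)

    -- If x were not the last vertex of A, the segment of A from v to x together with the path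
    -- without `t` would attach to the shortened hole exactly at t, y and v. Being last on A, x is
    -- next to z.
    cross-adj : x ∈ A → y ∈ B → x ~ z
    cross-adj x∈A y∈B with ∈-∃++ x∈A
    ... | A₁ , [] , eqA = H .edgeᴴ (cyc⁺ (subst (λ l → (x , z) ∈ pairs (v ∷ l ++ z ∷ B)) (sym eqA) (pairs-bridge {xs = v ∷ A₁ ++ [ x ]} (v ∷ A₁ , refl) (B , refl))))
    ... | A₁ , a ∷ A₂ , eqA = ⊥-elim (no-three-attachments {S = W ++ i} (spot hD (here refl) (there (B∈N y∈B)) (there v∈N) (λ e → neQ p.y∈ (sym e)) (λ e → neQ p.v∈ (sym e)) p.yv)
        (attaches cn of' (AnyP.++⁺ʳ W i-t) (AnyP.++⁺ʳ W (any-∈ d∈i p.d~y)) (AnyP.++⁺ˡ wv) at))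
      where
      W = A₁ ++ [ x ]
      eqA' : A ≡ W ++ a ∷ A₂
      eqA' = trans eqA (sym (L.++-assoc A₁ [ x ] (a ∷ A₂)))
      W⊆A : ∀ {b} → b ∈ W → b ∈ A
      W⊆A m = subst (_ ∈_) (sym eqA') (∈-++⁺ˡ m)
      A⊆Q' : ∀ {b} → b ∈ A → b ∈ v ∷ A ++ z ∷ B
      A⊆Q' m = there (∈-++⁺ˡ m)
      pA : Path A
      pA = hole-path′ {(z ∷ B) ++ [ v ]} (subst Hole (sym (L.++-assoc (z ∷ B) [ v ] A)) (hole-rotate (v ∷ A) H)) (here refl)
      pW : Path W
      pW = path-++ˡ {W} (subst Path eqA' pA)
      cn : Conn (W ++ i)
      cn = conn-join (path-conn pW) (path-conn pi) (∈-++⁺ʳ A₁ (here refl)) d∈i (~-sym p.d~x)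
      of' : ∀ {b} → b ∈ W ++ i → b ∉ D
      of' m k with ∈-++⁻ W m
      ... | inj₂ q = i∉D q k
      of' m (here refl) | inj₁ q = t∉Q (proj₂ sm (A⊆Q' (W⊆A q)))
      of' m (there k) | inj₁ q = A∉N (W⊆A q) k
      wv : Any (_~ v) W
      wv with W | eqA' | ∈-++⁺ʳ A₁ {[ x ]} (here refl)
      ... | w ∷ ws | eq | _ = here (~-sym (H .edgeᴴ (subst (λ l → (v , w) ∈ cyc (v ∷ l ++ z ∷ B)) (sym eq) (here refl))))
      uvA : Unique ((v ∷ A) ++ [ z ])
      uvA = unique-++ˡ {xs = (v ∷ A) ++ [ z ]} (subst Unique (cong (v ∷_) (sym (L.++-assoc A [ z ] B))) u)
      endA : ∀ {b} → Ends (v ∷ A) b → b ∉ W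
      endA {b} en m with has-end a A₂
      ... | e' , en' with ends-unique en (subst (λ l → Ends (v ∷ l) e') (sym eqA') (ends-++ (v ∷ W) en'))
      ... | refl = unique-disjoint (subst Unique eqA' (unique-++ˡ (unique-++ʳ [ v ] u))) m (ends∈ en')
      atW : ∀ {b q} → b ∈ W → q ∈ N → b ~ q → q ≡ v
      atW {b} {q} m k e with Edge-++⁻ (pairs (v ∷ A ++ [ z ])) (subst (λ E → Edge E b q) (cyc-arcs v A z B) (H .onlyᴴ (A⊆Q' (W⊆A m)) (N⊆ k) e))
      ... | inj₂ k' = ⊥-elim (A∉N (W⊆A m) (proj₁ (Edge-∈ {l = N} k')))
      ... | inj₁ k' with ∈-∷ʳ⁻ (v ∷ A) (proj₂ (Edge-∈ {l = v ∷ A ++ [ z ]} k'))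
      ... | inj₁ (here eq) = eq
      ... | inj₁ (there q') = ⊥-elim (A∉N q' k)
      ... | inj₂ refl = ⊥-elim (endA (edge-last {l = v ∷ A} uvA k') m)
      at : ∀ {b q} → b ∈ W ++ i → q ∈ D → b ~ q → q ≡ t ⊎ q ≡ y ⊎ q ≡ v
      at m (here eq) e = inj₁ eq
      at m (there k) e with ∈-++⁻ W m
      ... | inj₁ q = inj₂ (inj₂ (atW q k e))
      ... | inj₂ q with i-lab q (N⊆Q k) e
      ... | _ , inj₂ eq = inj₂ (inj₁ eq)
      ... | _ , inj₁ refl = ⊥-elim (A∉N x∈A k)

    arcs-nonadj : x ∈ A → y ∈ B → ¬ x ~ y
    arcs-nonadj x∈A y∈B e with Edge-++⁻ (pairs (v ∷ A ++ [ z ])) (subst (λ E → Edge E x y) (cyc-arcs v A z B) (H .onlyᴴ (proj₁ sm p.x∈) (proj₁ sm p.y∈) e))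
    ... | inj₂ k = A∉N x∈A (proj₁ (Edge-∈ {l = N} k))
    ... | inj₁ k with ∈-∷ʳ⁻ (v ∷ A) (proj₂ (Edge-∈ {l = v ∷ A ++ [ z ]} k))
    ... | inj₁ (here eq) = p.yv eq
    ... | inj₁ (there q) = A∉N q (B∈N y∈B)
    ... | inj₂ eq = p.yz eq

  private
    rotate₂ : ∀ {Q v A z B} → Hole (v ∷ A ++ z ∷ B) → SameMem Q (v ∷ A ++ z ∷ B) → Hole (z ∷ B ++ v ∷ A) × SameMem Q (z ∷ B ++ v ∷ A)
    rotate₂ {Q} {v} {A} {z} {B} H sm = hole-rotate (v ∷ A) H , ((λ m → AnyP.++-comm (v ∷ A) (z ∷ B) (proj₁ sm m)) , (λ m → proj₂ sm (AnyP.++-comm (z ∷ B) (v ∷ A) m)))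

    reverse₂ : ∀ {Q v A z B} → Hole (v ∷ A ++ z ∷ B) → SameMem Q (v ∷ A ++ z ∷ B) → Hole (z ∷ reverse A ++ v ∷ reverse B) × SameMem Q (z ∷ reverse A ++ v ∷ reverse B)
    reverse₂ {Q} {v} {A} {z} {B} H sm with rotate₂ {Q} {v} {A} {z} {B} H sm
    ... | H' , sm' = subst (λ l → Hole (z ∷ l)) eq (hole-reverse H') ,
      λ {a} → (λ m → subst (λ l → a ∈ z ∷ l) eq (rv (proj₁ sm' m))) , (λ m → proj₂ sm' (rv⁻ (subst (λ l → a ∈ z ∷ l) (sym eq) m)))
      where
      eq : reverse (B ++ v ∷ A) ≡ reverse A ++ v ∷ reverse B
      eq = trans (L.reverse-++ B (v ∷ A)) (trans (cong (_++ reverse B) (L.unfold-reverse v A)) (L.++-assoc (reverse A) [ v ] (reverse B)))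
      rv : ∀ {a l} → a ∈ z ∷ l → a ∈ z ∷ reverse l
      rv (here e) = here e
      rv (there m) = there (∈-reverse m)
      rv⁻ : ∀ {a l} → a ∈ z ∷ reverse l → a ∈ z ∷ l
      rv⁻ (here e) = here e
      rv⁻ {l = l} (there m) = there (∈-reverse⁻ {l = l} m)

  -- All four edges between x, y and v, z are forced. If d sees t, then v, z, d and x, y, t are the
  -- sides of an induced K₃,₃; if not, the edge yd attaches to the square v x z t at v, x and z
  -- only.
  pinch-cross : ∀ {Q x y v z d t S A B} → ¬ K33 → Pinch Q x y v z d t S → ¬ v ~ z →
    Hole (v ∷ A ++ z ∷ B) → SameMem Q (v ∷ A ++ z ∷ B) → x ∈ A → y ∈ B → ⊥
  pinch-cross {Q} {x} {y} {v} {z} {d} {t} {S} {A} {B} noK p v≁z H sm x∈ y∈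
    with rotate₂ {Q} {v} {A} {z} {B} H sm | reverse₂ {Q} {v} {A} {z} {B} H sm
  ... | H₂ , sm₂ | H₃ , sm₃ with reverse₂ {Q} {z} {B} {v} {A} H₂ sm₂
  ... | H₄ , sm₄ = go
    where
    module p = Pinch p
    v≁z' : ¬ z ~ v
    v≁z' e = v≁z (~-sym e)
    module S₁ = Shortcut p v≁z {A} {B} H sm
    -- Rotating the hole exchanges x with y and v with z at once, and reversing it exchanges v with
    -- z alone. The four combinations turn `cross-adj` into all four edges.
    xz~ : x ~ z
    xz~ = S₁.cross-adj x∈ y∈
    yv~ : y ~ v
    yv~ = Shortcut.cross-adj (pinch-swap-xy (pinch-swap-vz p)) v≁z' {B} {A} H₂ sm₂ y∈ x∈
    xv~ : x ~ v
    xv~ = Shortcut.cross-adj (pinch-swap-vz p) v≁z' {reverse A} {reverse B} H₃ sm₃ (∈-reverse x∈) (∈-reverse y∈)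
    yz~ : y ~ z
    yz~ = Shortcut.cross-adj (pinch-swap-xy p) v≁z {reverse B} {reverse A} H₄ sm₄ (∈-reverse y∈) (∈-reverse x∈)
    x≁y = S₁.arcs-nonadj x∈ y∈
    x≁t : ¬ x ~ t
    x≁t e with S₁.t-lab p.x∈ (~-sym e)
    ... | inj₁ eq = p.xv eq
    ... | inj₂ eq = p.xz eq
    y≁t : ¬ y ~ t
    y≁t e with S₁.t-lab p.y∈ (~-sym e)
    ... | inj₁ eq = p.yv eq
    ... | inj₂ eq = p.yz eq
    d-lab : ∀ {q} → q ∈ Q → d ~ q → q ≡ x ⊎ q ≡ y
    d-lab q e = proj₂ (S₁.i-lab S₁.d∈i q e)
    d∉ : d ∉ Q
    d∉ = p.off (starts∈ p.start)
    d≁v : ¬ d ~ v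
    d≁v e with d-lab p.v∈ e
    ... | inj₁ eq = p.xv (sym eq)
    ... | inj₂ eq = p.yv (sym eq)
    d≁z : ¬ d ~ z
    d≁z e with d-lab p.z∈ e
    ... | inj₁ eq = p.xz (sym eq)
    ... | inj₂ eq = p.yz (sym eq)
    go : ⊥
    go with d ~? t
    ... | yes dt = noK record { a₁ = v ; a₂ = z ; a₃ = d ; b₁ = x ; b₂ = y ; b₃ = t
        ; a₁₂ = p.vz ; a₁₃ = (λ { refl → d∉ p.v∈ }) ; a₂₃ = (λ { refl → d∉ p.z∈ }) ; b₁₂ = p.xy ; b₁₃ = S₁.neQ p.x∈ ; b₂₃ = S₁.neQ p.y∈
        ; ¬a₁₂ = v≁z ; ¬a₁₃ = (λ e → d≁v (~-sym e)) ; ¬a₂₃ = (λ e → d≁z (~-sym e)) ; ¬b₁₂ = x≁y ; ¬b₁₃ = x≁t ; ¬b₂₃ = y≁t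
        ; e₁₁ = ~-sym xv~ ; e₁₂ = ~-sym yv~ ; e₁₃ = ~-sym p.t~v ; e₂₁ = ~-sym xz~ ; e₂₂ = ~-sym yz~ ; e₂₃ = ~-sym p.t~z ; e₃₁ = p.d~x ; e₃₂ = p.d~y ; e₃₃ = dt }
    ... | no d≁t = no-three-attachments {S = y ∷ d ∷ []} (spot (square (~-sym xv~) xz~ (~-sym p.t~z) p.t~v p.vz (S₁.neQ p.x∈) v≁z x≁t) (here refl) (there (here refl)) (there (there (here refl))) (≢-sym p.xv) p.vz p.xz)
        (attaches (conn-cons (conn-single d) (here refl) (~-sym p.d~y)) of' (here yv~) (there (here p.d~x)) (here yz~) at)
      where
      of' : ∀ {a} → a ∈ y ∷ d ∷ [] → a ∉ v ∷ x ∷ z ∷ t ∷ []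
      of' (here refl) (here eq) = p.yv eq
      of' (here refl) (there (here eq)) = p.xy (sym eq)
      of' (here refl) (there (there (here eq))) = p.yz eq
      of' (here refl) (there (there (there (here eq)))) = S₁.neQ p.y∈ eq
      of' (there (here refl)) (here refl) = d∉ p.v∈
      of' (there (here refl)) (there (here refl)) = d∉ p.x∈
      of' (there (here refl)) (there (there (here refl))) = d∉ p.z∈
      of' (there (here refl)) (there (there (there (here eq)))) = p.d≢t eq
      at : ∀ {a q} → a ∈ y ∷ d ∷ [] → q ∈ v ∷ x ∷ z ∷ t ∷ [] → a ~ q → q ≡ v ⊎ q ≡ x ⊎ q ≡ z
      at _ (here eq) e = inj₁ eq
      at _ (there (here eq)) e = inj₂ (inj₁ eq)
      at _ (there (there (here eq))) e = inj₂ (inj₂ eq)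
      at (here refl) (there (there (there (here refl)))) e = ⊥-elim (y≁t e)
      at (there (here refl)) (there (there (there (here refl)))) e = ⊥-elim (d≁t e)

  -- Non-adjacent v and z cut Q into two non-trivial arcs, and both positions of x and y, on the
  -- same arc or on different ones, have been excluded.
  pinch-adj : ∀ {Q x y v z d t S} → ¬ K33 → Pinch Q x y v z d t S → v ~ z
  pinch-adj {Q} {x} {y} {v} {z} noK p with v ~? z
  ... | yes e = e
  ... | no v≁z with hole-at₂ (Pinch.hole p) (Pinch.v∈ p) (Pinch.z∈ p) (Pinch.vz p)
  ... | A , B , H , sm = ⊥-elim (go (side (Pinch.x∈ p) (Pinch.xv p) (Pinch.xz p)) (side (Pinch.y∈ p) (Pinch.yv p) (Pinch.yz p)))
    where
    side : ∀ {q} → q ∈ Q → q ≢ v → q ≢ z → q ∈ A ⊎ q ∈ B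
    side m nv nz with proj₁ sm m
    ... | here eq = ⊥-elim (nv eq)
    ... | there m' with ∈-++⁻ A m'
    ... | inj₁ k = inj₁ k
    ... | inj₂ (here eq) = ⊥-elim (nz eq)
    ... | inj₂ (there k) = inj₂ k
    go : x ∈ A ⊎ x ∈ B → y ∈ A ⊎ y ∈ B → ⊥
    go (inj₁ a) (inj₂ b) = pinch-cross {A = A} {B} noK p v≁z H sm a b
    go (inj₂ b) (inj₁ a) = pinch-cross {A = A} {B} noK (pinch-swap-xy p) v≁z H sm a b
    go (inj₂ b) (inj₂ b') = Shortcut.same-arc-⊥ p v≁z {A} {B} H sm b b'
    go (inj₁ a) (inj₁ a') with rotate₂ {Q} {v} {A} {z} {B} H sm
    ... | H₂ , sm₂ = Shortcut.same-arc-⊥ (pinch-swap-vz p) (λ e → v≁z (~-sym e)) {B} {A} H₂ sm₂ a a'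

-- Leaving a connected set, and triangles on an edge of a hole

module Claws {n : ℕ} (R : Adj n) (isg : IsGraph R) (noISK4 : ¬ HasISK4 R) (noWheel : ¬ HasWheel R) where
  open Graph R isg
  open Attachments R isg noISK4 noWheel using (spot)
  open ThreeAttachments R isg noISK4 noWheel using (attaches; no-three-attachments)
  open Flags R isg noISK4 noWheel

  -- A connected set U containing c, attached to Q at most at v and z, next to a vertex d that also attaches elsewhere.
  record Exit (Q : List V) (v z c : V) (P : V → Set) : Set where
    field
      U    : List V
      conn : Conn U
      c∈U  : c ∈ U
      offU : Off Q U
      labU : LabIn Q U v z
      inP  : ∀ {u} → u ∈ U → P u
      {s d q} : V
      d∉   : d ∉ Q
      s∈U  : s ∈ U
      s~d  : s ~ d
      q∈   : q ∈ Q
      q≢v  : q ≢ v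
      q≢z  : q ≢ z
      d~q  : d ~ q

  at-most-two : ∀ {Q d x y} → Hole Q → d ∉ Q → x ∈ Q → y ∈ Q → x ≢ y → d ~ x → d ~ y → ∀ {q} → q ∈ Q → d ~ q → q ≡ x ⊎ q ≡ y
  at-most-two {Q} {d} {x} {y} H d∉ mx my xy dx dy {q} mq dq with q F.≟ x
  ... | yes e = inj₁ e
  ... | no n with q F.≟ y
  ... | yes e = inj₂ e
  ... | no n' = ⊥-elim (noWheel (wheel H d∉ mx my mq xy (≢-sym n) (≢-sym n') dx dy dq))

  -- The vertex d outside `U` cannot have just one neighbour on Q besides v and z, for then `T`, `U`
  -- and d together would attach at exactly three vertices. With a second one it has exactly these
  -- two, and `pinch` applies to `U`.
  exit-pinch : ∀ {Q T v z c w P} → Hole Q → v ∈ Q → z ∈ Q → v ≢ z → Conn T → Off Q T → LabIn Q T v z →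
    c ∈ T → c ~ v → w ∈ T → w ~ z → (ex : Exit Q v z c P) →
    ∃ λ t → t ∈ Exit.U ex × t ~ v × t ~ z × (¬ K33 → v ~ z)
  exit-pinch {Q} {T} {v} {z} {c} {w} H v∈ z∈ v≢z cT offT labT c∈T cv w∈ wz ex
    with Any.any? (λ r → ¬? (r F.≟ v) ×-dec ¬? (r F.≟ z) ×-dec ¬? (r F.≟ Exit.q ex) ×-dec (Exit.d ex ~? r)) Q
  ... | yes some with ∈-any some
  ... | r , r∈ , r≢v , r≢z , r≢q , dr with pinch H q∈ r∈ v∈ z∈ (≢-sym r≢q) q≢v q≢z r≢v r≢z v≢z conn offU labU c∈U cv d∉ s∈U s~d d~q dr
            (at-most-two H d∉ q∈ r∈ (≢-sym r≢q) d~q dr)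
    where open Exit ex
  ... | t , p = t , Pinch.t∈ p , Pinch.t~v p , Pinch.t~z p , λ noK → pinch-adj noK p
  exit-pinch {Q} {T} {v} {z} {c} {w} H v∈ z∈ v≢z cT offT labT c∈T cv w∈ wz ex | no none =
    ⊥-elim (no-three-attachments {S = d ∷ T ++ U} (spot H v∈ z∈ q∈ v≢z (≢-sym q≢v) (≢-sym q≢z))
      (attaches (conn-cons (conn-meet cT conn c∈T c∈U) (∈-++⁺ʳ T s∈U) (~-sym s~d)) of'
        (there (any-∈ (∈-++⁺ˡ c∈T) cv)) (there (any-∈ (∈-++⁺ˡ w∈) wz)) (here d~q) at))
    where
    open Exit ex
    of' : Off Q (d ∷ T ++ U)
    of' (here refl) = d∉
    of' (there m) with ∈-++⁻ T m
    ... | inj₁ k = offT k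
    ... | inj₂ k = offU k
    two : ∀ {r} → r ≡ v ⊎ r ≡ z → r ≡ v ⊎ r ≡ z ⊎ r ≡ q
    two (inj₁ e) = inj₁ e
    two (inj₂ e) = inj₂ (inj₁ e)
    at : ∀ {a r} → a ∈ d ∷ T ++ U → r ∈ Q → a ~ r → r ≡ v ⊎ r ≡ z ⊎ r ≡ q
    at {r = r} (here refl) r∈ e with r F.≟ v | r F.≟ z | r F.≟ q
    ... | yes p | _ | _ = inj₁ p
    ... | no _ | yes p | _ = inj₂ (inj₁ p)
    ... | no _ | no _ | yes p = inj₂ (inj₂ p)
    ... | no a | no b | no c = ⊥-elim (none (any-∈ r∈ (a , b , c , e)))
    at (there m) r∈ e with ∈-++⁻ T m
    ... | inj₁ k = two (labT k r∈ e)
    ... | inj₂ k = two (labU k r∈ e)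

  -- The triangle v, z, t stands on the edge vz of Q. The set `W` is kept together with c because it
  -- serves as the first set in another use of `exit-pinch`.
  record Flag (Q : List V) (v c : V) : Set where
    field
      {z t} : V
      z∈   : z ∈ Q
      v~z  : v ~ z
      W    : List V
      conn : Conn W
      c∈W  : c ∈ W
      offW : Off Q W
      labW : LabIn Q W v z
      t∈W  : t ∈ W
      t~v  : t ~ v
      t~z  : t ~ z

  module _ (noK33 : ¬ K33) {Q : List V} {v c : V} (H : Hole Q) (v∈ : v ∈ Q) (c∉ : c ∉ Q) (cv : c ~ v)
           (escape : ∀ {z} → z ∈ Q → LabIn Q [ c ] v z → Exit Q v z c (λ _ → ⊤)) where

    private
      finish : ∀ {T z w} → z ∈ Q → v ≢ z → Conn T → Off Q T → LabIn Q T v z → c ∈ T → w ∈ T → w ~ z → Flag Q v c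
      finish {T} {z} z∈ v≢z cT offT labT c∈T w∈ wz with escape z∈ (λ { (here refl) → labT c∈T })
      ... | ex with exit-pinch H v∈ z∈ v≢z cT offT labT c∈T cv w∈ wz ex
      ... | t , t∈ , tv , tz , adj = record { z∈ = z∈ ; v~z = adj noK33 ; W = T ++ U ; conn = conn-meet cT conn c∈T c∈U ; c∈W = ∈-++⁺ˡ c∈T
            ; offW = λ m → [ offT , offU ]′ (∈-++⁻ T m) ; labW = λ m q e → [ (λ k → labT k q e) , (λ k → labU k q e) ]′ (∈-++⁻ T m)
            ; t∈W = ∈-++⁺ʳ T t∈ ; t~v = tv ; t~z = tz }
        where open Exit ex

    -- A connected set containing c and attached at exactly two vertices v and z is needed first. It
    -- is c itself if c sees a second vertex of Q; otherwise it comes from leaving c once, where a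
    -- vertex d with two new neighbours would give three attachments. A second escape, relative to v
    -- and z, then yields t.
    flag : Flag Q v c
    flag with Any.any? (λ r → ¬? (r F.≟ v) ×-dec (c ~? r)) Q
    ... | yes some with ∈-any some
    ... | z , z∈ , z≢v , cz = finish z∈ (≢-sym z≢v) (conn-single c) (λ { (here refl) → c∉ })
            (λ { (here refl) q e → at-most-two H c∉ v∈ z∈ (≢-sym z≢v) cv cz q e }) (here refl) (here refl) cz
    -- Since c sees only v on Q, both allowed attachments are taken to be v.
    flag | no none with escape v∈ (λ { (here refl) q e → inj₁ (onlyv q e) })
      where
      onlyv : ∀ {q} → q ∈ Q → c ~ q → q ≡ v
      onlyv {q} m e with q F.≟ v
      ... | yes p = p
      ... | no np = ⊥-elim (none (any-∈ m (np , e)))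
    ... | ex with Any.any? (λ r → ¬? (r F.≟ v) ×-dec ¬? (r F.≟ Exit.q ex) ×-dec (Exit.d ex ~? r)) Q
    ... | yes some with ∈-any some
    ... | r , r∈ , r≢v , r≢q , dr = ⊥-elim (no-three-attachments {S = d ∷ U} (spot H v∈ q∈ r∈ (≢-sym q≢v) (≢-sym r≢v) (≢-sym r≢q))
          (attaches (conn-cons conn s∈U (~-sym s~d)) (λ { (here refl) → d∉ ; (there m) → offU m }) (there (any-∈ c∈U cv)) (here d~q) (here dr) at))
      where
      open Exit ex
      at : ∀ {a p} → a ∈ d ∷ U → p ∈ Q → a ~ p → p ≡ v ⊎ p ≡ q ⊎ p ≡ r
      at (here refl) m e with at-most-two H d∉ q∈ r∈ (≢-sym r≢q) d~q dr m e
      ... | inj₁ p = inj₂ (inj₁ p)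
      ... | inj₂ p = inj₂ (inj₂ p)
      at (there k) m e with labU k m e
      ... | inj₁ p = inj₁ p
      ... | inj₂ p = inj₁ p
    flag | no none | ex | no none' = finish {d ∷ U} q∈ (≢-sym q≢v) (conn-cons conn s∈U (~-sym s~d))
          (λ { (here refl) → d∉ ; (there m) → offU m }) lab (there c∈U) (here refl) d~q
      where
      open Exit ex
      lab : LabIn Q (d ∷ U) v q
      lab {q = r} (here refl) m e with r F.≟ v | r F.≟ q
      ... | yes p | _ = inj₁ p
      ... | no _ | yes p = inj₂ p
      ... | no a | no b = ⊥-elim (none' (any-∈ m (a , b , e)))
      lab (there k) m e with labU k m e
      ... | inj₁ p = inj₁ p
      ... | inj₂ p = inj₁ p

  -- Equivalently, there is no diamond and no K₄.
  Thin : Set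
  Thin = ∀ {a b c d} → a ~ b → c ~ a → c ~ b → d ~ a → d ~ b → c ≡ d

  -- The flag gives a triangle v, z, t. Escaping from c a second time without passing t produces
  -- another common neighbour of v and z, so the edge vz would lie in two triangles.
  hole-claw-⊥ : ∀ {Q v c} → ¬ K33 → Thin → Hole Q → v ∈ Q → c ∉ Q → c ~ v → (∀ {q} → q ∈ Q → v ~ q → ¬ c ~ q) →
    (∀ {z} → z ∈ Q → LabIn Q [ c ] v z → Exit Q v z c (λ _ → ⊤)) →
    (∀ {z t} → z ∈ Q → v ~ z → t ~ v → t ~ z → t ∉ Q → c ≢ t → LabIn Q [ c ] v z → Exit Q v z c (_≢ t)) → ⊥
  hole-claw-⊥ {Q} {v} {c} noK33 thin H v∈ c∉ cv apart esc esc△ = u≢t (thin v~z u~v u~z t~v t~z)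
    where
    open Flag (flag noK33 H v∈ c∉ cv esc)
    c≢t : c ≢ t
    c≢t e = apart z∈ v~z (subst (_~ z) (sym e) t~z)
    ex = esc△ z∈ v~z t~v t~z (offW t∈W) c≢t (λ { (here refl) → labW c∈W })
    pt = exit-pinch H v∈ z∈ (~-irrefl v~z) conn offW labW c∈W cv t∈W t~z ex
    u = proj₁ pt
    u~v = proj₁ (proj₂ (proj₂ pt))
    u~z = proj₁ (proj₂ (proj₂ (proj₂ pt)))
    u≢t : u ≢ t
    u≢t = Exit.inP ex (proj₁ (proj₂ pt))

-- Induced K₃,₃

module Bipartite {n : ℕ} (R : Adj n) (isg : IsGraph R) (noISK4 : ¬ HasISK4 R) (noWheel : ¬ HasWheel R) where
  open Graph R isg
  open Attachments R isg noISK4 noWheel using (spot)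
  open ThreeAttachments R isg noISK4 noWheel using (attaches; no-three-attachments)
  open Flags R isg noISK4 noWheel
  open Claws R isg noISK4 noWheel using (Thin)

  k33-swap : K33 → K33
  k33-swap k = record { a₁ = k.b₁ ; a₂ = k.b₂ ; a₃ = k.b₃ ; b₁ = k.a₁ ; b₂ = k.a₂ ; b₃ = k.a₃
    ; a₁₂ = k.b₁₂ ; a₁₃ = k.b₁₃ ; a₂₃ = k.b₂₃ ; b₁₂ = k.a₁₂ ; b₁₃ = k.a₁₃ ; b₂₃ = k.a₂₃
    ; ¬a₁₂ = k.¬b₁₂ ; ¬a₁₃ = k.¬b₁₃ ; ¬a₂₃ = k.¬b₂₃ ; ¬b₁₂ = k.¬a₁₂ ; ¬b₁₃ = k.¬a₁₃ ; ¬b₂₃ = k.¬a₂₃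
    ; e₁₁ = ~-sym k.e₁₁ ; e₁₂ = ~-sym k.e₂₁ ; e₁₃ = ~-sym k.e₃₁ ; e₂₁ = ~-sym k.e₁₂ ; e₂₂ = ~-sym k.e₂₂ ; e₂₃ = ~-sym k.e₃₂
    ; e₃₁ = ~-sym k.e₁₃ ; e₃₂ = ~-sym k.e₂₃ ; e₃₃ = ~-sym k.e₃₃ }
    where module k = K33 k

  -- Each side of the maximal complete bipartite graph is described as the common neighbourhood of
  -- the three given vertices on the other side.
  InA InB : K33 → V → Set
  InA k u = (u ~ K33.b₁ k) × (u ~ K33.b₂ k) × (u ~ K33.b₃ k)
  InB k u = InA (k33-swap k) u

  inA? : ∀ k → Decidable (InA k)
  inA? k u = (u ~? K33.b₁ k) ×-dec (u ~? K33.b₂ k) ×-dec (u ~? K33.b₃ k)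

  -- Connected sets built vertex by vertex, so that statements about them can be proved by adding
  -- one vertex at a time.
  data Grow : List V → Set where
    one : ∀ d → Grow [ d ]
    add : ∀ {S s d} → Grow S → s ∈ S → s ~ d → Grow (d ∷ S)

  grow-conn : ∀ {S} → Grow S → Conn S
  grow-conn (one d) = conn-single d
  grow-conn (add g m e) = conn-cons (grow-conn g) m (~-sym e)

  module Side (thin : Thin) (k : K33) where
    open K33 k

    A B : V → Set
    A = InA k
    B = InB k

    a₁A : A a₁
    a₁A = e₁₁ , e₁₂ , e₁₃
    a₂A : A a₂
    a₂A = e₂₁ , e₂₂ , e₂₃
    a₃A : A a₃
    a₃A = e₃₁ , e₃₂ , e₃₃
    b₁B : B b₁
    b₁B = ~-sym e₁₁ , ~-sym e₂₁ , ~-sym e₃₁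
    b₂B : B b₂
    b₂B = ~-sym e₁₂ , ~-sym e₂₂ , ~-sym e₃₂
    b₃B : B b₃
    b₃B = ~-sym e₁₃ , ~-sym e₂₃ , ~-sym e₃₃

    A-stable : ∀ {u w} → A u → A w → ¬ u ~ w
    A-stable (u₁ , u₂ , _) (w₁ , w₂ , _) e = b₁₂ (thin e (~-sym u₁) (~-sym w₁) (~-sym u₂) (~-sym w₂))

    B-stable : ∀ {u w} → B u → B w → ¬ u ~ w
    B-stable (u₁ , u₂ , _) (w₁ , w₂ , _) e = a₁₂ (thin e (~-sym u₁) (~-sym w₁) (~-sym u₂) (~-sym w₂))

    AB-disjoint : ∀ {u} → A u → B u → ⊥
    AB-disjoint uA uB = A-stable uA a₁A (proj₁ uB)

    -- On the square a, b₁, a″, b₂ the edge da' attaches exactly at a (through d) and at b₁ and b₂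
    -- (through a').
    partial-⊥ : ∀ {a a' a″ d} → A a → A a' → A a″ → a ≢ a' → d ~ a → d ~ a' → ¬ d ~ a″ → ¬ d ~ b₁ → ¬ d ~ b₂ → d ≢ b₁ → d ≢ b₂ → ⊥
    partial-⊥ {a} {a'} {a″} {d} Aa Aa' Aa″ ne da da' ¬da″ ¬db₁ ¬db₂ n₁ n₂ =
      no-three-attachments {S = d ∷ a' ∷ []} (spot (square {a} {b₁} {a″} {b₂} (proj₁ Aa) (~-sym (proj₁ Aa″)) (proj₁ (proj₂ Aa″)) (~-sym (proj₁ (proj₂ Aa))) (ne″ da) b₁₂ (A-stable Aa Aa″) ¬b₁₂)
          (here refl) (there (here refl)) (there (there (there (here refl)))) (~-irrefl (proj₁ Aa)) (~-irrefl (proj₁ (proj₂ Aa))) b₁₂)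
        (attaches (conn-cons (conn-single a') (here refl) da') of' (here da) (there (here (proj₁ Aa'))) (there (here (proj₁ (proj₂ Aa')))) at)
      where
      ne″ : ∀ {c} → d ~ c → c ≢ a″
      ne″ e refl = ¬da″ e
      of' : ∀ {u} → u ∈ d ∷ a' ∷ [] → u ∉ a ∷ b₁ ∷ a″ ∷ b₂ ∷ []
      of' (here refl) (here eq) = ~-irrefl da eq
      of' (here refl) (there (here eq)) = n₁ eq
      of' (here refl) (there (there (here refl))) = A-stable Aa″ Aa da
      of' (here refl) (there (there (there (here eq)))) = n₂ eq
      of' (there (here refl)) (here eq) = ne (sym eq)
      of' (there (here refl)) (there (here eq)) = ~-irrefl (proj₁ Aa') eq
      of' (there (here refl)) (there (there (here eq))) = ne″ da' eq
      of' (there (here refl)) (there (there (there (here eq)))) = ~-irrefl (proj₁ (proj₂ Aa')) eq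
      at : ∀ {u q} → u ∈ d ∷ a' ∷ [] → q ∈ a ∷ b₁ ∷ a″ ∷ b₂ ∷ [] → u ~ q → q ≡ a ⊎ q ≡ b₁ ⊎ q ≡ b₂
      at _ (here eq) e = inj₁ eq
      at _ (there (here eq)) e = inj₂ (inj₁ eq)
      at _ (there (there (there (here eq)))) e = inj₂ (inj₂ eq)
      at (here refl) (there (there (here refl))) e = ⊥-elim (¬da″ e)
      at (there (here refl)) (there (there (here refl))) e = ⊥-elim (A-stable Aa' Aa″ e)

    -- A vertex w of B sees a₁ and a₂; if it missed u, `partial-⊥` would apply with u as the missed
    -- vertex.
    complete : ∀ {u w} → A u → B w → u ~ w
    complete {u} {w} Au Bw with u ~? w
    ... | yes e = e
    ... | no ne = ⊥-elim (partial-⊥ a₁A a₂A Au a₁₂ (proj₁ Bw) (proj₁ (proj₂ Bw)) (λ e → ne (~-sym e))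
          (B-stable Bw b₁B) (B-stable Bw b₂B) (λ { refl → ne (proj₁ Au) }) (λ { refl → ne (proj₁ (proj₂ Au)) }))

    Out : V → Set
    Out d = ¬ A d × ¬ B d

    out-≢A : ∀ {d a} → Out d → A a → d ≢ a
    out-≢A (n , _) Aa refl = n Aa

    out-≢B : ∀ {d b} → Out d → B b → d ≢ b
    out-≢B (_ , n) Bb refl = n Bb

    other-b : ∀ b → ∃ λ b' → B b' × b' ≢ b
    other-b b with b₁ F.≟ b
    ... | no n = b₁ , b₁B , n
    ... | yes refl = b₂ , b₂B , λ e → b₁₂ (sym e)

    other-a : ∀ a a' → ∃ λ a″ → A a″ × a″ ≢ a × a″ ≢ a'
    other-a a a' with a₁ F.≟ a | a₁ F.≟ a' | a₂ F.≟ a | a₂ F.≟ a'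
    ... | no p | no q | _ | _ = a₁ , a₁A , p , q
    ... | yes refl | _ | yes r | _ = ⊥-elim (a₁₂ (sym r))
    ... | _ | yes refl | _ | yes r = ⊥-elim (a₁₂ (sym r))
    ... | yes refl | _ | no p | no q = a₂ , a₂A , p , q
    ... | no _ | yes refl | no p | no q = a₂ , a₂A , p , q
    ... | yes refl | _ | no p | yes refl = a₃ , a₃A , (≢-sym a₁₃) , (≢-sym a₂₃)
    ... | no _ | yes refl | yes refl | no p = a₃ , a₃A , (≢-sym a₂₃) , (≢-sym a₁₃)

    -- A vertex d that sees two vertices of A sees none of B, since otherwise it would be the hub
    -- over a square a, b, a', b'. It cannot see all of a₁, a₂, a₃ without belonging to B, so it
    -- misses one of them and `partial-⊥` applies.
    vertex-A : ∀ {d a a'} → Out d → A a → A a' → d ~ a → d ~ a' → a ≡ a'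
    vertex-A {d} {a} {a'} out Aa Aa' da da' with a F.≟ a'
    ... | yes e = e
    ... | no ne = ⊥-elim (go (d ~? a₁) (d ~? a₂) (d ~? a₃))
      where
      ¬db : ∀ {b} → B b → ¬ d ~ b
      ¬db {b} Bb db with other-b b
      ... | b' , Bb' , ne' = noWheel (wheel {x = a} {b} {a'} (square {a} {b} {a'} {b'} (complete Aa Bb) (~-sym (complete Aa' Bb)) (complete Aa' Bb') (~-sym (complete Aa Bb')) ne (≢-sym ne') (A-stable Aa Aa') (B-stable Bb Bb'))
            (λ { (here eq) → out-≢A out Aa eq ; (there (here eq)) → out-≢B out Bb eq ; (there (there (here eq))) → out-≢A out Aa' eq ; (there (there (there (here eq)))) → out-≢B out Bb' eq })
            (here refl) (there (here refl)) (there (there (here refl))) (~-irrefl (complete Aa Bb)) ne (λ e → ~-irrefl (complete Aa' Bb) (sym e)) da db da')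
      miss : ∀ {a″} → A a″ → ¬ d ~ a″ → ⊥
      miss Aa″ n = partial-⊥ Aa Aa' Aa″ ne da da' n (¬db b₁B) (¬db b₂B) (out-≢B out b₁B) (out-≢B out b₂B)
      go : Dec (d ~ a₁) → Dec (d ~ a₂) → Dec (d ~ a₃) → ⊥
      go (yes p) (yes q) (yes r) = proj₂ out (p , q , r)
      go (no n) _ _ = miss a₁A n
      go _ (no n) _ = miss a₂A n
      go _ _ (no n) = miss a₃A n

    OneA OneB : List V → Set
    OneA S = ∀ {s s' a a'} → s ∈ S → s' ∈ S → A a → A a' → s ~ a → s' ~ a' → a ≡ a'
    OneB S = ∀ {s s' b b'} → s ∈ S → s' ∈ S → B b → B b' → s ~ b → s' ~ b' → b ≡ b'

    -- Suppose d sees a and S sees a different a'. As d and S each see at most one vertex of B, one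
    -- of b₁, b₂, b₃ is unattached, and a square avoiding unwanted attachments can be chosen; which
    -- one depends on whether some vertex of B is attached at all.
    vertex-B⇒step : ∀ {S d s} → (∀ {b b'} → B b → B b' → d ~ b → d ~ b' → b ≡ b') →
      Grow S → (∀ {u} → u ∈ S → Out u) → OneA S → OneB S → s ∈ S → s ~ d → Out d → OneA (d ∷ S)
    vertex-B⇒step {S} {d} {s} vB g outS oneA oneB s∈ sd outd = res
      where
      outS' : ∀ {u} → u ∈ d ∷ S → Out u
      outS' (here refl) = outd
      outS' (there m) = outS m
      cn : Conn (d ∷ S)
      cn = grow-conn (add g s∈ sd)
      att? : ∀ b → Dec (Any (_~ b) (d ∷ S))
      att? b = Any.any? (_~? b) (d ∷ S)
      free-b : ∃ λ b' → B b' × ¬ Any (_~ b') (d ∷ S)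
      free-b with att? b₁ | att? b₂ | att? b₃
      ... | no n | _ | _ = b₁ , b₁B , n
      ... | yes _ | no n | _ = b₂ , b₂B , n
      ... | yes _ | yes _ | no n = b₃ , b₃B , n
      ... | yes p | yes q | yes r with ∈-any p | ∈-any q | ∈-any r
      ... | _ , here refl , e | _ , here refl , f | _ = ⊥-elim (b₁₂ (vB b₁B b₂B e f))
      ... | _ , here refl , e | _ , there _ , _ | _ , here refl , f = ⊥-elim (b₁₃ (vB b₁B b₃B e f))
      ... | _ , here refl , _ | _ , there m , e | _ , there m' , f = ⊥-elim (b₂₃ (oneB m m' b₂B b₃B e f))
      ... | _ , there m , e | _ , there m' , f | _ = ⊥-elim (b₁₂ (oneB m m' b₁B b₂B e f))
      ... | _ , there m , e | _ , here refl , _ | _ , there m' , f = ⊥-elim (b₁₃ (oneB m m' b₁B b₃B e f))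
      ... | _ , there _ , _ | _ , here refl , e | _ , here refl , f = ⊥-elim (b₂₃ (vB b₂B b₃B e f))
      clash : ∀ {u a a'} → A a → A a' → d ~ a → u ∈ S → u ~ a' → a ≢ a' → ⊥
      clash {u} {a} {a'} Aa Aa' da u∈ ua' ne with F.any? (λ b → inA? (k33-swap k) b ×-dec att? b)
      -- Nothing in B is attached, so a' is added to the set. On the square a, b₁, a″, b₂ it
      -- contributes b₁ and b₂, while d contributes a.
      ... | no none with other-a a a'
      ... | a″ , Aa″ , ne₁ , ne₂ = no-three-attachments {S = a' ∷ d ∷ S}
            (spot (square {a} {b₁} {a″} {b₂} (complete Aa b₁B) (~-sym (complete Aa″ b₁B)) (complete Aa″ b₂B) (~-sym (complete Aa b₂B)) (≢-sym ne₁) b₁₂ (A-stable Aa Aa″) ¬b₁₂)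
              (here refl) (there (here refl)) (there (there (there (here refl)))) (~-irrefl (complete Aa b₁B)) (~-irrefl (complete Aa b₂B)) b₁₂)
            (attaches (conn-cons cn (there u∈) (~-sym ua')) of' (there (here da)) (here (proj₁ Aa')) (here (proj₁ (proj₂ Aa'))) at)
        where
        ¬a″ : ∀ {w} → w ∈ d ∷ S → ¬ w ~ a″
        ¬a″ (here refl) e = ne₁ (vertex-A outd Aa″ Aa e da)
        ¬a″ (there m) e = ne₂ (oneA m u∈ Aa″ Aa' e ua')
        of' : ∀ {w} → w ∈ a' ∷ d ∷ S → w ∉ a ∷ b₁ ∷ a″ ∷ b₂ ∷ []
        of' (here refl) (here eq) = ne (sym eq)
        of' (here refl) (there (here eq)) = ~-irrefl (proj₁ Aa') eq
        of' (here refl) (there (there (here eq))) = ne₂ (sym eq)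
        of' (here refl) (there (there (there (here eq)))) = ~-irrefl (proj₁ (proj₂ Aa')) eq
        of' (there m) (here eq) = out-≢A (outS' m) Aa eq
        of' (there m) (there (here eq)) = out-≢B (outS' m) b₁B eq
        of' (there m) (there (there (here eq))) = out-≢A (outS' m) Aa″ eq
        of' (there m) (there (there (there (here eq)))) = out-≢B (outS' m) b₂B eq
        at : ∀ {w q} → w ∈ a' ∷ d ∷ S → q ∈ a ∷ b₁ ∷ a″ ∷ b₂ ∷ [] → w ~ q → q ≡ a ⊎ q ≡ b₁ ⊎ q ≡ b₂
        at _ (here eq) e = inj₁ eq
        at _ (there (here eq)) e = inj₂ (inj₁ eq)
        at _ (there (there (there (here eq)))) e = inj₂ (inj₂ eq)
        at (here refl) (there (there (here refl))) e = ⊥-elim (A-stable Aa' Aa″ e)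
        at (there m) (there (there (here refl))) e = ⊥-elim (¬a″ m e)
      -- With an attached b and an unattached b', the square a, b, a', b' is attached exactly at a,
      -- b and a'.
      clash {u} {a} {a'} Aa Aa' da u∈ ua' ne | yes (b , Bb , batt) with free-b
      ... | b' , Bb' , ¬batt = no-three-attachments {S = d ∷ S}
            (spot (square {a} {b} {a'} {b'} (complete Aa Bb) (~-sym (complete Aa' Bb)) (complete Aa' Bb') (~-sym (complete Aa Bb')) ne (λ { refl → ¬batt batt }) (A-stable Aa Aa') (B-stable Bb Bb'))
              (here refl) (there (here refl)) (there (there (here refl))) (~-irrefl (complete Aa Bb)) ne (λ e → ~-irrefl (complete Aa' Bb) (sym e)))
            (attaches cn of' (here da) batt (there (any-∈ u∈ ua')) at)
        where
        of' : ∀ {w} → w ∈ d ∷ S → w ∉ a ∷ b ∷ a' ∷ b' ∷ []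
        of' m (here eq) = out-≢A (outS' m) Aa eq
        of' m (there (here eq)) = out-≢B (outS' m) Bb eq
        of' m (there (there (here eq))) = out-≢A (outS' m) Aa' eq
        of' m (there (there (there (here eq)))) = out-≢B (outS' m) Bb' eq
        at : ∀ {w q} → w ∈ d ∷ S → q ∈ a ∷ b ∷ a' ∷ b' ∷ [] → w ~ q → q ≡ a ⊎ q ≡ b ⊎ q ≡ a'
        at _ (here eq) e = inj₁ eq
        at _ (there (here eq)) e = inj₂ (inj₁ eq)
        at _ (there (there (here eq))) e = inj₂ (inj₂ eq)
        at m (there (there (there (here refl)))) e = ⊥-elim (¬batt (any-∈ m e))
      ded : ∀ {u a a'} → A a → A a' → d ~ a → u ∈ S → u ~ a' → a ≡ a'
      ded {u} {a} {a'} Aa Aa' da u∈ ua' with a F.≟ a'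
      ... | yes e = e
      ... | no ne = ⊥-elim (clash Aa Aa' da u∈ ua' ne)
      res : OneA (d ∷ S)
      res (here refl) (here refl) Aa Aa' e e' = vertex-A outd Aa Aa' e e'
      res (here refl) (there m) Aa Aa' e e' = ded Aa Aa' e m e'
      res (there m) (here refl) Aa Aa' e e' = sym (ded Aa' Aa e' m e)
      res (there m) (there m') Aa Aa' e e' = oneA m m' Aa Aa' e e'

  module TwoSides (thin : Thin) (k : K33) where
    module Sᴬ = Side thin k
    module Sᴮ = Side thin (k33-swap k)
    open Sᴬ using (A; B; Out; OneA; OneB)

    flip-out : ∀ {d} → Out d → Sᴮ.Out d
    flip-out (p , q) = q , p

    -- Both sides are treated in one induction: adding a vertex for one side uses the bound already
    -- known for the other.
    grow-one : ∀ {S} → Grow S → (∀ {u} → u ∈ S → Out u) → OneA S × OneB S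
    grow-one (one d) out = (λ { (here refl) (here refl) → Sᴬ.vertex-A (out (here refl)) }) , (λ { (here refl) (here refl) → Sᴮ.vertex-A (flip-out (out (here refl))) })
    grow-one (add {S} {s} {d} g m e) out with grow-one g (λ q → out (there q))
    ... | oA , oB = Sᴬ.vertex-B⇒step (Sᴮ.vertex-A (flip-out (out (here refl)))) g (λ q → out (there q)) oA oB m e (out (here refl)) ,
                    Sᴮ.vertex-B⇒step (Sᴬ.vertex-A (out (here refl))) g (λ q → flip-out (out (there q))) oB oA m e (flip-out (out (here refl)))

    out? : Decidable Out
    out? d = ¬? (inA? k d) ×-dec ¬? (inA? (k33-swap k) d)

    -- The set absorbs the walk until the walk ends or enters the bipartite graph; the first vertex
    -- q met there is then an attachment of the set.
    grow-along : ∀ {X S c b} → Grow S → (∀ {u} → u ∈ S → Out u) → c ∈ S → Reach R X c b →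
      (∃ λ S' → Grow S' × (∀ {u} → u ∈ S' → Out u) × (∀ {u} → u ∈ S → u ∈ S') × b ∈ S') ⊎
      (∃ λ S' → ∃ λ q → Grow S' × (∀ {u} → u ∈ S' → Out u) × (∀ {u} → u ∈ S → u ∈ S') × ¬ Out q × X q ≡ true × Any (_~ q) S')
    grow-along g out m (here x) = inj₁ (_ , g , out , (λ q → q) , m)
    grow-along g out m (step {b} {c} r x e) with grow-along g out m r
    ... | inj₂ done = inj₂ done
    ... | inj₁ (S' , g' , out' , inc , b∈) with out? c
    ... | yes oc = inj₁ (c ∷ S' , add g' b∈ e , (λ { (here refl) → oc ; (there q) → out' q }) , (λ q → there (inc q)) , here refl)
    ... | no no' = inj₂ (S' , c , g' , out' , inc , no' , x , any-∈ b∈ e)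

-- 3-connected graphs

avoid : ∀ {n} → Fin n → Fin n → Fin n → Bool
avoid a b x = not ((x == a) ∨ (x == b))

avoid₃ : ∀ {n} → Fin n → Fin n → Fin n → Fin n → Bool
avoid₃ a b c x = not ((x == a) ∨ (x == b) ∨ (x == c))

avoid⁻ : ∀ {n} {a b x : Fin n} → avoid a b x ≡ true → x ≢ a × x ≢ b
avoid⁻ {a = a} {b} {x} p = (λ { refl → true≢false (∨-trueˡ {b = x == b} (==-refl x)) (not-true⁻ p) }) , (λ { refl → true≢false (∨-trueʳ (x == a) (==-refl x)) (not-true⁻ p) })

avoid⁺ : ∀ {n} {a b x : Fin n} → x ≢ a → x ≢ b → avoid a b x ≡ true
avoid⁺ {a = a} {b} {x} p q rewrite ==-neq p | ==-neq q = refl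

avoid₃⁻ : ∀ {n} {a b c x : Fin n} → avoid₃ a b c x ≡ true → x ≢ a × x ≢ b × x ≢ c
avoid₃⁻ {a = a} {b} {c} {x} p =
  (λ { refl → true≢false (∨-trueˡ {b = (x == b) ∨ (x == c)} (==-refl x)) (not-true⁻ p) }) ,
  (λ { refl → true≢false (∨-trueʳ (x == a) (∨-trueˡ {b = x == c} (==-refl x))) (not-true⁻ p) }) ,
  (λ { refl → true≢false (∨-trueʳ (x == a) (∨-trueʳ (x == b) (==-refl x))) (not-true⁻ p) })

avoid₃⁺ : ∀ {n} {a b c x : Fin n} → x ≢ a → x ≢ b → x ≢ c → avoid₃ a b c x ≡ true
avoid₃⁺ p q r rewrite ==-neq p | ==-neq q | ==-neq r = refl

avoid-self₁ : ∀ {n} (a b : Fin n) → avoid a b a ≡ false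
avoid-self₁ a b rewrite ==-refl a = refl

avoid-self₂ : ∀ {n} (a b : Fin n) → avoid a b b ≡ false
avoid-self₂ a b rewrite ==-refl b | B.∨-zeroʳ (b == a) = refl

avoid₃-self₁ : ∀ {n} (a b c : Fin n) → avoid₃ a b c a ≡ false
avoid₃-self₁ a b c rewrite ==-refl a = refl

avoid₃-self₂ : ∀ {n} (a b c : Fin n) → avoid₃ a b c b ≡ false
avoid₃-self₂ a b c rewrite ==-refl b | B.∨-zeroʳ (b == a) = refl

reach-source : ∀ {n} {H : Adj n} {X a b} → Reach H X a b → X a ≡ true
reach-source (here x) = x
reach-source (step r _ _) = reach-source r

reach-target : ∀ {n} {H : Adj n} {X a b} → Reach H X a b → X b ≡ true
reach-target (here x) = x
reach-target (step _ x _) = x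

module Exits {n : ℕ} (R : Adj n) (isg : IsGraph R) (noISK4 : ¬ HasISK4 R) (noWheel : ¬ HasWheel R) where
  open Graph R isg
  open Flags R isg noISK4 noWheel
  open Claws R isg noISK4 noWheel

  members : (V → Bool) → List V
  members X = filterᵇ X (allFin n)

  members⁺ : ∀ {X u} → X u ≡ true → u ∈ members X
  members⁺ {X} {u} p = ∈-filter⁺ (λ y → B.T? (X y)) (∈-tabulate⁺ u) (subst T (sym p) tt)

  members⁻ : ∀ {X u} → u ∈ members X → X u ≡ true
  members⁻ {X} {u} m with X u | proj₂ (∈-filter⁻ (λ y → B.T? (X y)) {xs = allFin n} m)
  ... | true | _ = refl

  reach-walk : ∀ {X a b} → Reach R X a b → Walk (members X) a b
  reach-walk (here x) = stop (members⁺ x)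
  reach-walk (step r x e) = step (reach-walk r) (members⁺ x) e

  private
    within? : ∀ Q d v z → Dec (∃ λ q → q ∈ Q × q ≢ v × q ≢ z × d ~ q)
    within? Q d v z with Any.any? (λ q → ¬? (q F.≟ v) ×-dec ¬? (q F.≟ z) ×-dec (d ~? q)) Q
    ... | yes p = yes (∈-any p)
    ... | no np = no λ (q , m , r) → np (any-∈ m r)

  -- The walk may use a graph R₀ that differs from R inside Q.
  exit-along : ∀ {R₀ : Adj n} {Q v z c X b} → (∀ {u w} → u ∉ Q → R₀ u w ≡ true → u ~ w) → c ∉ Q → LabIn Q [ c ] v z →
    X v ≡ false → X z ≡ false → Reach R₀ X c b →
    Exit Q v z c (λ u → X u ≡ true) ⊎
    (b ∉ Q × ∃ λ U → Conn U × c ∈ U × b ∈ U × Off Q U × LabIn Q U v z × (∀ {u} → u ∈ U → X u ≡ true))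
  exit-along {c = c} agree c∉ labc Xv Xz (here x) = inj₂ (c∉ , [ c ] , conn-single c , here refl , here refl , (λ { (here refl) → c∉ }) , labc , (λ { (here refl) → x }))
  exit-along {R₀} {Q} {v} {z} {c} {X} agree c∉ labc Xv Xz (step {b} {d} r x e) with exit-along agree c∉ labc Xv Xz r
  ... | inj₁ ex = inj₁ ex
  ... | inj₂ (b∉ , U , cU , c∈ , b∈ , off , lab , inX) with d ∈? Q
  ... | yes d∈ with lab b∈ d∈ (agree b∉ e)
  ... | inj₁ refl = ⊥-elim (true≢false x Xv)
  ... | inj₂ refl = ⊥-elim (true≢false x Xz)
  exit-along {R₀} {Q} {v} {z} {c} {X} agree c∉ labc Xv Xz (step {b} {d} r x e) | inj₂ (b∉ , U , cU , c∈ , b∈ , off , lab , inX) | no d∉ with within? Q d v z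
  ... | yes (q , q∈ , q≢v , q≢z , dq) = inj₁ record { U = U ; conn = cU ; c∈U = c∈ ; offU = off ; labU = lab ; inP = inX ; d∉ = d∉ ; s∈U = b∈ ; s~d = agree b∉ e ; q∈ = q∈ ; q≢v = q≢v ; q≢z = q≢z ; d~q = dq }
  ... | no none = inj₂ (d∉ , d ∷ U , conn-cons cU b∈ (~-sym (agree b∉ e)) , there c∈ , here refl , (λ { (here refl) → d∉ ; (there m) → off m }) , lab' , (λ { (here refl) → x ; (there m) → inX m }))
    where
    lab' : LabIn Q (d ∷ U) v z
    lab' {q = q} (here refl) m f with q F.≟ v | q F.≟ z
    ... | yes p | _ = inj₁ p
    ... | no _ | yes p = inj₂ p
    ... | no p | no p' = ⊥-elim (none (q , m , p , p' , f))
    lab' (there k) m f = lab k m f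

  exit-map : ∀ {Q v z c P P'} → (∀ {u} → P u → P' u) → Exit Q v z c P → Exit Q v z c P'
  exit-map f ex = record { U = U ; conn = conn ; c∈U = c∈U ; offU = offU ; labU = labU ; inP = λ m → f (inP m) ; d∉ = d∉ ; s∈U = s∈U ; s~d = s~d ; q∈ = q∈ ; q≢v = q≢v ; q≢z = q≢z ; d~q = d~q }
    where open Exit ex

  exit-reach : ∀ {R₀ : Adj n} {Q v z c X b} → (∀ {u w} → u ∉ Q → R₀ u w ≡ true → u ~ w) → c ∉ Q → LabIn Q [ c ] v z →
    X v ≡ false → X z ≡ false → b ∈ Q → Reach R₀ X c b → Exit Q v z c (λ u → X u ≡ true)
  exit-reach agree c∉ lab Xv Xz b∈ r with exit-along agree c∉ lab Xv Xz r
  ... | inj₁ ex = ex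
  ... | inj₂ (b∉ , _) = ⊥-elim (b∉ b∈)

  hole-other : ∀ {Q} → Hole Q → ∀ v z → ∃ λ b → b ∈ Q × b ≢ v × b ≢ z
  hole-other {Q} H v z with Any.any? (λ q → ¬? (q F.≟ v) ×-dec ¬? (q F.≟ z)) Q
  ... | yes p = ∈-any p
  ... | no np = ⊥-elim (ℕ.<⇒≱ (s≤s (unique-⊆-length {ys = v ∷ z ∷ []} (H .uniqᴴ) sub)) (ℕ.≤-trans (ℕ.n≤1+n 3) (H .long)))
    where
    sub : ∀ {a} → a ∈ Q → a ∈ v ∷ z ∷ []
    sub {a} m with a F.≟ v | a F.≟ z
    ... | yes p | _ = here p
    ... | no _ | yes p = there (here p)
    ... | no p | no q = ⊥-elim (np (any-∈ m (p , q)))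

  k4-⊥ : ∀ {a b c d} → a ~ b → a ~ c → a ~ d → b ~ c → b ~ d → c ~ d → ⊥
  k4-⊥ {a} {b} {c} {d} ab ac ad bc bd cd = noISK4 (4 , K .graph , K .subdiv , lookup X , lookup-injective un , adj)
    where
    X = a ∷ b ∷ c ∷ d ∷ []
    un : Unique X
    un = (~-irrefl ab ∷ ~-irrefl ac ∷ ~-irrefl ad ∷ []) ∷ (~-irrefl bc ∷ ~-irrefl bd ∷ []) ∷ (~-irrefl cd ∷ []) ∷ [] ∷ []
    K = sk4-base un
    E₀ = (b , c) ∷ (c , d) ∷ (d , b) ∷ (a , b) ∷ (a , c) ∷ (a , d) ∷ []
    0∈ : ∀ {A : Set} {x : A} {l} → x ∈ x ∷ l
    0∈ = here refl
    isE : ∀ {u w} → (u , w) ∈ E₀ → u ~ w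
    isE (here refl) = bc
    isE (there (here refl)) = cd
    isE (there (there (here refl))) = ~-sym bd
    isE (there (there (there (here refl)))) = ab
    isE (there (there (there (there (here refl))))) = ac
    isE (there (there (there (there (there (here refl)))))) = ad
    bw : ∀ {u w} → Edge E₀ u w → u ~ w
    bw (inj₁ m) = isE m
    bw (inj₂ m) = ~-sym (isE m)
    adj : ∀ i j → R (lookup X i) (lookup X j) ≡ K .graph i j
    adj i j = bool-ext fw (λ h → bw (K .edge⁻ i j h))
      where
      fw : lookup X i ~ lookup X j → K .graph i j ≡ true
      fw e with i F.≟ j
      ... | no _ = refl
      ... | yes refl = ⊥-elim (~-irrefl e refl)

module ThreeConnected {n : ℕ} (R : Adj n) (isg : IsGraph R) (noISK4 : ¬ HasISK4 R) (noWheel : ¬ HasWheel R) (4≤n : 4 ≤ n)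
    (conn₃ : ∀ a b {u w} → u ≢ a → u ≢ b → w ≢ a → w ≢ b → Reach R (avoid a b) u w) where
  open Graph R isg
  open Flags R isg noISK4 noWheel
  open Claws R isg noISK4 noWheel
  open Exits R isg noISK4 noWheel
  open Bipartite R isg noISK4 noWheel

  private
    -- The hole b, c, J, r with hub a.
    diamond-wheel : ∀ {a b c r p J} → a ~ b → c ~ a → c ~ b → Path (c ∷ J ++ [ r ]) → (∀ {u} → u ∈ c ∷ J ++ [ r ] → u ≢ a × u ≢ b) →
      r ~ b → (∀ {u} → u ∈ J → ¬ u ~ b) → p ∈ J ++ [ r ] → p ~ a → ⊥
    diamond-wheel {J = []} ab ca cb P av rb nob (here refl) pa = k4-⊥ ab (~-sym ca) (~-sym pa) (~-sym cb) (~-sym rb) (P .edge (here refl))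
    diamond-wheel {a} {b} {c} {r} {p} {j ∷ J} ab ca cb P av rb nob p∈ pa =
      noWheel (wheel {x = b} {c} {p} H a∉ (here refl) (there (here refl)) (there (there p∈)) (~-irrefl (~-sym cb)) (λ e → proj₂ (av (there p∈)) (sym e)) (λ e → U.Unique[x∷xs]⇒x∉xs (P .uniq) (subst (_∈ (j ∷ J) ++ [ r ]) (sym e) p∈)) ab (~-sym ca) (~-sym pa))
      where
      cr : ∀ {u w} → u ∈ [ b ] → w ∈ c ∷ (j ∷ J) ++ [ r ] → u ~ w → (u ≡ b × w ≡ c) ⊎ (u ≡ b × w ≡ r)
      cr (here refl) (here eq) e = inj₁ (refl , eq)
      cr (here refl) (there m) e with ∈-∷ʳ⁻ (j ∷ J) m
      ... | inj₁ k = ⊥-elim (nob k (~-sym e))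
      ... | inj₂ eq = inj₂ (refl , eq)
      H : Hole (b ∷ c ∷ (j ∷ J) ++ [ r ])
      H = hole-join {xs = [ b ]} (path-single b) P ([] , refl) ([] , refl) ((j ∷ J) ++ [ r ] , refl) (c ∷ j ∷ J , refl) (~-sym cb) rb
            (s≤s (s≤s (s≤s (subst (1 ≤_) (trans (ℕ.+-comm 1 (length J)) (sym (L.length-++ J))) (s≤s z≤n)))))
            (λ { (here refl) m → proj₂ (av m) refl }) cr
      a∉ : a ∉ b ∷ c ∷ (j ∷ J) ++ [ r ]
      a∉ (here eq) = ~-irrefl ab eq
      a∉ (there m) = proj₁ (av m) refl

    -- After p, the path is followed to the first neighbour r of b. Then b closes the path from c to
    -- r into a cycle, on which a sees b, c and p.
    diamond-half : ∀ {a b c p K₁ K₂} → a ~ b → c ~ a → c ~ b → Path (c ∷ K₁ ++ p ∷ K₂) → (∀ {u} → u ∈ c ∷ K₁ ++ p ∷ K₂ → u ≢ a × u ≢ b) →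
      (∀ {u} → u ∈ K₁ → ¬ u ~ b) → p ~ a → Any (_~ b) (p ∷ K₂) → ⊥
    diamond-half {a} {b} {c} {p} {K₁} {K₂} ab ca cb P av nob pa any with split-first (_~? b) any
    ... | J , r , J₂ , eq , rb , noJ = diamond-wheel {p = p} {J = K₁ ++ J} ab ca cb (path-++ˡ {c ∷ (K₁ ++ J) ++ [ r ]} (subst Path eq' P))
          (λ {u} m → av (subst (u ∈_) (sym eq') (∈-++⁺ˡ m))) rb nob' (subst (p ∈_) (sym (L.++-assoc K₁ J [ r ])) (∈-++⁺ʳ K₁ (first J eq))) pa
      where
      eq' : c ∷ K₁ ++ p ∷ K₂ ≡ (c ∷ (K₁ ++ J) ++ [ r ]) ++ J₂
      eq' = cong (c ∷_) (trans (cong (K₁ ++_) eq) (trans (sym (L.++-assoc K₁ J (r ∷ J₂))) (sym (L.++-assoc (K₁ ++ J) [ r ] J₂))))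
      first : ∀ J → p ∷ K₂ ≡ J ++ r ∷ J₂ → p ∈ J ++ [ r ]
      first [] refl = here refl
      first (_ ∷ J) refl = here refl
      nob' : ∀ {u} → u ∈ K₁ ++ J → ¬ u ~ b
      nob' m with ∈-++⁻ K₁ m
      ... | inj₁ k = nob k
      ... | inj₂ k = noJ k

  -- Two common neighbours c and d of a and b are joined by an induced path that avoids a and b. The
  -- first vertex after c that sees a or b determines which of the two becomes the hub; the other
  -- one closes the hole.
  thin : Thin
  thin {a} {b} {c} {d} ab ca cb da db with c F.≟ d
  ... | yes e = e
  ... | no c≢d with walk-path (reach-walk (conn₃ a b (~-irrefl ca) (~-irrefl cb) (~-irrefl da) (~-irrefl db)))
  ... | mkPF l p (t , refl) en inS with split-first (λ u → (u ~? a) ⊎-dec (u ~? b)) (any-∈ (tl (ends∈ en)) (inj₁ da))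
    where
    tl : d ∈ c ∷ t → d ∈ t
    tl (here e) = ⊥-elim (c≢d (sym e))
    tl (there m) = m
  ... | K₁ , p₀ , K₂ , refl , lab , none = ⊥-elim (go lab)
    where
    av : ∀ {u} → u ∈ c ∷ K₁ ++ p₀ ∷ K₂ → u ≢ a × u ≢ b
    av m = avoid⁻ (members⁻ (inS m))
    d∈ : d ∈ p₀ ∷ K₂
    d∈ with ends∈ en
    ... | here e = ⊥-elim (c≢d (sym e))
    ... | there m with ∈-++⁻ K₁ m
    ... | inj₁ k = ⊥-elim (none k (inj₁ da))
    ... | inj₂ k = k
    go : p₀ ~ a ⊎ p₀ ~ b → ⊥
    go (inj₁ e) = diamond-half {K₁ = K₁} ab ca cb p av (λ k f → none k (inj₂ f)) e (any-∈ d∈ db)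
    go (inj₂ e) = diamond-half {K₁ = K₁} (~-sym ab) cb ca p (λ m → let (x , y) = av m in y , x) (λ k f → none k (inj₁ f)) e (any-∈ d∈ da)

  fourth : ∀ x y z → ∃ λ (u : V) → u ≢ x × u ≢ y × u ≢ z
  fourth x y z with F.any? (λ u → ¬? (u F.≟ x) ×-dec ¬? (u F.≟ y) ×-dec ¬? (u F.≟ z))
  ... | yes p = p
  ... | no np = ⊥-elim (ℕ.<⇒≱ (s≤s len) 4≤n)
    where
    sub : ∀ {u} → u ∈ allFin n → u ∈ x ∷ y ∷ z ∷ []
    sub {u} _ with u F.≟ x | u F.≟ y | u F.≟ z
    ... | yes p | _ | _ = here p
    ... | no _ | yes p | _ = there (here p)
    ... | no _ | no _ | yes p = there (there (here p))
    ... | no p | no q | no r = ⊥-elim (np (u , p , q , r))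
    len : n ≤ 3
    len = subst (_≤ 3) (L.length-tabulate {n = n} (λ i → i)) (unique-⊆-length {xs = allFin n} {ys = x ∷ y ∷ z ∷ []} (U.tabulate⁺ (λ e → e)) sub)

  -- Some vertex u differs from v, x, y, and the last step of a walk from u to v avoiding x and y
  -- enters v from a suitable neighbour.
  another : ∀ {v} x y → v ≢ x → v ≢ y → ∃ λ w → v ~ w × w ≢ x × w ≢ y
  another {v} x y vx vy with fourth v x y
  ... | u , uv , ux , uy = go (conn₃ x y ux uy vx vy) uv
    where
    go : ∀ {w} → Reach R (avoid x y) u w → u ≢ w → ∃ λ w' → w ~ w' × w' ≢ x × w' ≢ y
    go (here _) ne = ⊥-elim (ne refl)
    go (step {b} r _ e) _ with avoid⁻ (reach-target r)
    ... | bx , by = b , ~-sym e , bx , by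

  module _ (k : K33) where
    open TwoSides thin k
    open K33 k

    Inside : V → Set
    Inside u = InA k u ⊎ InB k u

    -- From an outside vertex, three successive walks reach the bipartite graph, each avoiding the
    -- vertices already reached. This gives three distinct attachments of one connected outside set,
    -- two of them on the same side, against `grow-one`.
    cover : ∀ d → Inside d
    cover d with out? d
    ... | no nout with inA? k d | inA? (k33-swap k) d
    ... | yes p | _ = inj₁ p
    ... | no _ | yes p = inj₂ p
    ... | no p | no q = ⊥-elim (nout (p , q))
    -- Both deleted vertices are taken to be `b₁`, so a single vertex is deleted; `a₁` only provides
    -- the walk with a target inside.
    cover d | yes od = ⊥-elim (go₁ (grow-along (one d) (λ { (here refl) → od }) (here refl) (conn₃ b₁ b₁ (Sᴬ.out-≢B od Sᴬ.b₁B) (Sᴬ.out-≢B od Sᴬ.b₁B) (~-irrefl e₁₁) (~-irrefl e₁₁))))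
      where
      inA : ∀ {q} → InA k q → Sᴬ.Out q → ⊥
      inA p (n , _) = n p
      side : ∀ {q} → ¬ Sᴬ.Out q → Inside q
      side {q} nout with inA? k q | inA? (k33-swap k) q
      ... | yes p | _ = inj₁ p
      ... | no _ | yes p = inj₂ p
      ... | no p | no r = ⊥-elim (nout (p , r))
      ≢d : ∀ {q} → ¬ Sᴬ.Out q → d ≢ q
      ≢d n refl = n od
      go₃ : ∀ {S q₁ q₂ q₃} → Grow S → (∀ {u} → u ∈ S → Sᴬ.Out u) → Inside q₁ → Inside q₂ → Inside q₃ → q₂ ≢ q₁ → q₃ ≢ q₁ → q₃ ≢ q₂ →
        Any (_~ q₁) S → Any (_~ q₂) S → Any (_~ q₃) S → ⊥
      go₃ {S} {q₁} {q₂} {q₃} g out i₁ i₂ i₃ n₂₁ n₃₁ n₃₂ a₁ a₂ a₃ with grow-one g out | ∈-any a₁ | ∈-any a₂ | ∈-any a₃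
      ... | oA , oB | s₁ , m₁ , f₁ | s₂ , m₂ , f₂ | s₃ , m₃ , f₃ = pick i₁ i₂ i₃
        where
        pick : Inside q₁ → Inside q₂ → Inside q₃ → ⊥
        pick (inj₁ p) (inj₁ q) _ = n₂₁ (oA m₂ m₁ q p f₂ f₁)
        pick (inj₂ p) (inj₂ q) _ = n₂₁ (oB m₂ m₁ q p f₂ f₁)
        pick (inj₁ p) _ (inj₁ q) = n₃₁ (oA m₃ m₁ q p f₃ f₁)
        pick (inj₂ p) _ (inj₂ q) = n₃₁ (oB m₃ m₁ q p f₃ f₁)
        pick _ (inj₁ p) (inj₁ q) = n₃₂ (oA m₃ m₂ q p f₃ f₂)
        pick _ (inj₂ p) (inj₂ q) = n₃₂ (oB m₃ m₂ q p f₃ f₂)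
      any-inc : ∀ {S S' : List V} {q} → (∀ {u} → u ∈ S → u ∈ S') → Any (_~ q) S → Any (_~ q) S'
      any-inc f a with ∈-any a
      ... | b , m , e = any-∈ (f m) e
      go₂ : ∀ {S q₁ q₂} → Grow S → (∀ {u} → u ∈ S → Sᴬ.Out u) → d ∈ S → ¬ Sᴬ.Out q₁ → ¬ Sᴬ.Out q₂ → q₂ ≢ q₁ → Any (_~ q₁) S → Any (_~ q₂) S → ⊥
      go₂ {S} {q₁} {q₂} g out d∈ no₁ no₂ n₂₁ at₁ at₂ with Sᴬ.other-a q₁ q₂
      ... | a , Aa , a≢₁ , a≢₂ with grow-along g out d∈ (conn₃ q₁ q₂ (≢d no₁) (≢d no₂) a≢₁ a≢₂)
      ... | inj₁ (_ , _ , out' , _ , m) = inA Aa (out' m)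
      ... | inj₂ (S' , q₃ , g' , out' , inc , no₃ , x , at₃) with avoid⁻ {a = q₁} {q₂} {q₃} x
      ... | n₃₁ , n₃₂ = go₃ g' out' (side no₁) (side no₂) (side no₃) n₂₁ n₃₁ n₃₂ (any-inc inc at₁) (any-inc inc at₂) at₃
      go₁ : _ ⊎ _ → ⊥
      go₁ (inj₁ (_ , _ , out' , _ , m)) = inA Sᴬ.a₁A (out' m)
      go₁ (inj₂ (S , q₁ , g , out , inc , no₁ , _ , at₁)) with Sᴬ.other-a q₁ q₁
      ... | a , Aa , a≢ , _ with grow-along g out (inc (here refl)) (conn₃ q₁ q₁ (≢d no₁) (≢d no₁) a≢ a≢)
      ... | inj₁ (_ , _ , out' , _ , m) = inA Aa (out' m)
      ... | inj₂ (S' , q₂ , g' , out' , inc' , no₂ , x , at₂) = go₂ g' out' (inc' (inc (here refl))) no₁ no₂ (proj₁ (avoid⁻ {a = q₁} {q₁} {q₂} x)) (any-inc inc' at₁) at₂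

  record ThroughHole (v : V) : Set where
    field
      {a b}   : V
      m       : List V
      hole    : Hole (v ∷ m)
      a~v     : a ~ v
      b~v     : b ~ v
      nbrs    : ∀ {q} → q ∈ v ∷ m → v ~ q → q ≡ a ⊎ q ≡ b

  private
    -- The path from a to b is cut at the next neighbour r of v. If r directly follows a, then r
    -- replaces a: it cannot see b, because a and b would be two common neighbours of v and r.
    -- Otherwise v closes the piece from a to r into a hole.
    hole-through : ∀ {v a b} t → Path (a ∷ t) → Ends (a ∷ t) b → v ∉ a ∷ t → a ~ v → b ~ v → a ≢ b → ¬ a ~ b → ThroughHole v
    hole-through {v} {a} {b} t p en v∉ av bv a≢b a≁b with split-first (_~? v) (any-∈ {l = t} (tl (ends∈ en)) bv)
      where
      tl : b ∈ a ∷ t → b ∈ t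
      tl (here e) = ⊥-elim (a≢b (sym e))
      tl (there m) = m
    ... | [] , r , t' , refl , rv , none = hole-through t' (path-++ʳ [ a ] p) en' (λ m → v∉ (there m)) rv bv r≢b r≁b
      where
      ar : a ~ r
      ar = p .edge (here refl)
      r≢b : r ≢ b
      r≢b refl = a≁b ar
      r≁b : ¬ r ~ b
      r≁b e = a≢b (thin (~-sym rv) av ar bv (~-sym e))
      en' : Ends (r ∷ t') b
      en' = ends-suffix [ a ] en
    ... | j ∷ J , r , t' , refl , rv , none = record { m = l ; hole = H ; a~v = av ; b~v = rv ; nbrs = nb }
      where
      l = a ∷ (j ∷ J) ++ [ r ]
      eq : a ∷ (j ∷ J) ++ r ∷ t' ≡ l ++ t'
      eq = cong (a ∷_) (sym (L.++-assoc (j ∷ J) [ r ] t'))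
      pl : Path l
      pl = path-++ˡ {l} (subst Path eq p)
      v∉l : v ∉ l
      v∉l m = v∉ (subst (v ∈_) (sym eq) (∈-++⁺ˡ m))
      nbl : ∀ {q} → q ∈ l → v ~ q → q ≡ a ⊎ q ≡ r
      nbl (here e) _ = inj₁ e
      nbl (there m) e with ∈-∷ʳ⁻ (j ∷ J) m
      ... | inj₁ k = ⊥-elim (none k (~-sym e))
      ... | inj₂ k = inj₂ k
      nb : ∀ {q} → q ∈ v ∷ l → v ~ q → q ≡ a ⊎ q ≡ r
      nb (here refl) e = ⊥-elim (~-irrefl e refl)
      nb (there m) e = nbl m e
      cr : ∀ {u w} → u ∈ [ v ] → w ∈ l → u ~ w → (u ≡ v × w ≡ a) ⊎ (u ≡ v × w ≡ r)
      cr (here refl) m e with nbl m e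
      ... | inj₁ k = inj₁ (refl , k)
      ... | inj₂ k = inj₂ (refl , k)
      H : Hole (v ∷ l)
      H = hole-join {xs = [ v ]} (path-single v) pl ([] , refl) ([] , refl) ((j ∷ J) ++ [ r ] , refl) (a ∷ j ∷ J , refl) (~-sym av) rv
            (s≤s (s≤s (s≤s (subst (1 ≤_) (trans (ℕ.+-comm 1 (length J)) (sym (L.length-++ J))) (s≤s z≤n)))))
            (λ { (here refl) m → v∉l m }) cr

  escape : ∀ {Q v z c} → Hole Q → v ∈ Q → z ∈ Q → c ∉ Q → LabIn Q [ c ] v z → Exit Q v z c (λ _ → ⊤)
  escape {Q} {v} {z} {c} H v∈ z∈ c∉ lab with hole-other H v z
  ... | b , b∈ , bv , bz = exit-map _ (exit-reach {R₀ = R} (λ _ e → e) c∉ lab (avoid-self₁ v z) (avoid-self₂ v z) b∈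
        (conn₃ v z (λ { refl → c∉ v∈ }) (λ { refl → c∉ z∈ }) bv bz))

  ClawFree : Set
  ClawFree = ∀ {v a b c} → v ~ a → v ~ b → v ~ c → a ≢ b → a ≢ c → b ≢ c → ¬ a ~ b → ¬ a ~ c → ¬ b ~ c → ⊥

  -- A hole through v uses two neighbours a and b of v. Each of them equals or sees at most one of
  -- the three leaves of the claw, so some leaf c is distinct from and non-adjacent to both, and
  -- `hole-claw-⊥` applies to c.
  claw-free : ¬ K33 →
    (∀ {a b c u w} → a ~ b → a ~ c → b ~ c → avoid₃ a b c u ≡ true → avoid₃ a b c w ≡ true → Reach R (avoid₃ a b c) u w) → ClawFree
  claw-free noK33 conn△ {v} {x₁} {x₂} {x₃} v₁ v₂ v₃ n₁₂ n₁₃ n₂₃ ¬₁₂ ¬₁₃ ¬₂₃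
    with walk-path (reach-walk (conn₃ v v (λ e → ~-irrefl v₁ (sym e)) (λ e → ~-irrefl v₁ (sym e)) (λ e → ~-irrefl v₂ (sym e)) (λ e → ~-irrefl v₂ (sym e))))
  ... | mkPF l p (t , refl) en inS = pick (conf? a x₁) (conf? a x₂) (conf? a x₃) (conf? b x₁) (conf? b x₂) (conf? b x₃)
    where
    open ThroughHole (hole-through t p en (λ k → proj₁ (avoid⁻ {a = v} {v} {v} (members⁻ (inS k))) refl) (~-sym v₁) (~-sym v₂) n₁₂ ¬₁₂)
    Q = v ∷ m
    Conf : V → V → Set
    Conf a x = a ≡ x ⊎ a ~ x
    conf? : ∀ a x → Dec (Conf a x)
    conf? a x = (a F.≟ x) ⊎-dec (a ~? x)
    main : ∀ {c} → v ~ c → ¬ Conf a c → ¬ Conf b c → ⊥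
    main {c} vc na nb = hole-claw-⊥ noK33 thin hole (here refl) c∉ (~-sym vc) apart (λ z∈ lab → escape hole (here refl) z∈ c∉ lab) esc△
      where
      c∉ : c ∉ Q
      c∉ m with nbrs m vc
      ... | inj₁ e = na (inj₁ (sym e))
      ... | inj₂ e = nb (inj₁ (sym e))
      apart : ∀ {q} → q ∈ Q → v ~ q → ¬ c ~ q
      apart m vq cq with nbrs m vq
      ... | inj₁ refl = na (inj₂ (~-sym cq))
      ... | inj₂ refl = nb (inj₂ (~-sym cq))
      esc△ : ∀ {z t} → z ∈ Q → v ~ z → t ~ v → t ~ z → t ∉ Q → c ≢ t → LabIn Q [ c ] v z → Exit Q v z c (_≢ t)
      esc△ {z} {t} z∈ vz tv tz t∉ c≢t lab with hole-other hole v z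
      ... | b , b∈ , bv , bz = exit-map (λ {u} x → proj₂ (proj₂ (avoid₃⁻ {a = v} {z} {t} {u} x))) (exit-reach {R₀ = R} {X = avoid₃ v z t} (λ _ e → e) c∉ lab (avoid₃-self₁ v z t) (avoid₃-self₂ v z t) b∈
            (conn△ vz (~-sym tv) (~-sym tz) (avoid₃⁺ (λ { refl → c∉ (here refl) }) (λ { refl → c∉ z∈ }) c≢t) (avoid₃⁺ bv bz (λ { refl → t∉ b∈ }))))
    -- If a saw two leaves, these would be two common neighbours of a and v, against thinness; and a
    -- leaf equal to a sees no other leaf.
    clash : ∀ {a x y} → a ~ v → v ~ x → v ~ y → x ≢ y → ¬ x ~ y → Conf a x → Conf a y → ⊥
    clash av vx vy ne nadj (inj₁ refl) (inj₁ e) = ne e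
    clash av vx vy ne nadj (inj₁ refl) (inj₂ e) = nadj e
    clash av vx vy ne nadj (inj₂ e) (inj₁ refl) = nadj (~-sym e)
    clash av vx vy ne nadj (inj₂ e) (inj₂ f) = ne (thin av (~-sym e) (~-sym vx) (~-sym f) (~-sym vy))
    pick : Dec (Conf a x₁) → Dec (Conf a x₂) → Dec (Conf a x₃) → Dec (Conf b x₁) → Dec (Conf b x₂) → Dec (Conf b x₃) → ⊥
    pick (no p) _ _ (no q) _ _ = main v₁ p q
    pick _ (no p) _ _ (no q) _ = main v₂ p q
    pick _ _ (no p) _ _ (no q) = main v₃ p q
    pick (yes p) (yes q) _ _ _ _ = clash a~v v₁ v₂ n₁₂ ¬₁₂ p q
    pick (yes p) _ (yes q) _ _ _ = clash a~v v₁ v₃ n₁₃ ¬₁₃ p q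
    pick _ (yes p) (yes q) _ _ _ = clash a~v v₂ v₃ n₂₃ ¬₂₃ p q
    pick _ _ _ (yes p) (yes q) _ = clash b~v v₁ v₂ n₁₂ ¬₁₂ p q
    pick _ _ _ (yes p) _ (yes q) = clash b~v v₁ v₃ n₁₃ ¬₁₃ p q
    pick _ _ _ _ (yes p) (yes q) = clash b~v v₂ v₃ n₂₃ ¬₂₃ p q

-- Deciding reachability and connectedness

module _ {n : ℕ} (H : Adj n) (X : Fin n → Bool) (a : Fin n) where

  private
    Closed : List (Fin n) → Set
    Closed S = ∀ {s c} → s ∈ S → X c ≡ true → H s c ≡ true → c ∈ S

    -- The number `k` is fuel. A list without repetitions has at most n entries, so once
    -- `n ≤ length S` nothing can be added and fuel zero is enough.
    closure : ∀ k S → Unique S → n ≤ k + length S → a ∈ S → (∀ {s} → s ∈ S → Reach H X a s) →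
      ∃ λ S' → a ∈ S' × (∀ {s} → s ∈ S' → Reach H X a s) × Closed S'
    closure k S u len m r with F.any? (λ c → ¬? (c ∈? S) ×-dec ((X c B.≟ true) ×-dec Any.any? (λ s → H s c B.≟ true) S))
    ... | no none = S , m , r , cl
      where
      cl : Closed S
      cl {s} {c} s∈ Xc e with c ∈? S
      ... | yes c∈ = c∈
      ... | no c∉ = ⊥-elim (none (c , c∉ , Xc , any-∈ s∈ e))
    closure zero S u len m r | yes (c , c∉ , _) = ⊥-elim (ℕ.<⇒≱ (unique-length≤ (unique-cons c∉ u)) len)
    closure (suc k) S u len m r | yes (c , c∉ , Xc , any) = closure k (c ∷ S) (unique-cons c∉ u) (subst (n ≤_) (sym (ℕ.+-suc k (length S))) len) (there m) r'
      where
      r' : ∀ {s} → s ∈ c ∷ S → Reach H X a s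
      r' (here refl) with ∈-any any
      ... | s , s∈ , e = step (r s∈) Xc e
      r' (there q) = r q

  reach? : ∀ b → Dec (Reach H X a b)
  reach? b with X a B.≟ true
  ... | no nX = no λ r → nX (reach-source r)
  ... | yes Xa with closure n [ a ] ([] ∷ []) (ℕ.m≤m+n n 1) (here refl) (λ { (here refl) → here Xa })
  ... | S , m , sound , cl with b ∈? S
  ... | yes b∈ = yes (sound b∈)
  ... | no b∉ = no λ r → b∉ (complete r)
    where
    complete : ∀ {b} → Reach H X a b → b ∈ S
    complete (here _) = m
    complete (step r x e) = cl (complete r) x e

disconnected? : ∀ {n} (H : Adj n) X → Dec (DisconnectedOn H X)
disconnected? H X = F.any? λ a → F.any? λ b → (X a B.≟ true) ×-dec ((X b B.≟ true) ×-dec ¬? (reach? H X a b))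

connected : ∀ {n} {H : Adj n} {X} → ¬ DisconnectedOn H X → ConnectedOn H X
connected {H = H} {X} nd a b Xa Xb with reach? H X a b
... | yes r = r
... | no nr = ⊥-elim (nd (a , b , Xa , Xb , nr))

-- R′ is R with the edge ab of the triangle abc removed; if both graphs are free, this is impossible.
module SoftTriangle {n : ℕ} (R : Adj n) (isg : IsGraph R) (noISK4 : ¬ HasISK4 R) (noWheel : ¬ HasWheel R) (4≤n : 4 ≤ n)
    (conn₃ : ∀ a b {u w} → u ≢ a → u ≢ b → w ≢ a → w ≢ b → Reach R (avoid a b) u w)
    (noK33 : ¬ Flags.K33 R isg noISK4 noWheel)
    (R′ : Adj n) (isg′ : IsGraph R′) (noISK4′ : ¬ HasISK4 R′) (noWheel′ : ¬ HasWheel R′)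
    {a b c : Fin n} (ab : R a b ≡ true) (ac : R a c ≡ true) (bc : R b c ≡ true)
    (sub : ∀ {u w} → R′ u w ≡ true → R u w ≡ true)
    (keep : ∀ {u w} → R u w ≡ true → R′ u w ≡ true ⊎ (u ≡ a × w ≡ b) ⊎ (u ≡ b × w ≡ a))
    (gone : ¬ R′ a b ≡ true) where
  open Graph R isg
  open ThreeConnected R isg noISK4 noWheel 4≤n conn₃ using (thin; another)
  module G′ = Graph R′ isg′
  module E′ = Exits R′ isg′ noISK4′ noWheel′
  module C′ = Claws R′ isg′ noISK4′ noWheel′
  module F′ = Flags R′ isg′ noISK4′ noWheel′
  open Flags R isg noISK4 noWheel using (K33)

  private
    keep-off : ∀ {u w} → u ≢ a → u ≢ b → u ~ w → u G′.~ w
    keep-off ua ub e with keep e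
    ... | inj₁ e' = e'
    ... | inj₂ (inj₁ (eq , _)) = ⊥-elim (ua eq)
    ... | inj₂ (inj₂ (eq , _)) = ⊥-elim (ub eq)

    keep-off-a : ∀ {u w} → u ≢ a → w ≢ a → u ~ w → u G′.~ w
    keep-off-a ua wa e with keep e
    ... | inj₁ e' = e'
    ... | inj₂ (inj₁ (eq , _)) = ⊥-elim (ua eq)
    ... | inj₂ (inj₂ (_ , eq)) = ⊥-elim (wa eq)

    c≢a : c ≢ a
    c≢a e = ~-irrefl ac (sym e)

    c≢b : c ≢ b
    c≢b e = ~-irrefl bc (sym e)

    a≢b : a ≢ b
    a≢b = ~-irrefl ab

    S : List V
    S = E′.members (avoid c c)

    S⁺ : ∀ {u} → u ≢ c → u ∈ S
    S⁺ ne = E′.members⁺ {avoid c c} (avoid⁺ ne ne)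

    -- The walk leaves a through a third neighbour d and from there avoids a and c. So it never uses
    -- the removed edge ab, and c stays off the path.
    path′ : ∀ {d} → a ~ d → d ≢ b → d ≢ c → G′.PathFrom S a b
    path′ {d} a~d d≢b d≢c = G′.walk-path (G′.walk-trans (G′.step (G′.stop (S⁺ (~-irrefl ac))) (S⁺ d≢c) (G′.~-sym (keep-off d≢a d≢b (~-sym a~d))))
           (walk′ (conn₃ a c d≢a d≢c (≢-sym a≢b) (~-irrefl bc))))
      where
      d≢a : d ≢ a
      d≢a e = ~-irrefl a~d (sym e)
      walk′ : ∀ {w} → Reach R (avoid a c) d w → G′.Walk S d w
      walk′ (here x) = G′.stop (S⁺ d≢c)
      walk′ (step {w} {w'} r x e) = G′.step (walk′ r) (S⁺ (proj₂ (avoid⁻ {a = a} {c} {w'} x)))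
        (keep-off-a (proj₁ (avoid⁻ {a = a} {c} {w} (reach-target r))) (proj₁ (avoid⁻ {a = a} {c} {w'} x)) e)

  -- In `R` the path closes through the edge ab into a hole on which c sees only a and b, lest c be
  -- the hub of a wheel. In `R′` it closes through c into a hole Q, to which the flag lemma is
  -- applied at c with a further neighbour c'.
  module Closed (pf : G′.PathFrom S a b) {c'} (cc' : c ~ c') (c'≢a : c' ≢ a) (c'≢b : c' ≢ b) where
    private
      module pf = G′.PathFrom pf
      l : List V
      l = pf.list

      c∉l : c ∉ l
      c∉l m = proj₁ (avoid⁻ {a = c} {c} {c} (E′.members⁻ (pf.within m))) refl

      a∈l : a ∈ l
      a∈l = starts∈ pf.start

      b∈l : b ∈ l
      b∈l = ends∈ pf.end

      long-l : 4 ≤ length l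
      long-l = go pf.path pf.start pf.end c∉l
        where
        go : ∀ {l} → G′.Path l → Starts l a → Ends l b → c ∉ l → 4 ≤ length l
        go p ([] , refl) en _ = ⊥-elim (a≢b (ends-unique ([] , refl) en))
        go p (w ∷ [] , refl) en _ with ends-unique {l = a ∷ w ∷ []} (a ∷ [] , refl) en
        ... | refl = ⊥-elim (gone (p .G′.edge (here refl)))
        -- On a path a, w, b the vertex w would be a common neighbour of a and b, hence equal to c
        -- by thinness.
        go p (w ∷ w' ∷ [] , refl) en c∉ with ends-unique {l = a ∷ w ∷ w' ∷ []} (a ∷ w ∷ [] , refl) en
        ... | refl = ⊥-elim (c∉ (there (here (thin ab (~-sym ac) (~-sym bc) (~-sym (sub (p .G′.edge (here refl)))) (sub (p .G′.edge (there (here refl))))))))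
        go p (w ∷ w' ∷ w″ ∷ t , refl) en _ = s≤s (s≤s (s≤s (s≤s z≤n)))

      holeR : Hole l
      holeR = record { uniqᴴ = pf.path .G′.uniq ; long = long-l ; onlyᴴ = on ; edgeᴴ = ed }
        where
        on : ∀ {u w} → u ∈ l → w ∈ l → u ~ w → Edge (cyc l) u w
        on m k e with keep e
        ... | inj₁ e' = Edge-mono cyc⁺ (pf.path .G′.only m k e')
        ... | inj₂ (inj₁ (refl , refl)) = inj₂ (cyc-close pf.start pf.end)
        ... | inj₂ (inj₂ (refl , refl)) = inj₁ (cyc-close pf.start pf.end)
        ed : ∀ {u w} → (u , w) ∈ cyc l → u ~ w
        ed m with cyc⁻ pf.start pf.end m
        ... | inj₁ k = sub (pf.path .G′.edge k)
        ... | inj₂ (refl , refl) = ~-sym ab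

      lab : ∀ {u} → u ∈ l → c ~ u → u ≡ a ⊎ u ≡ b
      lab {u} m e with u F.≟ a | u F.≟ b
      ... | yes p | _ = inj₁ p
      ... | no _ | yes p = inj₂ p
      ... | no p | no q = ⊥-elim (noWheel (wheel holeR c∉l a∈l b∈l m a≢b (≢-sym p) (≢-sym q) (~-sym ac) (~-sym bc) e))

      Q : List V
      Q = c ∷ l

      c~′a : c G′.~ a
      c~′a = keep-off c≢a c≢b (~-sym ac)

      c~′b : c G′.~ b
      c~′b = keep-off c≢a c≢b (~-sym bc)

      hole′ : G′.Hole Q
      hole′ = G′.hole-join {xs = [ c ]} (G′.path-single c) pf.path ([] , refl) ([] , refl) pf.start pf.end c~′a (G′.~-sym c~′b)
                (ℕ.m≤n⇒m≤1+n long-l) (λ { (here refl) m → c∉l m }) cr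
        where
        cr : ∀ {u w} → u ∈ [ c ] → w ∈ l → u G′.~ w → (u ≡ c × w ≡ a) ⊎ (u ≡ c × w ≡ b)
        cr (here refl) m e with lab m (sub e)
        ... | inj₁ p = inj₁ (refl , p)
        ... | inj₂ p = inj₂ (refl , p)

      c'∉ : c' ∉ Q
      c'∉ (here e) = ~-irrefl cc' (sym e)
      c'∉ (there m) with lab m cc'
      ... | inj₁ p = c'≢a p
      ... | inj₂ p = c'≢b p

      -- An induced K₃,₃ of `R′` stays induced in `R`: two vertices of one side that became adjacent
      -- would have two common neighbours, against thinness.
      noK33′ : ¬ F′.K33
      noK33′ k = noK33 record { a₁ = k.a₁ ; a₂ = k.a₂ ; a₃ = k.a₃ ; b₁ = k.b₁ ; b₂ = k.b₂ ; b₃ = k.b₃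
        ; a₁₂ = k.a₁₂ ; a₁₃ = k.a₁₃ ; a₂₃ = k.a₂₃ ; b₁₂ = k.b₁₂ ; b₁₃ = k.b₁₃ ; b₂₃ = k.b₂₃
        ; ¬a₁₂ = nA k.e₁₁ k.e₂₁ k.e₁₂ k.e₂₂ ; ¬a₁₃ = nA k.e₁₁ k.e₃₁ k.e₁₂ k.e₃₂ ; ¬a₂₃ = nA k.e₂₁ k.e₃₁ k.e₂₂ k.e₃₂
        ; ¬b₁₂ = nB k.e₁₁ k.e₁₂ k.e₂₁ k.e₂₂ ; ¬b₁₃ = nB k.e₁₁ k.e₁₃ k.e₂₁ k.e₂₃ ; ¬b₂₃ = nB k.e₁₂ k.e₁₃ k.e₂₂ k.e₂₃
        ; e₁₁ = sub k.e₁₁ ; e₁₂ = sub k.e₁₂ ; e₁₃ = sub k.e₁₃ ; e₂₁ = sub k.e₂₁ ; e₂₂ = sub k.e₂₂ ; e₂₃ = sub k.e₂₃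
        ; e₃₁ = sub k.e₃₁ ; e₃₂ = sub k.e₃₂ ; e₃₃ = sub k.e₃₃ }
        where
        module k = F′.K33 k
        nA : ∀ {u w} → u G′.~ k.b₁ → w G′.~ k.b₁ → u G′.~ k.b₂ → w G′.~ k.b₂ → ¬ u ~ w
        nA p q r s e = k.b₁₂ (thin e (~-sym (sub p)) (~-sym (sub q)) (~-sym (sub r)) (~-sym (sub s)))
        nB : ∀ {u w} → k.a₁ G′.~ u → k.a₁ G′.~ w → k.a₂ G′.~ u → k.a₂ G′.~ w → ¬ u ~ w
        nB p q r s e = k.a₁₂ (thin e (sub p) (sub q) (sub r) (sub s))

      esc′ : ∀ {z} → z ∈ Q → F′.LabIn Q [ c' ] c z → C′.Exit Q c z c' (λ _ → ⊤)
      esc′ {z} z∈ lb with E′.hole-other hole′ c z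
      ... | w , w∈ , wc , wz = E′.exit-map _ (E′.exit-reach {R₀ = R} {X = avoid c z} agree c'∉ lb (avoid-self₁ c z) (avoid-self₂ c z) w∈
            (conn₃ c z (λ e → c'∉ (here e)) (λ e → c'∉ (subst (_∈ Q) (sym e) z∈)) wc wz))
        where
        agree : ∀ {u w} → u ∉ Q → R u w ≡ true → u G′.~ w
        agree u∉ e = keep-off (λ { refl → u∉ (there a∈l) }) (λ { refl → u∉ (there b∈l) }) e

      fl : C′.Flag Q c c'
      fl = C′.flag noK33′ hole′ (here refl) c'∉ (keep-off c'≢a c'≢b (~-sym cc')) esc′

    -- The flag provides a vertex t off Q that sees c and one of a, b. By thinness the only vertex
    -- completing ca to a triangle is b, and the only one completing cb is a; both lie on Q.
    closed-⊥ : ⊥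
    closed-⊥ = go fl
      where
      at-a : ∀ {t} → t G′.~ c → t G′.~ a → t ∉ Q → ⊥
      at-a tc ta t∉ = t∉ (subst (_∈ Q) (thin (~-sym ac) bc (~-sym ab) (sub tc) (sub ta)) (there b∈l))
      at-b : ∀ {t} → t G′.~ c → t G′.~ b → t ∉ Q → ⊥
      at-b tc tb t∉ = t∉ (subst (_∈ Q) (thin (~-sym bc) ac ab (sub tc) (sub tb)) (there a∈l))
      go : C′.Flag Q c c' → ⊥
      go f with C′.Flag.z∈ f
      ... | here e = G′.~-irrefl (C′.Flag.v~z f) (sym e)
      ... | there m with lab m (sub (C′.Flag.v~z f))
      ... | inj₁ e = at-a (C′.Flag.t~v f) (subst (C′.Flag.t f G′.~_) e (C′.Flag.t~z f)) (C′.Flag.offW f (C′.Flag.t∈W f))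
      ... | inj₂ e = at-b (C′.Flag.t~v f) (subst (C′.Flag.t f G′.~_) e (C′.Flag.t~z f)) (C′.Flag.offW f (C′.Flag.t∈W f))

  impossible : ⊥
  impossible with another b c a≢b (~-irrefl ac) | another a b c≢a c≢b
  ... | d , a~d , d≢b , d≢c | c' , cc' , c'≢a , c'≢b = Closed.closed-⊥ (path′ a~d d≢b d≢c) cc' c'≢a c'≢b

-- Maximal cliques and the root graph

isYes⁺ : ∀ {P : Set} {d : Dec P} → P → ⌊ d ⌋ ≡ true
isYes⁺ {d = yes _} p = refl
isYes⁺ {d = no n} p = ⊥-elim (n p)

isYes⁻ : ∀ {P : Set} {d : Dec P} → ⌊ d ⌋ ≡ true → P
isYes⁻ {d = yes p} _ = p

-- The cyclic successor on indices, and pigeonhole arguments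

next-exists : ∀ {k} (i : Fin k) → ∃ λ j → next k i j ≡ true
next-exists {suc k} i with suc (toℕ i) ℕ.<? suc k
... | yes lt = fromℕ< lt , next⁺ {i = i} {fromℕ< lt} (inj₁ (sym (F.toℕ-fromℕ< lt)))
... | no nlt = zero , next⁺ {i = i} {zero} (inj₂ (ℕ.≤-antisym (F.toℕ<n i) (ℕ.≮⇒≥ nlt) , refl))

prev-exists : ∀ {k} (i : Fin k) → ∃ λ j → next k j i ≡ true
prev-exists {suc k} zero = fromℕ k , next⁺ {i = fromℕ k} {zero} (inj₂ (cong suc (F.toℕ-fromℕ k) , refl))
prev-exists {suc k} (suc i) = inject₁ i , next⁺ {i = inject₁ i} {suc i} (inj₁ (cong suc (F.toℕ-inject₁ i)))

next-functional : ∀ {k} {i j j' : Fin k} → next k i j ≡ true → next k i j' ≡ true → j ≡ j'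
next-functional {k} {i} {j} {j'} p q with next⁻ {i = i} {j} p | next⁻ {i = i} {j'} q
... | inj₁ a | inj₁ b = F.toℕ-injective (trans (sym a) b)
... | inj₁ a | inj₂ (b , _) = ⊥-elim (ℕ.<⇒≢ (F.toℕ<n j) (trans (sym a) b))
... | inj₂ (a , _) | inj₁ b = ⊥-elim (ℕ.<⇒≢ (F.toℕ<n j') (trans (sym b) a))
... | inj₂ (_ , a) | inj₂ (_ , b) = F.toℕ-injective (trans a (sym b))

next-injective : ∀ {k} {i i' j : Fin k} → next k i j ≡ true → next k i' j ≡ true → i ≡ i'
next-injective {k} {i} {i'} {j} p q with next⁻ {i = i} {j} p | next⁻ {i = i'} {j} q
... | inj₁ a | inj₁ b = F.toℕ-injective (ℕ.suc-injective (trans a (sym b)))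
... | inj₁ a | inj₂ (_ , b) = ⊥-elim (ℕ.1+n≢0 (trans a b))
... | inj₂ (_ , a) | inj₁ b = ⊥-elim (ℕ.1+n≢0 (trans b a))
... | inj₂ (a , _) | inj₂ (b , _) = F.toℕ-injective (ℕ.suc-injective (trans a (sym b)))

next-asym : ∀ {k} {i j : Fin k} → 3 ≤ k → next k i j ≡ true → next k j i ≡ true → ⊥
next-asym {k} {i} {j} 3≤k p q with next⁻ {i = i} {j} p | next⁻ {i = j} {i} q
... | inj₁ a | inj₁ b = ℕ.<⇒≢ (ℕ.<-trans (ℕ.n<1+n _) (ℕ.≤-reflexive (cong suc a))) (sym b)
... | inj₁ a | inj₂ (b , c) = ℕ.<⇒≢ 3≤k (trans (cong (λ t → suc (suc t)) (sym c)) (trans (cong suc a) b))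
... | inj₂ (a , c) | inj₁ b = ℕ.<⇒≢ 3≤k (trans (cong (λ t → suc (suc t)) (sym c)) (trans (cong suc b) a))
... | inj₂ (a , c) | inj₂ (b , d) = ℕ.<⇒≢ (ℕ.≤-trans (ℕ.n≤1+n 2) 3≤k) (trans (cong suc (sym c)) b)

next-irrefl : ∀ {k} {i : Fin k} → 3 ≤ k → next k i i ≡ true → ⊥
next-irrefl {i = i} 3≤k p = next-asym {i = i} {i} 3≤k p p


injective⇒surjective : ∀ {k} {f : Fin k → Fin k} → InjectiveFn f → ∀ y → ∃ λ x → f x ≡ y
injective⇒surjective {k} {f} inj y with F.any? (λ x → f x F.≟ y)
... | yes p = p
... | no none = ⊥-elim (ℕ.1+n≰n (subst (λ l → suc l ≤ k) (L.length-tabulate f) (unique-length≤ (unique-cons y∉ (U.tabulate⁺ inj)))))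
  where
  y∉ : y ∉ tabulate f
  y∉ mem with ∈-tabulate⁻ mem
  ... | x , e = none (x , sym e)

-- Sending each index to a reason for excluding it would map four indices to three reasons, and each
-- reason excludes at most one index.
three-exceptions : ∀ {k} → 4 ≤ k → {P Q S : Fin k → Set} → Decidable P → Decidable Q → Decidable S →
  (∀ {i j} → P i → P j → i ≡ j) → (∀ {i j} → Q i → Q j → i ≡ j) → (∀ {i j} → S i → S j → i ≡ j) →
  ∃ λ i → ¬ P i × ¬ Q i × ¬ S i
three-exceptions {k} 4≤k {P} {Q} {S} P? Q? S? uP uQ uS with F.any? (λ i → ¬? (P? i) ×-dec (¬? (Q? i) ×-dec ¬? (S? i)))
... | yes p = p
... | no none = ⊥-elim (clash (F.pigeonhole ℕ.≤-refl (λ (i : Fin 4) → proj₁ (reason (inject≤ i 4≤k)))))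
  where
  Reason : Fin 3 → Fin k → Set
  Reason zero = P
  Reason (suc zero) = Q
  Reason (suc (suc zero)) = S
  reason : ∀ i → ∃ λ r → Reason r i
  reason i with P? i | Q? i | S? i
  ... | yes p | _ | _ = zero , p
  ... | no _ | yes p | _ = suc zero , p
  ... | no _ | no _ | yes p = suc (suc zero) , p
  ... | no p | no q | no r = ⊥-elim (none (i , p , q , r))
  same : ∀ r {i j} → Reason r i → Reason r j → i ≡ j
  same zero = uP
  same (suc zero) = uQ
  same (suc (suc zero)) = uS
  clash : ∃ (λ (i : Fin 4) → ∃ λ j → i <ᶠ j × proj₁ (reason (inject≤ i 4≤k)) ≡ proj₁ (reason (inject≤ j 4≤k))) → ⊥
  clash (i , j , i<j , eq) = F.<⇒≢ i<j (F.inject≤-injective 4≤k 4≤k i j (same _ (subst (λ r → Reason r (inject≤ i 4≤k)) eq (proj₂ (reason (inject≤ i 4≤k)))) (proj₂ (reason (inject≤ j 4≤k)))))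

record Tight {n : ℕ} (R : Adj n) : Set where
  field
    isg       : IsGraph R
    noWheel   : ¬ HasWheel R
    thin      : ∀ {a b c d} → R a b ≡ true → R c a ≡ true → R c b ≡ true → R d a ≡ true → R d b ≡ true → c ≡ d
    claw-free : ∀ {v a b c} → R v a ≡ true → R v b ≡ true → R v c ≡ true → a ≢ b → a ≢ c → b ≢ c →
                ¬ R a b ≡ true → ¬ R a c ≡ true → ¬ R b c ≡ true → ⊥
    fourth    : ∀ x y z → ∃ λ (u : Fin n) → u ≢ x × u ≢ y × u ≢ z
    another   : ∀ {v} x y → v ≢ x → v ≢ y → ∃ λ w → R v w ≡ true × w ≢ x × w ≢ y
    conn₃     : ∀ a b {u w} → u ≢ a → u ≢ b → w ≢ a → w ≢ b → Reach R (avoid a b) u w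
    conn△     : ∀ {a b c u w} → R a b ≡ true → R a c ≡ true → R b c ≡ true →
                avoid₃ a b c u ≡ true → avoid₃ a b c w ≡ true → Reach R (avoid₃ a b c) u w
    v₀        : Fin n

-- The maximal cliques as an abstract incidence relation, independent of how they are enumerated.
-- Besides `lo` and `hi` a clique contains only common neighbours of these two, of which thinness
-- allows one.
record CliqueSystem {n : ℕ} (R : Adj n) : Set₁ where
  infix 4 _∋_ _∋?_
  field
    m           : ℕ
    _∋_         : Fin m → Fin n → Set
    _∋?_        : ∀ x u → Dec (x ∋ u)
    lo hi       : Fin m → Fin n
    lo∈         : ∀ x → x ∋ lo x
    hi∈         : ∀ x → x ∋ hi x
    lo~hi       : ∀ x → R (lo x) (hi x) ≡ true
    cases       : ∀ {x u} → x ∋ u → u ≡ lo x ⊎ u ≡ hi x ⊎ (R u (lo x) ≡ true × R u (hi x) ≡ true)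
    clique      : ∀ {x u w} → x ∋ u → x ∋ w → u ≢ w → R u w ≡ true
    maximal     : ∀ {x u w t} → x ∋ u → x ∋ w → u ≢ w → R t u ≡ true → R t w ≡ true → x ∋ t
    determined  : ∀ {x y u w} → u ≢ w → x ∋ u → x ∋ w → y ∋ u → y ∋ w → x ≡ y
    edge-clique : ∀ {u w} → R u w ≡ true → ∃ λ x → x ∋ u × x ∋ w

module Cliques {n : ℕ} (R : Adj n) (isg : IsGraph R)
    (thin : ∀ {a b c d} → R a b ≡ true → R c a ≡ true → R c b ≡ true → R d a ≡ true → R d b ≡ true → c ≡ d) where
  open Graph R isg

  -- A clique is named by its two smallest vertices.
  Canonical : V × V → Set
  Canonical (i , j) = (i <ᶠ j) × (i ~ j) × (∀ c → c ~ i → c ~ j → j <ᶠ c)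

  canonical? : Decidable Canonical
  canonical? (i , j) = (i F.<? j) ×-dec ((i ~? j) ×-dec F.all? (λ c → (c ~? i) →-dec ((c ~? j) →-dec (j F.<? c))))

  names : List (V × V)
  names = filter canonical? (cartesianProduct (allFin n) (allFin n))

  m : ℕ
  m = length names

  lo hi : Fin m → V
  lo x = proj₁ (lookup names x)
  hi x = proj₂ (lookup names x)

  canonical : ∀ x → Canonical (lo x , hi x)
  canonical x = proj₂ (∈-filter⁻ canonical? {xs = cartesianProduct (allFin n) (allFin n)} (∈-lookup {xs = names} x))

  unique-names : Unique names
  unique-names = U.filter⁺ canonical? (U.cartesianProduct⁺ (U.tabulate⁺ (λ e → e)) (U.tabulate⁺ (λ e → e)))

  Mem : V → V → V → Set
  Mem i j u = u ≡ i ⊎ u ≡ j ⊎ (u ~ i × u ~ j)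

  _∋_ : Fin m → V → Set
  x ∋ u = Mem (lo x) (hi x) u

  _∋?_ : ∀ x u → Dec (x ∋ u)
  x ∋? u = (u F.≟ lo x) ⊎-dec ((u F.≟ hi x) ⊎-dec ((u ~? lo x) ×-dec (u ~? hi x)))

  lo~hi : ∀ x → lo x ~ hi x
  lo~hi x = proj₁ (proj₂ (canonical x))

  clique : ∀ {x u w} → x ∋ u → x ∋ w → u ≢ w → u ~ w
  clique {x} (inj₁ refl) (inj₁ refl) ne = ⊥-elim (ne refl)
  clique {x} (inj₁ refl) (inj₂ (inj₁ refl)) ne = lo~hi x
  clique {x} (inj₁ refl) (inj₂ (inj₂ (p , q))) ne = ~-sym p
  clique {x} (inj₂ (inj₁ refl)) (inj₁ refl) ne = ~-sym (lo~hi x)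
  clique {x} (inj₂ (inj₁ refl)) (inj₂ (inj₁ refl)) ne = ⊥-elim (ne refl)
  clique {x} (inj₂ (inj₁ refl)) (inj₂ (inj₂ (p , q))) ne = ~-sym q
  clique {x} (inj₂ (inj₂ (p , q))) (inj₁ refl) ne = p
  clique {x} (inj₂ (inj₂ (p , q))) (inj₂ (inj₁ refl)) ne = q
  clique {x} (inj₂ (inj₂ (p , q))) (inj₂ (inj₂ (r , s))) ne = ⊥-elim (ne (thin (lo~hi x) p q r s))

  maximal : ∀ {x u w t} → x ∋ u → x ∋ w → u ≢ w → t ~ u → t ~ w → x ∋ t
  maximal (inj₁ refl) (inj₁ refl) ne p q = ⊥-elim (ne refl)
  maximal (inj₁ refl) (inj₂ (inj₁ refl)) ne p q = inj₂ (inj₂ (p , q))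
  maximal {x} (inj₁ refl) (inj₂ (inj₂ (r , s))) ne p q = inj₂ (inj₁ (thin (~-sym r) p q (~-sym (lo~hi x)) (~-sym s)))
  maximal (inj₂ (inj₁ refl)) (inj₁ refl) ne p q = inj₂ (inj₂ (q , p))
  maximal (inj₂ (inj₁ refl)) (inj₂ (inj₁ refl)) ne p q = ⊥-elim (ne refl)
  maximal {x} (inj₂ (inj₁ refl)) (inj₂ (inj₂ (r , s))) ne p q = inj₁ (thin (~-sym s) p q (lo~hi x) (~-sym r))
  maximal {x} (inj₂ (inj₂ (r , s))) (inj₁ refl) ne p q = inj₂ (inj₁ (thin (~-sym r) q p (~-sym (lo~hi x)) (~-sym s)))
  maximal {x} (inj₂ (inj₂ (r , s))) (inj₂ (inj₁ refl)) ne p q = inj₁ (thin (~-sym s) q p (lo~hi x) (~-sym r))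
  maximal {x} (inj₂ (inj₂ (p , q))) (inj₂ (inj₂ (r , s))) ne _ _ = ⊥-elim (ne (thin (lo~hi x) p q r s))

  private
    lo-min : ∀ {x u} → x ∋ u → lo x ≤ᶠ u
    lo-min (inj₁ refl) = ℕ.≤-refl
    lo-min {x} (inj₂ (inj₁ refl)) = ℕ.<⇒≤ (proj₁ (canonical x))
    lo-min {x} (inj₂ (inj₂ (p , q))) = ℕ.<⇒≤ (ℕ.<-trans (proj₁ (canonical x)) (proj₂ (proj₂ (canonical x)) _ p q))

    hi-min : ∀ {x u} → x ∋ u → u ≢ lo x → hi x ≤ᶠ u
    hi-min (inj₁ e) ne = ⊥-elim (ne e)
    hi-min (inj₂ (inj₁ refl)) ne = ℕ.≤-refl
    hi-min {x} (inj₂ (inj₂ (p , q))) ne = ℕ.<⇒≤ (proj₂ (proj₂ (canonical x)) _ p q)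

    hi≢lo : ∀ x → hi x ≢ lo x
    hi≢lo x e = ~-irrefl (lo~hi x) (sym e)

  -- By maximality, cliques with two common vertices have the same members. Since `lo` and `hi` are
  -- the two smallest members, the names agree as well.
  determined : ∀ {x y u w} → u ≢ w → x ∋ u → x ∋ w → y ∋ u → y ∋ w → x ≡ y
  determined {x} {y} {u} {w} ne xu xw yu yw = lookup-injective unique-names (cong₂ _,_ los his)
    where
    inc : ∀ {x y} → x ∋ u → x ∋ w → y ∋ u → y ∋ w → ∀ {t} → x ∋ t → y ∋ t
    inc {x} {y} xu xw yu yw {t} xt with t F.≟ u | t F.≟ w
    ... | yes refl | _ = yu
    ... | no _ | yes refl = yw
    ... | no p | no q = maximal {y} yu yw ne (clique {x} xt xu p) (clique {x} xt xw q)
    fw = inc {x} {y} xu xw yu yw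
    bw = inc {y} {x} yu yw xu xw
    los : lo x ≡ lo y
    los = F.≤-antisym (lo-min {x} (bw (inj₁ refl))) (lo-min {y} (fw (inj₁ refl)))
    his : hi x ≡ hi y
    his = F.≤-antisym (hi-min {x} (bw (inj₂ (inj₁ refl))) (λ e → hi≢lo y (trans e los))) (hi-min {y} (fw (inj₂ (inj₁ refl))) (λ e → hi≢lo x (trans e (sym los))))

  private
    -- A common neighbour c < j of i and j replaces j, so that the larger named vertex decreases.
    canon : ∀ k {i j} → toℕ j < k → i <ᶠ j → i ~ j → ∃ λ x → ∀ {u} → Mem i j u → x ∋ u
    canon (suc k) {i} {j} (s≤s j≤k) i<j ij with F.any? (λ c → (c ~? i) ×-dec ((c ~? j) ×-dec ¬? (j F.<? c)))
    ... | no none with ∈⇒lookup (∈-filter⁺ canonical? (∈-cartesianProduct⁺ (∈-tabulate⁺ i) (∈-tabulate⁺ j)) can)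
      where
      can : Canonical (i , j)
      can = i<j , ij , λ c p q → below c p q
        where
        below : ∀ c → c ~ i → c ~ j → j <ᶠ c
        below c p q with j F.<? c
        ... | yes lt = lt
        ... | no nlt = ⊥-elim (none (c , p , q , nlt))
    ... | x , eq = x , λ {u} mu → subst (λ (p : V × V) → Mem (proj₁ p) (proj₂ p) u) (sym eq) mu
    canon (suc k) {i} {j} (s≤s j≤k) i<j ij | yes (c , ci , cj , nlt) with F.<-cmp i c
    ... | tri≈ _ e _ = ⊥-elim (~-irrefl ci (sym e))
    ... | tri< i<c _ _ = let (x , f) = canon k (ℕ.<-≤-trans c<j j≤k) i<c (~-sym ci) in x , λ mu → f (move mu)
      where
      c<j : c <ᶠ j
      c<j = ℕ.≤∧≢⇒< (ℕ.≮⇒≥ nlt) (λ e → ~-irrefl cj (F.toℕ-injective e))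
      move : ∀ {u} → Mem i j u → Mem i c u
      move (inj₁ e) = inj₁ e
      move (inj₂ (inj₁ refl)) = inj₂ (inj₂ (~-sym ij , ~-sym cj))
      move (inj₂ (inj₂ (p , q))) = inj₂ (inj₁ (thin ij p q ci cj))
    ... | tri> _ _ c<i = let (x , f) = canon k (ℕ.<-≤-trans i<j j≤k) c<i ci in x , λ mu → f (move mu)
      where
      move : ∀ {u} → Mem i j u → Mem c i u
      move (inj₁ e) = inj₂ (inj₁ e)
      move (inj₂ (inj₁ refl)) = inj₂ (inj₂ (~-sym cj , ~-sym ij))
      move (inj₂ (inj₂ (p , q))) = inj₁ (thin ij p q ci cj)

  edge-clique : ∀ {u w} → u ~ w → ∃ λ x → x ∋ u × x ∋ w
  edge-clique {u} {w} e with F.<-cmp u w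
  ... | tri≈ _ eq _ = ⊥-elim (~-irrefl e eq)
  ... | tri< lt _ _ = let (x , f) = canon (suc (toℕ w)) ℕ.≤-refl lt e in x , f (inj₁ refl) , f (inj₂ (inj₁ refl))
  ... | tri> _ _ gt = let (x , f) = canon (suc (toℕ u)) ℕ.≤-refl gt (~-sym e) in x , f (inj₂ (inj₁ refl)) , f (inj₁ refl)

  system : CliqueSystem R
  system = record { m = m ; _∋_ = _∋_ ; _∋?_ = _∋?_ ; lo = lo ; hi = hi ; lo∈ = λ x → inj₁ refl ; hi∈ = λ x → inj₂ (inj₁ refl) ; lo~hi = lo~hi
    ; cases = λ p → p ; clique = λ {x} → clique {x} ; maximal = λ {x} → maximal {x} ; determined = λ {x} {y} → determined {x} {y} ; edge-clique = edge-clique }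

module TwoEnds {n : ℕ} (R : Adj n) (tight : Tight R) (C : CliqueSystem R) where
  open Tight tight
  open Graph R isg
  open CliqueSystem C

  other-member : ∀ x u → ∃ λ w → x ∋ w × w ≢ u
  other-member x u with lo x F.≟ u
  ... | no ne = lo x , lo∈ x , ne
  ... | yes refl = hi x , hi∈ x , λ e → ~-irrefl (lo~hi x) (sym e)

  -- A member other than `lo` and `hi` is a common neighbour of both, and by thinness there is at
  -- most one.
  triple : ∀ x → ∃ λ p → ∃ λ q → ∃ λ r → ∀ {u} → x ∋ u → u ≡ p ⊎ u ≡ q ⊎ u ≡ r
  triple x with F.any? (λ c → (c ~? lo x) ×-dec (c ~? hi x))
  ... | yes (c , p , q) = lo x , hi x , c , λ i → go (cases i)
    where
    go : ∀ {u} → u ≡ lo x ⊎ u ≡ hi x ⊎ (u ~ lo x × u ~ hi x) → u ≡ lo x ⊎ u ≡ hi x ⊎ u ≡ c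
    go (inj₁ e) = inj₁ e
    go (inj₂ (inj₁ e)) = inj₂ (inj₁ e)
    go (inj₂ (inj₂ (r , s))) = inj₂ (inj₂ (thin (lo~hi x) r s p q))
  -- For a clique with two members, `lo x` is repeated to fill the third place.
  ... | no none = lo x , hi x , lo x , λ i → go (cases i)
    where
    go : ∀ {u} → u ≡ lo x ⊎ u ≡ hi x ⊎ (u ~ lo x × u ~ hi x) → u ≡ lo x ⊎ u ≡ hi x ⊎ u ≡ lo x
    go (inj₁ e) = inj₁ e
    go (inj₂ (inj₁ e)) = inj₂ (inj₁ e)
    go {u} (inj₂ (inj₂ r)) = ⊥-elim (none (u , r))

  record Ends₂ (v : V) : Set where
    field
      x₁ x₂ : Fin m
      in₁   : x₁ ∋ v
      in₂   : x₂ ∋ v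
      x₁≢x₂ : x₁ ≢ x₂
      exact : ∀ {x} → x ∋ v → x ≡ x₁ ⊎ x ≡ x₂

  -- It suffices to find two non-adjacent neighbours u₁, u₂ of v: by claw-freeness every other
  -- neighbour of v sees one of them, so every clique at v is that of v and u₁ or that of v and u₂.
  -- Given u₁, degree at least three and thinness leave a neighbour that does not see u₁.
  ends : ∀ v → Ends₂ v
  ends v with fourth v v v
  ... | w , wv , _ with another w w (≢-sym wv) (≢-sym wv)
  ... | u₁ , vu₁ , _ = go (F.any? (λ t → (t ~? v) ×-dec (t ~? u₁)))
    where
    build : ∀ {u₂} → v ~ u₂ → u₂ ≢ u₁ → ¬ u₁ ~ u₂ → Ends₂ v
    build {u₂} vu₂ ne nadj with edge-clique vu₁ | edge-clique vu₂
    ... | x₁ , v₁ , w₁ | x₂ , v₂ , w₂ = record { x₁ = x₁ ; x₂ = x₂ ; in₁ = v₁ ; in₂ = v₂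
        ; x₁≢x₂ = (λ { refl → nadj (clique {x₁} w₁ w₂ (≢-sym ne)) }) ; exact = ex }
      where
      at : ∀ {x y u t} → x ∋ v → x ∋ u → v ~ u → y ∋ v → y ∋ t → t ≢ v → t ≡ u ⊎ t ~ u → y ≡ x
      at {x} {y} xv xu vu yv yt tv (inj₁ refl) = determined {y} {x} tv yt yv xu xv
      at {x} {y} xv xu vu yv yt tv (inj₂ e) = determined {y} {x} tv yt yv (maximal {x} xv xu (~-irrefl vu) (clique {y} yt yv tv) e) xv
      ex : ∀ {y} → y ∋ v → y ≡ x₁ ⊎ y ≡ x₂
      ex {y} yv with other-member y v
      ... | t , yt , tv with t F.≟ u₁ | t ~? u₁ | t F.≟ u₂ | t ~? u₂
      ... | yes e | _ | _ | _ = inj₁ (at {x₁} {y} v₁ w₁ vu₁ yv yt tv (inj₁ e))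
      ... | no _ | yes e | _ | _ = inj₁ (at {x₁} {y} v₁ w₁ vu₁ yv yt tv (inj₂ e))
      ... | no _ | no _ | yes e | _ = inj₂ (at {x₂} {y} v₂ w₂ vu₂ yv yt tv (inj₁ e))
      ... | no _ | no _ | no _ | yes e = inj₂ (at {x₂} {y} v₂ w₂ vu₂ yv yt tv (inj₂ e))
      ... | no p | no q | no r | no s = ⊥-elim (claw-free (~-sym (clique {y} yt yv tv)) vu₁ vu₂ p r (≢-sym ne) q s nadj)
    go : Dec (∃ λ t → t ~ v × t ~ u₁) → Ends₂ v
    go (no none) with another u₁ u₁ (~-irrefl vu₁) (~-irrefl vu₁)
    ... | u₂ , vu₂ , ne , _ = build vu₂ ne (λ e → none (u₂ , ~-sym vu₂ , ~-sym e))
    go (yes (t , tv , tu)) with another u₁ t (~-irrefl vu₁) (λ e → ~-irrefl tv (sym e))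
    ... | u₂ , vu₂ , ne , ne' = build vu₂ ne (λ e → ne' (thin vu₁ (~-sym vu₂) (~-sym e) tv tu))

-- The root graph: degree, chords, connectivity and separations

module LineGraph {n : ℕ} (R : Adj n) (tight : Tight R) (C : CliqueSystem R) (ends : ∀ v → TwoEnds.Ends₂ R tight C v) where
  open Tight tight
  open Graph R isg
  open CliqueSystem C
  open TwoEnds R tight C using (Ends₂; module Ends₂; other-member; triple)

  not-three : ∀ {x y z v} → x ∋ v → y ∋ v → z ∋ v → x ≢ y → x ≢ z → y ≢ z → ⊥
  not-three {v = v} xv yv zv xy xz yz with exact xv | exact yv | exact zv
    where open Ends₂ (ends v)
  ... | inj₁ p | inj₁ q | _ = xy (trans p (sym q))
  ... | inj₂ p | inj₂ q | _ = xy (trans p (sym q))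
  ... | inj₁ p | inj₂ _ | inj₁ r = xz (trans p (sym r))
  ... | inj₂ p | inj₁ _ | inj₂ r = xz (trans p (sym r))
  ... | inj₁ _ | inj₂ q | inj₂ r = yz (trans q (sym r))
  ... | inj₂ _ | inj₁ q | inj₁ r = yz (trans q (sym r))

  other-end : ∀ x {v} → x ∋ v → ∃ λ y → y ∋ v × y ≢ x
  other-end x {v} xv with Ends₂.x₁ (ends v) F.≟ x
  ... | no ne = Ends₂.x₁ (ends v) , Ends₂.in₁ (ends v) , ne
  ... | yes refl = Ends₂.x₂ (ends v) , Ends₂.in₂ (ends v) , λ e → Ends₂.x₁≢x₂ (ends v) (sym e)

  Joined : Fin m → Fin m → Set
  Joined x y = x ≢ y × ∃ λ v → x ∋ v × y ∋ v

  joined? : ∀ x y → Dec (Joined x y)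
  joined? x y = ¬? (x F.≟ y) ×-dec F.any? (λ v → (x ∋? v) ×-dec (y ∋? v))

  root : Adj m
  root x y = ⌊ joined? x y ⌋

  root⁺ : ∀ {x y} → Joined x y → root x y ≡ true
  root⁺ = isYes⁺

  root⁻ : ∀ {x y} → root x y ≡ true → Joined x y
  root⁻ {x} {y} = isYes⁻ {d = joined? x y}

  joined-sym : ∀ {x y} → Joined x y → Joined y x
  joined-sym (ne , v , p , q) = (≢-sym ne) , v , q , p

  isGraph-root : IsGraph root
  isGraph-root = (λ x y → bool-ext (λ e → root⁺ (joined-sym (root⁻ e))) (λ e → root⁺ (joined-sym (root⁻ e)))) , irr
    where
    irr : ∀ x → root x x ≡ false
    irr x with joined? x x
    ... | yes (ne , _) = ⊥-elim (ne refl)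
    ... | no _ = refl

  -- A neighbour of the clique x is the other clique through some member of x, and x has at most
  -- three members.
  max-degree : MaxDegreeAtMost3 root
  max-degree x with triple x
  ... | p , q , r , cov = unique-⊆-length {ys = f p ∷ f q ∷ f r ∷ []} (U.filter⁺ (λ y → B.T? (root x y)) (U.tabulate⁺ (λ e → e))) sub
    where
    f : V → Fin m
    f v with x ∋? v
    ... | yes xv = proj₁ (other-end x xv)
    -- A default value for vertices outside x; `f-eq` speaks of members only.
    ... | no _ = x
    f-eq : ∀ {v y} → x ∋ v → y ∋ v → x ≢ y → y ≡ f v
    f-eq {v} {y} xv yv ne with x ∋? v
    ... | no n = ⊥-elim (n xv)
    ... | yes xv' with other-end x xv'
    ... | z , zv , z≢x with y F.≟ z
    ... | yes e = e
    ... | no n = ⊥-elim (not-three {x} {y} {z} xv yv zv ne (≢-sym z≢x) n)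
    sub : ∀ {y} → y ∈ filterᵇ (root x) (allFin m) → y ∈ f p ∷ f q ∷ f r ∷ []
    sub {y} mem with root x y in eq | proj₂ (∈-filter⁻ (λ y → B.T? (root x y)) {xs = allFin m} mem)
    ... | true | _ with root⁻ eq
    ... | ne , v , xv , yv with f-eq xv yv ne | cov xv
    ... | e | inj₁ refl = here e
    ... | e | inj₂ (inj₁ refl) = there (here e)
    ... | e | inj₂ (inj₂ refl) = there (there (here e))

  -- The vertices u, v, w shared by xy, yz, xz are pairwise adjacent. So w belongs, by maximality,
  -- to the clique y of u and v, and would lie in three cliques.
  triangle-free : ∀ {x y z} → root x y ≡ true → root y z ≡ true → root x z ≡ true → ⊥
  triangle-free {x} {y} {z} exy eyz exz with root⁻ exy | root⁻ eyz | root⁻ exz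
  ... | xy , u , xu , yu | yz , v , yv , zv | xz , w , xw , zw = not-three {x} {y} {z} xw (maximal {y} yu yv u≢v (~-sym (clique {x} xu xw u≢w)) (~-sym (clique {z} zv zw v≢w))) zw xy xz yz
    where
    u≢v : u ≢ v
    u≢v refl = not-three {x} {y} {z} xu yu zv xy xz yz
    u≢w : u ≢ w
    u≢w refl = not-three {x} {y} {z} xu yu zw xy xz yz
    v≢w : v ≢ w
    v≢w refl = not-three {x} {y} {z} xw yv zv xy xz yz

  -- A cycle c of the root graph together with the vertices v i that its consecutive cliques share.
  record Lifted {k : ℕ} (c : Fin k → Fin m) : Set where
    field
      3≤k    : 3 ≤ k
      inj    : InjectiveFn c
      edges  : ∀ i j → cycAdj k i j ≡ true → root (c i) (c j) ≡ true
      σ      : Fin k → Fin k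
      next-σ : ∀ i → next k i (σ i) ≡ true
      v      : Fin k → V
      inˡ    : ∀ i → c i ∋ v i
      inʳ    : ∀ i → c (σ i) ∋ v i
      c≢cσ   : ∀ i → c i ≢ c (σ i)

  lifted : ∀ {k} {c : Fin k → Fin m} → 3 ≤ k → InjectiveFn c → (∀ i j → cycAdj k i j ≡ true → root (c i) (c j) ≡ true) → Lifted c
  lifted {k} {c} 3≤k inj edges = record { 3≤k = 3≤k ; inj = inj ; edges = edges ; σ = λ i → proj₁ (next-exists i) ; next-σ = λ i → proj₂ (next-exists i)
    ; v = λ i → proj₁ (proj₂ (link i)) ; inˡ = λ i → proj₁ (proj₂ (proj₂ (link i))) ; inʳ = λ i → proj₂ (proj₂ (proj₂ (link i))) ; c≢cσ = λ i → proj₁ (link i) }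
    where
    link : ∀ i → Joined (c i) (c (proj₁ (next-exists i)))
    link i = root⁻ (edges i (proj₁ (next-exists i)) (∨-trueˡ (proj₂ (next-exists i))))

  module RootCycle {k : ℕ} {c : Fin k → Fin m} (L : Lifted c) where
    open Lifted L public

    ends-of : ∀ {x} i → x ∋ v i → x ≡ c i ⊎ x ≡ c (σ i)
    ends-of {x} i xv with x F.≟ c i | x F.≟ c (σ i)
    ... | yes e | _ = inj₁ e
    ... | no _ | yes e = inj₂ e
    ... | no p | no q = ⊥-elim (not-three {x} {c i} {c (σ i)} xv (inˡ i) (inʳ i) p q (c≢cσ i))

    σ-injective : ∀ {i j} → σ i ≡ σ j → i ≡ j
    σ-injective {i} {j} e = next-injective {i = i} {j} {σ i} (next-σ i) (subst (λ l → next k j l ≡ true) (sym e) (next-σ j))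

    -- Equal vertices lie in the same two cliques. If these are matched crosswise, i and j are each
    -- other's successors, which is impossible on a cycle of length at least three.
    v-injective : ∀ {i j} → v i ≡ v j → i ≡ j
    v-injective {i} {j} e with ends-of {c j} i (subst (c j ∋_) (sym e) (inˡ j)) | ends-of {c (σ j)} i (subst (c (σ j) ∋_) (sym e) (inʳ j))
    ... | inj₁ p | _ = sym (inj p)
    ... | inj₂ p | inj₂ q = sym (σ-injective (inj q))
    ... | inj₂ p | inj₁ q = ⊥-elim (next-asym {i = i} {j} 3≤k (subst (λ l → next k i l ≡ true) (sym (inj p)) (next-σ i)) (subst (λ l → next k j l ≡ true) (inj q) (next-σ j)))

    adj⁻ : ∀ i j → v i ~ v j → cycAdj k i j ≡ true
    adj⁻ i j e with edge-clique e
    ... | x , xi , xj with ends-of i xi | ends-of j xj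
    ... | inj₁ p | inj₁ q = ⊥-elim (~-irrefl e (cong v (inj (trans (sym p) q))))
    ... | inj₁ p | inj₂ q = ∨-trueʳ (next k i j) (subst (λ l → next k j l ≡ true) (sym (inj (trans (sym p) q))) (next-σ j))
    ... | inj₂ p | inj₁ q = ∨-trueˡ (subst (λ l → next k i l ≡ true) (inj (trans (sym p) q)) (next-σ i))
    ... | inj₂ p | inj₂ q = ⊥-elim (~-irrefl e (cong v (σ-injective (inj (trans (sym p) q)))))

    next-adj : ∀ i j → next k i j ≡ true → v i ~ v j
    next-adj i j e = clique {c j} (subst (λ l → c l ∋ v i) (next-functional {i = i} {σ i} {j} (next-σ i) e) (inʳ i)) (inˡ j)
      (λ eq → next-irrefl {i = i} 3≤k (subst (λ l → next k i l ≡ true) (sym (v-injective eq)) e))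

    -- Adjacent vertices share a clique, which must be a vertex of the cycle common to the two edges
    -- they stand for. So every cycle of the root graph lifts to an induced cycle of `R`, whether or
    -- not it has chords itself.
    adj : ∀ i j → R (v i) (v j) ≡ cycAdj k i j
    adj i j = bool-ext (adj⁻ i j) adj⁺
      where
      adj⁺ : cycAdj k i j ≡ true → v i ~ v j
      adj⁺ e with ∨-true⁻ (next k i j) e
      ... | inj₁ p = next-adj i j p
      ... | inj₂ p = ~-sym (next-adj j i p)

    -- The root graph has no triangle. Four is what a wheel demands of its rim, and also what the
    -- count of exceptions in a separation needs.
    4≤k : 4 ≤ k
    4≤k = ℕ.≤∧≢⇒< 3≤k (λ e → short e c edges)
      where
      short : ∀ {k} → 3 ≡ k → (c : Fin k → Fin m) → (∀ i j → cycAdj k i j ≡ true → root (c i) (c j) ≡ true) → ⊥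
      short refl c edges = triangle-free {c zero} {c (suc zero)} {c (suc (suc zero))} (edges zero (suc zero) refl) (edges (suc zero) (suc (suc zero)) refl) (edges zero (suc (suc zero)) refl)

    -- A chord of the cycle is a vertex of the line graph with four neighbours on the hole formed by the edges of the cycle.
    chord-⊥ : ∀ i j → Joined (c i) (c j) → ¬ cycAdj k i j ≡ true → ⊥
    chord-⊥ i j (ne , u , iu , ju) nadj = noWheel (k , 4≤k , v , v-injective , adj , u , off ,
        count≥3 (λ l → R u (v l)) {i} {l} {j} i≢l (λ { refl → ne refl }) (λ { refl → nadj (∨-trueʳ (next k i l) next-l) })
          (clique {c i} iu (inˡ i) (λ e → off i (sym e)))
          (clique {c i} iu (subst (λ t → c t ∋ v l) (next-functional {i = l} {σ l} {i} (next-σ l) next-l) (inʳ l)) (λ e → off l (sym e)))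
          (clique {c j} ju (inˡ j) (λ e → off j (sym e))))
      where
      l = proj₁ (prev-exists i)
      next-l = proj₂ (prev-exists i)
      i≢l : i ≢ l
      i≢l e = next-irrefl {i = i} 3≤k (subst (λ t → next k t i ≡ true) (sym e) next-l)
      off : ∀ l → v l ≢ u
      off l e with ends-of {c i} l (subst (c i ∋_) (sym e) iu) | ends-of {c j} l (subst (c j ∋_) (sym e) ju)
      ... | inj₁ p | inj₁ q = ne (trans p (sym q))
      ... | inj₂ p | inj₂ q = ne (trans p (sym q))
      ... | inj₁ p | inj₂ q = nadj (∨-trueˡ (subst₂ (λ s t → next k s t ≡ true) (sym (inj p)) (sym (inj q)) (next-σ l)))
      ... | inj₂ p | inj₁ q = nadj (∨-trueʳ (next k i j) (subst₂ (λ s t → next k s t ≡ true) (sym (inj q)) (sym (inj p)) (next-σ l)))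

  chordless : Chordless root
  chordless k 3≤k c inj edges i j e with cycAdj k i j B.≟ true
  ... | yes p = p
  ... | no np = ⊥-elim (RootCycle.chord-⊥ (lifted 3≤k inj edges) i j (root⁻ e) np)

  reach-mono : ∀ {l} {H : Adj l} {X Y a b} → (∀ {u} → X u ≡ true → Y u ≡ true) → Reach H X a b → Reach H Y a b
  reach-mono f (here x) = here (f x)
  reach-mono f (step r x e) = step (reach-mono f r) (f x) e

  outside : Fin m → V → Bool
  outside x w = ⌊ ¬? (x ∋? w) ⌋

  -- A clique with three members is a triangle, which is not a cutset by `conn△`; one with two
  -- members is covered by 3-connectivity.
  connected-outside : ∀ x {u w} → ¬ x ∋ u → ¬ x ∋ w → Reach R (outside x) u w
  connected-outside x {u} {w} nu nw with F.any? (λ t → (t ~? lo x) ×-dec (t ~? hi x))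
  ... | yes (t , p , q) = reach-mono out (conn△ (lo~hi x) (~-sym p) (~-sym q) (av nu) (av nw))
    where
    av : ∀ {u} → ¬ x ∋ u → avoid₃ (lo x) (hi x) t u ≡ true
    av {u} n = avoid₃⁺ {a = lo x} {hi x} {t} {u} (λ { refl → n (lo∈ x) }) (λ { refl → n (hi∈ x) }) (λ { refl → n (maximal (lo∈ x) (hi∈ x) (~-irrefl (lo~hi x)) p q) })
    out : ∀ {u} → avoid₃ (lo x) (hi x) t u ≡ true → outside x u ≡ true
    out {u} a with avoid₃⁻ {a = lo x} {hi x} {t} {u} a
    ... | n₁ , n₂ , n₃ = isYes⁺ {d = ¬? (x ∋? u)} λ i → [ n₁ , [ n₂ , (λ (r , s) → n₃ (thin (lo~hi x) r s p q)) ]′ ]′ (cases i)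
  ... | no none = reach-mono out (conn₃ (lo x) (hi x) (λ { refl → nu (lo∈ x) }) (λ { refl → nu (hi∈ x) }) (λ { refl → nw (lo∈ x) }) (λ { refl → nw (hi∈ x) }))
    where
    out : ∀ {u} → avoid (lo x) (hi x) u ≡ true → outside x u ≡ true
    out {u} a with avoid⁻ {a = lo x} {hi x} {u} a
    ... | n₁ , n₂ = isYes⁺ {d = ¬? (x ∋? u)} λ i → [ n₁ , [ n₂ , (λ r → none (u , r)) ]′ ]′ (cases i)

  Others : Fin m → Fin m → Bool
  Others x y = not (y == x)

  others⁺ : ∀ {x y} → y ≢ x → Others x y ≡ true
  others⁺ {x} {y} ne rewrite ==-neq ne = refl

  private
    hop : ∀ {x y z w v} → Reach root (Others x) y z → z ∋ v → w ∋ v → w ≢ x → Reach root (Others x) y w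
    hop {x} {y} {z} {w} {v} r zv wv ne with z F.≟ w
    ... | yes refl = r
    ... | no n = step r (others⁺ ne) (root⁺ (n , v , zv , wv))

    -- Every edge of the walk lies in a clique, which differs from x because the walk stays outside
    -- x. Consecutive cliques share a vertex of the walk, so they are equal or adjacent in the root
    -- graph.
    lift : ∀ {x y u w} → Reach R (outside x) u w → y ∋ u → y ≢ x → ∀ {z} → z ∋ w → z ≢ x → Reach root (Others x) y z
    lift {x} (here _) yu y≢x zw z≢x = hop (here (others⁺ y≢x)) yu zw z≢x
    lift {x} (step {b} r _ e) yu y≢x {z} zw z≢x with edge-clique e
    ... | w , wb , wc = hop (lift r yu y≢x wb w≢x) wc zw z≢x
      where
      w≢x : w ≢ x
      w≢x refl = isYes⁻ {d = ¬? (x ∋? b)} (reach-target r) wb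

    member-outside : ∀ {x y} → y ≢ x → ∃ λ u → y ∋ u × ¬ x ∋ u
    member-outside {x} {y} ne with x ∋? lo y
    ... | no n = lo y , lo∈ y , n
    ... | yes p with x ∋? hi y
    ... | no n = hi y , hi∈ y , n
    ... | yes q = ⊥-elim (ne (determined {y} {x} (~-irrefl (lo~hi y)) (lo∈ y) (hi∈ y) p q))

  connected-without : ∀ x → ConnectedOn root (Others x)
  connected-without x y z yx zx with member-outside {x} {y} (oth yx) | member-outside {x} {z} (oth zx)
    where
    oth : ∀ {y} → Others x y ≡ true → y ≢ x
    oth p refl = true≢false (==-refl x) (not-true⁻ p)
  ... | u , yu , nu | w , zw , nw = lift (connected-outside x nu nw) yu (λ { refl → nu yu }) zw (λ { refl → nw zw })

  private
    three-cliques : ∃ λ x → ∃ λ y → ∃ λ z → Unique {A = Fin m} (x ∷ y ∷ z ∷ [])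
    three-cliques with other-member x₁ v₀
      where open Ends₂ (ends v₀)
    ... | u , xu , u≢v with other-end x₁ xu
      where open Ends₂ (ends v₀)
    ... | z , zu , z≢x = x₁ , x₂ , z , (x₁≢x₂ ∷ (≢-sym z≢x) ∷ []) ∷ ((λ { refl → x₁≢x₂ (determined {x₁} {x₂} u≢v xu in₁ zu in₂) }) ∷ []) ∷ [] ∷ []
      where open Ends₂ (ends v₀)

    3≤m : 3 ≤ m
    3≤m = unique-length≤ (proj₂ (proj₂ (proj₂ three-cliques)))

    third-clique : ∀ y z → ∃ λ x → y ≢ x × z ≢ x
    third-clique y z with F.any? (λ x → ¬? (y F.≟ x) ×-dec ¬? (z F.≟ x))
    ... | yes p = p
    ... | no none = ⊥-elim (ℕ.<⇒≱ (s≤s (unique-⊆-length {xs = allFin m} {ys = y ∷ z ∷ []} (U.tabulate⁺ (λ e → e)) sub)) (subst (3 ≤_) (sym (L.length-tabulate {n = m} (λ i → i))) 3≤m))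
      where
      sub : ∀ {x} → x ∈ allFin m → x ∈ y ∷ z ∷ []
      sub {x} _ with y F.≟ x | z F.≟ x
      ... | yes e | _ = here (sym e)
      ... | no _ | yes e = there (here (sym e))
      ... | no p | no q = ⊥-elim (none (x , p , q))

  two-connected : TwoConnected root
  two-connected = 3≤m , conn , connected-without
    where
    conn : ConnectedOn root Defs.all
    conn y z _ _ with third-clique y z
    ... | x , ny , nz = reach-mono (λ _ → refl) (connected-without x y z (others⁺ ny) (others⁺ nz))

  -- With degrees at least three and no claw, `R` contains a triangle. Its clique has three further
  -- cliques through its members, hence three neighbours in the root graph, whereas a vertex of a
  -- cycle has two.
  not-cycle : ¬ IsCycle root
  not-cycle (f , inj , iso) = go find
    where
    Triangle : Set
    Triangle = ∃ λ a → ∃ λ b → ∃ λ c → a ~ b × a ~ c × b ~ c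
    find : Triangle
    find with fourth v₀ v₀ v₀
    ... | w , wv , _ with another w w (≢-sym wv) (≢-sym wv)
    ... | a , va , _ with another a a (~-irrefl va) (~-irrefl va)
    ... | b , vb , b≢a , _ with another a b (~-irrefl va) (~-irrefl vb)
    ... | c , vc , c≢a , c≢b with a ~? b | a ~? c | b ~? c
    ... | yes e | _ | _ = v₀ , a , b , va , vb , e
    ... | no _ | yes e | _ = v₀ , a , c , va , vc , e
    ... | no _ | no _ | yes e = v₀ , b , c , vb , vc , e
    ... | no p | no q | no r = ⊥-elim (claw-free va vb vc (≢-sym b≢a) (≢-sym c≢a) (≢-sym c≢b) p q r)
    two : ∀ {i j l t} → cycAdj m i j ≡ true → cycAdj m i l ≡ true → cycAdj m i t ≡ true → j ≢ l → j ≢ t → l ≢ t → ⊥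
    two {i} {j} {l} {t} p q r jl jt lt with ∨-true⁻ (next m i j) p | ∨-true⁻ (next m i l) q | ∨-true⁻ (next m i t) r
    ... | inj₁ a | inj₁ b | _ = jl (next-functional {i = i} a b)
    ... | inj₂ a | inj₂ b | _ = jl (next-injective {j = i} a b)
    ... | inj₁ a | inj₂ _ | inj₁ b = jt (next-functional {i = i} a b)
    ... | inj₂ a | inj₁ _ | inj₂ b = jt (next-injective {j = i} a b)
    ... | inj₁ _ | inj₂ a | inj₂ b = lt (next-injective {j = i} a b)
    ... | inj₂ _ | inj₁ a | inj₁ b = lt (next-functional {i = i} a b)
    go : Triangle → ⊥
    go (a , b , c , ab , ac , bc) with edge-clique ab
    ... | x , xa , xb = fin (other-end x xa) (other-end x xb) (other-end x xc) (injective⇒surjective inj x)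
      where
      xc : x ∋ c
      xc = maximal {x} xa xb (~-irrefl ab) (~-sym ac) (~-sym bc)
      Other : V → Set
      Other v = ∃ λ y → y ∋ v × y ≢ x
      fin : Other a → Other b → Other c → (∃ λ i → f i ≡ x) → ⊥
      fin (ya , a∈ , na) (yb , b∈ , nb) (yc , c∈ , nc) (i , refl) with injective⇒surjective inj ya | injective⇒surjective inj yb | injective⇒surjective inj yc
      ... | j , refl | l , refl | t , refl = two {i} {j} {l} {t} (trans (iso i j) (root⁺ ((≢-sym na) , a , xa , a∈))) (trans (iso i l) (root⁺ ((≢-sym nb) , b , xb , b∈)))
            (trans (iso i t) (root⁺ ((≢-sym nc) , c , xc , c∈)))
            (λ { refl → na (determined {f j} {f i} (~-irrefl ab) a∈ b∈ xa xb) }) (λ { refl → na (determined {f j} {f i} (~-irrefl ac) a∈ c∈ xa xc) }) (λ { refl → nb (determined {f l} {f i} (~-irrefl bc) b∈ c∈ xb xc) })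

  -- A clique has at most three vertices, so of any two-colouring one class has at most one vertex s in it.
  separator : ∀ (g : V → Bool) w → ∃ λ s → ∀ {u t} → w ∋ u → w ∋ t → g u ≡ true → g t ≡ false → u ≡ s ⊎ t ≡ s
  separator g w with triple w
  ... | p , q , r , cov with g p B.≟ g q | g p B.≟ g r
  ... | yes pq | _ = r , λ wu wt gu gt → pick (cov wu) (cov wt) gu gt
    where
    pick : ∀ {u t} → u ≡ p ⊎ u ≡ q ⊎ u ≡ r → t ≡ p ⊎ t ≡ q ⊎ t ≡ r → g u ≡ true → g t ≡ false → u ≡ r ⊎ t ≡ r
    pick (inj₂ (inj₂ e)) _ _ _ = inj₁ e
    pick _ (inj₂ (inj₂ e)) _ _ = inj₂ e
    pick (inj₁ refl) (inj₁ refl) a b = ⊥-elim (true≢false a b)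
    pick (inj₁ refl) (inj₂ (inj₁ refl)) a b = ⊥-elim (true≢false a (trans pq b))
    pick (inj₂ (inj₁ refl)) (inj₁ refl) a b = ⊥-elim (true≢false a (trans (sym pq) b))
    pick (inj₂ (inj₁ refl)) (inj₂ (inj₁ refl)) a b = ⊥-elim (true≢false a b)
  ... | no _ | yes pr = q , λ wu wt gu gt → pick (cov wu) (cov wt) gu gt
    where
    pick : ∀ {u t} → u ≡ p ⊎ u ≡ q ⊎ u ≡ r → t ≡ p ⊎ t ≡ q ⊎ t ≡ r → g u ≡ true → g t ≡ false → u ≡ q ⊎ t ≡ q
    pick (inj₂ (inj₁ e)) _ _ _ = inj₁ e
    pick _ (inj₂ (inj₁ e)) _ _ = inj₂ e
    pick (inj₁ refl) (inj₁ refl) a b = ⊥-elim (true≢false a b)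
    pick (inj₁ refl) (inj₂ (inj₂ refl)) a b = ⊥-elim (true≢false a (trans pr b))
    pick (inj₂ (inj₂ refl)) (inj₁ refl) a b = ⊥-elim (true≢false a (trans (sym pr) b))
    pick (inj₂ (inj₂ refl)) (inj₂ (inj₂ refl)) a b = ⊥-elim (true≢false a b)
  ... | no pq | no pr = p , λ wu wt gu gt → pick (cov wu) (cov wt) gu gt
    where
    qr : g q ≡ g r
    qr with g p | g q | g r
    ... | true | true | _ = ⊥-elim (pq refl)
    ... | true | false | true = ⊥-elim (pr refl)
    ... | true | false | false = refl
    ... | false | false | _ = ⊥-elim (pq refl)
    ... | false | true | false = ⊥-elim (pr refl)
    ... | false | true | true = refl
    pick : ∀ {u t} → u ≡ p ⊎ u ≡ q ⊎ u ≡ r → t ≡ p ⊎ t ≡ q ⊎ t ≡ r → g u ≡ true → g t ≡ false → u ≡ p ⊎ t ≡ p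
    pick (inj₁ e) _ _ _ = inj₁ e
    pick _ (inj₁ e) _ _ = inj₂ e
    pick (inj₂ (inj₁ refl)) (inj₂ (inj₁ refl)) a b = ⊥-elim (true≢false a b)
    pick (inj₂ (inj₁ refl)) (inj₂ (inj₂ refl)) a b = ⊥-elim (true≢false a (trans qr b))
    pick (inj₂ (inj₂ refl)) (inj₂ (inj₁ refl)) a b = ⊥-elim (true≢false a (trans (sym qr) b))
    pick (inj₂ (inj₂ refl)) (inj₂ (inj₂ refl)) a b = ⊥-elim (true≢false a b)

  at-most-two-of : ∀ (p : Fin m → Bool) → count p ≤ 2 → ∃ λ w₁ → ∃ λ w₂ → ∀ {x} → p x ≡ true → x ≡ w₁ ⊎ x ≡ w₂
  at-most-two-of p le = go (filterᵇ p (allFin m)) le (λ {x} e → ∈-filter⁺ (λ y → B.T? (p y)) (∈-tabulate⁺ x) (subst T (sym e) tt))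
    where
    -- An arbitrary clique, which fills both places when the predicate holds nowhere.
    x₀ = Ends₂.x₁ (ends v₀)
    go : ∀ l → length l ≤ 2 → (∀ {x} → p x ≡ true → x ∈ l) → ∃ λ w₁ → ∃ λ w₂ → ∀ {x} → p x ≡ true → x ≡ w₁ ⊎ x ≡ w₂
    go [] _ f = x₀ , x₀ , λ e → ⊥-elim (case (f e))
      where
      case : ∀ {x} → x ∈ [] → ⊥
      case ()
    go (w ∷ []) _ f = w , w , λ e → case (f e)
      where
      case : ∀ {x} → x ∈ w ∷ [] → x ≡ w ⊎ x ≡ w
      case (here e) = inj₁ e
    go (w ∷ w' ∷ []) _ f = w , w' , λ e → case (f e)
      where
      case : ∀ {x} → x ∈ w ∷ w' ∷ [] → x ≡ w ⊎ x ≡ w'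
      case (here e) = inj₁ e
      case (there (here e)) = inj₂ e
    go (_ ∷ _ ∷ _ ∷ _) (s≤s (s≤s ())) f

  -- The vertices of R are the edges of the root graph; those inside A are separated from the others by one edge at each vertex of A ∩ B.
  module _ {A B : Fin m → Bool} (cov : ∀ x → A x ∨ B x ≡ true)
           (sep : ∀ x y → A x ∧ not (B x) ≡ true → B y ∧ not (A y) ≡ true → root x y ≡ false)
           (small : count (λ x → A x ∧ B x) ≤ 2)
           {kA} {cA : Fin kA → Fin m} (LA : Lifted cA) (inA : ∀ i → A (cA i) ≡ true)
           {kB} {cB : Fin kB → Fin m} (LB : Lifted cB) (inB : ∀ i → B (cB i) ≡ true) where
    private
      module CA = RootCycle LA
      module CB = RootCycle LB

    g : V → Bool
    g v = A (Ends₂.x₁ (ends v)) ∧ A (Ends₂.x₂ (ends v))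
    g⁺ : ∀ {v} → (∀ {x} → x ∋ v → A x ≡ true) → g v ≡ true
    g⁺ {v} f = ∧-true⁺ (f (Ends₂.in₁ (ends v))) (f (Ends₂.in₂ (ends v)))
    g⁻ : ∀ {v x} → g v ≡ true → x ∋ v → A x ≡ true
    g⁻ {v} e xv with ∧-true⁻ (A (Ends₂.x₁ (ends v))) e | Ends₂.exact (ends v) xv
    ... | p , _ | inj₁ refl = p
    ... | _ , q | inj₂ refl = q
    inB' : ∀ {x} → A x ≡ false → B x ≡ true
    inB' {x} e with ∨-true⁻ (A x) (cov x)
    ... | inj₁ p = ⊥-elim (true≢false p e)
    ... | inj₂ p = p
    outA : ∀ {x y} → A x ≡ false → root x y ≡ true → B y ≡ true
    outA {x} {y} e r with B y in eq
    ... | true = refl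
    ... | false = ⊥-elim (true≢false (trans (proj₁ isGraph-root y x) r) (sep y x (∧-true⁺ Ay (cong not eq)) (∧-true⁺ (inB' e) (cong not e))))
      where
      Ay : A y ≡ true
      Ay with ∨-true⁻ (A y) (cov y)
      ... | inj₁ p = p
      ... | inj₂ p = ⊥-elim (true≢false p eq)
    -- An end outside A lies in B, and no edge leads from there to a vertex outside B; so both ends
    -- of such an edge are in B.
    g-false : ∀ {v x} → g v ≡ false → x ∋ v → B x ≡ true
    g-false {v} {x} e xv with A x in eqx
    ... | false = inB' eqx
    ... | true with other-end x xv
    ... | y , yv , y≢x with A y in eqy
    ... | false = outA eqy (root⁺ (y≢x , v , yv , xv))
    ... | true = ⊥-elim (true≢false (g⁺ {v} all-A) e)
      where
      all-A : ∀ {z} → z ∋ v → A z ≡ true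
      all-A {z} zv with z F.≟ x | z F.≟ y
      ... | yes refl | _ = eqx
      ... | no _ | yes refl = eqy
      ... | no p | no q = ⊥-elim (not-three {z} {x} {y} zv xv yv p q (≢-sym y≢x))
    false⁻ : ∀ {b} → (b ≡ true → ⊥) → b ≡ false
    false⁻ {true} f = ⊥-elim (f refl)
    false⁻ {false} f = refl
    main : (∃ λ w₁ → ∃ λ w₂ → ∀ {x} → A x ∧ B x ≡ true → x ≡ w₁ ⊎ x ≡ w₂) → ⊥
    main (w₁ , w₂ , W) with separator g w₁ | separator g w₂
    ... | s₁ , sep₁ | s₂ , sep₂ = finish sideA sideB
      where
      Side : Bool → Set
      Side b = ∃ λ u → g u ≡ b × u ≢ s₁ × u ≢ s₂
      sideA : Side true
      -- The cycle in A lifts to at least four vertices, of which at most two are s₁ or s₂. The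
      -- first exception is a dummy.
      sideA with three-exceptions CA.4≤k {λ _ → ⊥} {λ i → CA.v i ≡ s₁} {λ i → CA.v i ≡ s₂} (λ _ → no λ ()) (λ i → CA.v i F.≟ s₁) (λ i → CA.v i F.≟ s₂) (λ ()) (λ p q → CA.v-injective (trans p (sym q))) (λ p q → CA.v-injective (trans p (sym q)))
      ... | i , _ , p , q = CA.v i , g⁺ {CA.v i} ends-A , p , q
        where
        ends-A : ∀ {x} → x ∋ CA.v i → A x ≡ true
        ends-A xv with CA.ends-of i xv
        ... | inj₁ refl = inA i
        ... | inj₂ refl = inA (CA.σ i)
      inW : ∀ i → g (CB.v i) ≡ true → ∀ {x} → x ∋ CB.v i → x ≡ w₁ ⊎ x ≡ w₂
      inW i e {x} xv with CB.ends-of i xv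
      ... | inj₁ refl = W (∧-true⁺ (g⁻ {CB.v i} e xv) (inB i))
      ... | inj₂ refl = W (∧-true⁺ (g⁻ {CB.v i} e xv) (inB (CB.σ i)))
      both : ∀ i → g (CB.v i) ≡ true → w₁ ≢ w₂ × w₁ ∋ CB.v i × w₂ ∋ CB.v i
      both i e with inW i e (CB.inˡ i) | inW i e (CB.inʳ i)
      ... | inj₁ p | inj₁ q = ⊥-elim (CB.c≢cσ i (trans p (sym q)))
      ... | inj₂ p | inj₂ q = ⊥-elim (CB.c≢cσ i (trans p (sym q)))
      ... | inj₁ refl | inj₂ refl = CB.c≢cσ i , CB.inˡ i , CB.inʳ i
      ... | inj₂ refl | inj₁ refl = (λ e → CB.c≢cσ i (sym e)) , CB.inʳ i , CB.inˡ i
      once : ∀ {i j} → g (CB.v i) ≡ true → g (CB.v j) ≡ true → i ≡ j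
      once {i} {j} p q with both i p | both j q
      ... | ne , a , b | _ , c , d with CB.v i F.≟ CB.v j
      ... | yes e = CB.v-injective e
      ... | no n = ⊥-elim (ne (determined {w₁} {w₂} n a c b d))
      sideB : Side false
      -- All three exceptions are used: besides s₁ and s₂, one vertex of the lifted cycle may have
      -- both ends in A. Its ends are then w₁ and w₂, which share only one vertex.
      sideB with three-exceptions CB.4≤k {λ i → g (CB.v i) ≡ true} {λ i → CB.v i ≡ s₁} {λ i → CB.v i ≡ s₂} (λ i → g (CB.v i) B.≟ true) (λ i → CB.v i F.≟ s₁) (λ i → CB.v i F.≟ s₂) once (λ p q → CB.v-injective (trans p (sym q))) (λ p q → CB.v-injective (trans p (sym q)))
      ... | i , n , p , q = CB.v i , false⁻ n , p , q
      -- An edge of the walk that changes sides lies in a clique which belongs to both A and B,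
      -- hence is w₁ or w₂. Then one end of the edge is s₁ or s₂, which the walk avoids.
      stay : ∀ {u t} → g u ≡ true → Reach R (avoid s₁ s₂) u t → g t ≡ true
      stay gu (here _) = gu
      stay gu (step {b} {t} r x e) with g t in eq
      ... | true = refl
      ... | false with edge-clique e
      ... | w , wb , wt with W (∧-true⁺ (g⁻ {b} (stay gu r) wb) (g-false {t} eq wt)) | avoid⁻ {a = s₁} {s₂} {b} (reach-target r) | avoid⁻ {a = s₁} {s₂} {t} x
      ... | inj₁ refl | b₁ , b₂ | t₁ , t₂ = ⊥-elim ([ b₁ , t₁ ]′ (sep₁ wb wt (stay gu r) eq))
      ... | inj₂ refl | b₁ , b₂ | t₁ , t₂ = ⊥-elim ([ b₂ , t₂ ]′ (sep₂ wb wt (stay gu r) eq))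
      finish : Side true → Side false → ⊥
      finish (u , gu , u₁ , u₂) (t , gt , t₁ , t₂) = true≢false (stay gu (conn₃ s₁ s₂ u₁ u₂ t₁ t₂)) gt

    separation-⊥ : ⊥
    separation-⊥ = main (at-most-two-of (λ x → A x ∧ B x) small)

  no-cyclic-2-separation : ∀ A B → ¬ CyclicTwoSeparation root A B
  no-cyclic-2-separation A B (cov , sep , small , (kA , 3≤kA , cA , injA , inA , edgesA) , (kB , 3≤kB , cB , injB , inB , edgesB)) =
    separation-⊥ {A} {B} cov sep small (lifted 3≤kA injA edgesA) inA (lifted 3≤kB injB edgesB) inB

  cyclically-3-connected : CyclicallyThreeConnected root
  cyclically-3-connected = two-connected , not-cycle , no-cyclic-2-separation

  edge-of : V → Fin m × Fin m
  edge-of v = Ends₂.x₁ (ends v) , Ends₂.x₂ (ends v)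

  is-line-graph : Σ (V → Fin m × Fin m) λ e →
    (∀ v → root (proj₁ (e v)) (proj₂ (e v)) ≡ true) ×
    (∀ u v → SameEdge (e u) (e v) → u ≡ v) ×
    (∀ x y → root x y ≡ true → Σ V λ v → SameEdge (e v) (x , y)) ×
    (∀ u v → u ≢ v → R u v ≡ meetᵇ (e u) (e v))
  is-line-graph = edge-of , (λ v → root⁺ (E.x₁≢x₂ v , v , E.in₁ v , E.in₂ v)) , same , onto , meets
    where
    module E v = Ends₂ (ends v)
    same : ∀ u v → SameEdge (edge-of u) (edge-of v) → u ≡ v
    same u v s with u F.≟ v
    ... | yes e = e
    ... | no ne = ⊥-elim (E.x₁≢x₂ u (go s))
      where
      go : SameEdge (edge-of u) (edge-of v) → E.x₁ u ≡ E.x₂ u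
      go (inj₁ (p , q)) = determined {E.x₁ u} {E.x₂ u} ne (E.in₁ u) (subst (_∋ v) (sym p) (E.in₁ v)) (E.in₂ u) (subst (_∋ v) (sym q) (E.in₂ v))
      go (inj₂ (p , q)) = determined {E.x₁ u} {E.x₂ u} ne (E.in₁ u) (subst (_∋ v) (sym p) (E.in₂ v)) (E.in₂ u) (subst (_∋ v) (sym q) (E.in₁ v))
    onto : ∀ x y → root x y ≡ true → Σ V λ v → SameEdge (edge-of v) (x , y)
    onto x y r with root⁻ r
    ... | ne , v , xv , yv with E.exact v xv | E.exact v yv
    ... | inj₁ p | inj₁ q = ⊥-elim (ne (trans p (sym q)))
    ... | inj₂ p | inj₂ q = ⊥-elim (ne (trans p (sym q)))
    ... | inj₁ p | inj₂ q = v , inj₁ (sym p , sym q)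
    ... | inj₂ p | inj₁ q = v , inj₂ (sym q , sym p)
    meets : ∀ u v → u ≢ v → R u v ≡ meetᵇ (edge-of u) (edge-of v)
    meets u v ne = bool-ext fw bw
      where
      fw : u ~ v → meetᵇ (edge-of u) (edge-of v) ≡ true
      fw e with edge-clique e
      ... | x , xu , xv with E.exact u xu | E.exact v xv
      ... | inj₁ p | inj₁ q = ∨-trueˡ (subst (λ t → (E.x₁ u == t) ≡ true) (trans (sym p) q) (==-refl _))
      ... | inj₁ p | inj₂ q = ∨-trueʳ (E.x₁ u == E.x₁ v) (∨-trueˡ (subst (λ t → (E.x₁ u == t) ≡ true) (trans (sym p) q) (==-refl _)))
      ... | inj₂ p | inj₁ q = ∨-trueʳ (E.x₁ u == E.x₁ v) (∨-trueʳ (E.x₁ u == E.x₂ v) (∨-trueˡ (subst (λ t → (E.x₂ u == t) ≡ true) (trans (sym p) q) (==-refl _))))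
      ... | inj₂ p | inj₂ q = ∨-trueʳ (E.x₁ u == E.x₁ v) (∨-trueʳ (E.x₁ u == E.x₂ v) (∨-trueʳ (E.x₂ u == E.x₁ v) (subst (λ t → (E.x₂ u == t) ≡ true) (trans (sym p) q) (==-refl _))))
      shared : ∀ {x y} → (x == y) ≡ true → x ∋ u → y ∋ v → u ~ v
      shared {x} {y} e xu yv = clique {x} xu (subst (_∋ v) (sym (==⁻ {i = x} e)) yv) ne
      bw : meetᵇ (edge-of u) (edge-of v) ≡ true → u ~ v
      bw e with ∨-true⁻ (E.x₁ u == E.x₁ v) e
      ... | inj₁ p = shared p (E.in₁ u) (E.in₁ v)
      ... | inj₂ e' with ∨-true⁻ (E.x₁ u == E.x₂ v) e'
      ... | inj₁ p = shared p (E.in₁ u) (E.in₂ v)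
      ... | inj₂ e″ with ∨-true⁻ (E.x₂ u == E.x₁ v) e″
      ... | inj₁ p = shared p (E.in₂ u) (E.in₁ v)
      ... | inj₂ p = shared p (E.in₂ u) (E.in₂ v)

-- Trigraphs

subdivK4-size : ∀ {k H} → SubdivK4 k H → 4 ≤ k
subdivK4-size (base H _) = ℕ.≤-refl
subdivK4-size (step s _ _ _ _) = ℕ.m≤n⇒m≤1+n (subdivK4-size s)

-- A subdivision of K₄ has at least four vertices, and these are embedded injectively.
small-seriesParallel : ∀ {n} (G : Trigraph n) → ¬ 4 ≤ n → SeriesParallel G
small-seriesParallel G n<4 (k , H , s , f , inj , _) = n<4 (ℕ.≤-trans (subdivK4-size s) (F.injective⇒≤ inj))

module Realizations {n : ℕ} (G : Trigraph n) where

  R : Adj n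
  R = full G

  full⁺ : ∀ {u v} → u ≢ v → isAdjᵇ (θ G u v) ≡ true → R u v ≡ true
  full⁺ {u} {v} ne e rewrite ==-neq ne = e

  full⁻ : ∀ {u v} → R u v ≡ true → u ≢ v × isAdjᵇ (θ G u v) ≡ true
  full⁻ {u} {v} e with ∧-true⁻ (not (u == v)) e
  ... | p , q = (λ { refl → true≢false (==-refl u) (not-true⁻ p) }) , q

  full-graph : IsGraph R
  full-graph = (λ u v → bool-ext (fw {u} {v}) (fw {v} {u})) , irr
    where
    fw : ∀ {u v} → R u v ≡ true → R v u ≡ true
    fw {u} {v} e with full⁻ e
    ... | ne , a = full⁺ (≢-sym ne) (subst (λ t → isAdjᵇ t ≡ true) (θ-sym G u v) a)
    irr : ∀ u → R u u ≡ false
    irr u rewrite ==-refl u = refl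

  anti⇒false : ∀ {u v} → θ G u v ≡ anti → R u v ≡ false
  anti⇒false {u} {v} e rewrite e = B.∧-zeroʳ (not (u == v))

  false⇒anti : ∀ {u v} → u ≢ v → ¬ R u v ≡ true → θ G u v ≡ anti
  false⇒anti {u} {v} ne nR = go (θ G u v) refl
    where
    go : ∀ t → θ G u v ≡ t → θ G u v ≡ anti
    go anti eq = eq
    go semi eq = ⊥-elim (nR (full⁺ ne (cong isAdjᵇ eq)))
    go strong eq = ⊥-elim (nR (full⁺ ne (cong isAdjᵇ eq)))

  true⇒strong : ∀ {u v} → R u v ≡ true → θ G u v ≢ semi → θ G u v ≡ strong
  true⇒strong {u} {v} e ns = go (θ G u v) refl
    where
    go : ∀ t → θ G u v ≡ t → θ G u v ≡ strong
    go anti eq = ⊥-elim (true≢false e (anti⇒false eq))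
    go semi eq = ⊥-elim (ns eq)
    go strong eq = eq

  full-realization : IsRealization G R
  full-realization = full-graph , (λ u v ne e → full⁺ ne (cong isAdjᵇ e)) , (λ u v ne e → anti⇒false e)

  -- For a semi-adjacent pair ab this is the realization in which ab is a non-edge and all other
  -- semi-adjacent pairs are edges.
  module Remove (a b : Fin n) where

    marked : Fin n → Fin n → Bool
    marked u v = ((u == a) ∧ (v == b)) ∨ ((u == b) ∧ (v == a))

    marked⁻ : ∀ {u v} → marked u v ≡ true → (u ≡ a × v ≡ b) ⊎ (u ≡ b × v ≡ a)
    marked⁻ {u} {v} e with ∨-true⁻ ((u == a) ∧ (v == b)) e
    ... | inj₁ p with ∧-true⁻ (u == a) p
    ... | x , y = inj₁ (==⁻ {i = u} x , ==⁻ {i = v} y)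
    marked⁻ {u} {v} e | inj₂ p with ∧-true⁻ (u == b) p
    ... | x , y = inj₂ (==⁻ {i = u} x , ==⁻ {i = v} y)

    marked-sym : ∀ {u v} → marked u v ≡ true → marked v u ≡ true
    marked-sym {u} {v} e with marked⁻ {u} {v} e
    ... | inj₁ (refl , refl) = ∨-trueʳ ((v == u) ∧ (u == v)) (∧-true⁺ (==-refl v) (==-refl u))
    ... | inj₂ (refl , refl) = ∨-trueˡ (∧-true⁺ (==-refl v) (==-refl u))

    R′ : Adj n
    R′ u v = R u v ∧ not (marked u v)

    sub : ∀ {u v} → R′ u v ≡ true → R u v ≡ true
    sub {u} {v} e = proj₁ (∧-true⁻ (R u v) e)

    keep : ∀ {u v} → R u v ≡ true → R′ u v ≡ true ⊎ (u ≡ a × v ≡ b) ⊎ (u ≡ b × v ≡ a)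
    keep {u} {v} e with marked u v B.≟ true
    ... | yes p = inj₂ (marked⁻ p)
    ... | no np = inj₁ (∧-true⁺ e (not-true⁺ np))

    gone : ¬ R′ a b ≡ true
    gone e = true≢false (∨-trueˡ {b = (a == b) ∧ (b == a)} (∧-true⁺ (==-refl a) (==-refl b))) (not-true⁻ (proj₂ (∧-true⁻ (R a b) e)))

    graph′ : IsGraph R′
    graph′ = (λ u v → bool-ext (fw {u} {v}) (fw {v} {u})) , λ u → false⁻ (λ e → true≢false (sub {u} {u} e) (proj₂ full-graph u))
      where
      false⁻ : ∀ {b} → (b ≡ true → ⊥) → b ≡ false
      false⁻ {true} f = ⊥-elim (f refl)
      false⁻ {false} f = refl
      fw : ∀ {u v} → R′ u v ≡ true → R′ v u ≡ true
      fw {u} {v} e with ∧-true⁻ (R u v) e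
      ... | p , q = ∧-true⁺ (trans (proj₁ full-graph v u) p) (not-true⁺ (λ m → true≢false (marked-sym {v} {u} m) (not-true⁻ q)))

    realization : θ G a b ≡ semi → IsRealization G R′
    realization s = graph′ , pos , neg
      where
      semi≢strong : semi ≡ strong → ⊥
      semi≢strong ()
      pos : ∀ u v → u ≢ v → θ G u v ≡ strong → R′ u v ≡ true
      pos u v ne e with keep (full⁺ ne (cong isAdjᵇ e))
      ... | inj₁ p = p
      ... | inj₂ (inj₁ (refl , refl)) = ⊥-elim (semi≢strong (trans (sym s) e))
      ... | inj₂ (inj₂ (refl , refl)) = ⊥-elim (semi≢strong (trans (sym s) (trans (θ-sym G v u) e)))
      neg : ∀ u v → u ≢ v → θ G u v ≡ anti → R′ u v ≡ false
      neg u v ne e rewrite anti⇒false {u} {v} e = refl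

-- Removing the edge uv leaves a hole u b′ a′ b″ to which the edge a″v attaches at b′, b″ and a′.
soft-bipartite-⊥ : ∀ {n : ℕ} (R : Adj n) (isg : IsGraph R) (noISK4 : ¬ HasISK4 R) (noWheel : ¬ HasWheel R)
    (thin : Claws.Thin R isg noISK4 noWheel) (k : Flags.K33 R isg noISK4 noWheel)
    (R′ : Adj n) (isg′ : IsGraph R′) (noISK4′ : ¬ HasISK4 R′) (noWheel′ : ¬ HasWheel R′) {u v : Fin n}
    (sub : ∀ {x y} → R′ x y ≡ true → R x y ≡ true)
    (keep : ∀ {x y} → R x y ≡ true → R′ x y ≡ true ⊎ (x ≡ u × y ≡ v) ⊎ (x ≡ v × y ≡ u))
    (gone : ¬ R′ u v ≡ true) → Bipartite.InA R isg noISK4 noWheel k u → Bipartite.InB R isg noISK4 noWheel k v → ⊥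
soft-bipartite-⊥ R isg noISK4 noWheel thin k R′ isg′ noISK4′ noWheel′ {u} {v} sub keep gone Au Bv = go
  where
  module Sᴬ = Bipartite.Side R isg noISK4 noWheel thin k
  module Sᴮ = Bipartite.Side R isg noISK4 noWheel thin (Bipartite.k33-swap R isg noISK4 noWheel k)
  open Sᴬ using (A; B)
  module G′ = Graph R′ isg′
  module A′ = Attachments R′ isg′ noISK4′ noWheel′
  module T′ = ThreeAttachments R′ isg′ noISK4′ noWheel′
  module F′ = Flags R′ isg′ noISK4′ noWheel′
  ~-sym′ : ∀ {x y} → x G′.~ y → y G′.~ x
  ~-sym′ = G′.~-sym
  ne : ∀ {a b} → A a → B b → a ≢ b
  ne Aa Bb refl = Sᴬ.AB-disjoint Aa Bb
  ab : ∀ {a b} → A a → B b → a ≢ u → R′ a b ≡ true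
  ab Aa Bb a≢u with keep (Sᴬ.complete Aa Bb)
  ... | inj₁ e = e
  ... | inj₂ (inj₁ (e , _)) = ⊥-elim (a≢u e)
  ... | inj₂ (inj₂ (e , _)) = ⊥-elim (ne Aa Bv e)
  ub : ∀ {b} → B b → b ≢ v → R′ u b ≡ true
  ub Bb b≢v with keep (Sᴬ.complete Au Bb)
  ... | inj₁ e = e
  ... | inj₂ (inj₁ (_ , e)) = ⊥-elim (b≢v e)
  ... | inj₂ (inj₂ (e , _)) = ⊥-elim (ne Au Bv e)
  go : ⊥
  go with Sᴬ.other-a u u | Sᴮ.other-a v v
  ... | a′ , Aa′ , a′≢u , _ | b′ , Bb′ , b′≢v , _ with Sᴬ.other-a u a′ | Sᴮ.other-a v b′
  ... | a″ , Aa″ , a″≢u , a″≢a′ | b″ , Bb″ , b″≢v , b″≢b′ =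
    T′.no-three-attachments {S = a″ ∷ v ∷ []}
      (A′.spot (F′.square {u} {b′} {a′} {b″} (ub Bb′ b′≢v) (~-sym′ (ab Aa′ Bb′ a′≢u)) (ab Aa′ Bb″ a′≢u) (~-sym′ (ub Bb″ b″≢v)) (≢-sym a′≢u) (≢-sym b″≢b′)
          (λ e → Sᴬ.A-stable Au Aa′ (sub e)) (λ e → Sᴬ.B-stable Bb′ Bb″ (sub e)))
        (there (here refl)) (there (there (there (here refl)))) (there (there (here refl))) (≢-sym b″≢b′) (λ e → ne Aa′ Bb′ (sym e)) (λ e → ne Aa′ Bb″ (sym e)))
      (T′.attaches (G′.conn-cons (G′.conn-single v) (here refl) (ab Aa″ Bv a″≢u)) of' (here (ab Aa″ Bb′ a″≢u)) (here (ab Aa″ Bb″ a″≢u)) (there (here (~-sym′ (ab Aa′ Bv a′≢u)))) at)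
    where
    of' : ∀ {x} → x ∈ a″ ∷ v ∷ [] → x ∉ u ∷ b′ ∷ a′ ∷ b″ ∷ []
    of' (here refl) (here e) = a″≢u e
    of' (here refl) (there (here e)) = ne Aa″ Bb′ e
    of' (here refl) (there (there (here e))) = a″≢a′ e
    of' (here refl) (there (there (there (here e)))) = ne Aa″ Bb″ e
    of' (there (here refl)) (here e) = ne Au Bv (sym e)
    of' (there (here refl)) (there (here e)) = b′≢v (sym e)
    of' (there (here refl)) (there (there (here e))) = ne Aa′ Bv (sym e)
    of' (there (here refl)) (there (there (there (here e)))) = b″≢v (sym e)
    at : ∀ {x q} → x ∈ a″ ∷ v ∷ [] → q ∈ u ∷ b′ ∷ a′ ∷ b″ ∷ [] → x G′.~ q → q ≡ b′ ⊎ q ≡ b″ ⊎ q ≡ a′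
    at _ (there (here e)) _ = inj₁ e
    at _ (there (there (here e))) _ = inj₂ (inj₂ e)
    at _ (there (there (there (here e)))) _ = inj₂ (inj₁ e)
    at (here refl) (here refl) f = ⊥-elim (Sᴬ.A-stable Aa″ Au (sub f))
    at (there (here refl)) (here refl) f = ⊥-elim (gone (~-sym′ f))

-- Choosing between the five outcomes

module Main {n : ℕ} (G : Trigraph n) (free : ISK4WheelFree G) (4≤n : 4 ≤ n) where
  open Realizations G
  open Graph R full-graph

  private
    noISK4 : ¬ HasISK4 R
    noISK4 = proj₁ (free R full-realization)

    noWheel : ¬ HasWheel R
    noWheel = proj₂ (free R full-realization)

  open Flags R full-graph noISK4 noWheel using (K33; module K33)
  open Bipartite R full-graph noISK4 noWheel using (InA; inA?; k33-swap; module Side)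

  Conn₃ : Set
  Conn₃ = ∀ a b {u w} → u ≢ a → u ≢ b → w ≢ a → w ≢ b → Reach R (avoid a b) u w

  Conn△ : Set
  Conn△ = ∀ {a b c u w} → a ~ b → a ~ c → b ~ c → avoid₃ a b c u ≡ true → avoid₃ a b c w ≡ true → Reach R (avoid₃ a b c) u w

  -- The two deleted vertices may coincide, and a single vertex is a strong clique. For distinct a
  -- and b the value of θ decides: a strongly adjacent pair is a clique-cutset, and any other pair
  -- is stable.
  conn₃-or-cutset : Conn₃ ⊎ HasCliqueCutset G ⊎ HasStable2Cutset G
  conn₃-or-cutset with F.any? (λ a → F.any? (λ b → disconnected? R (avoid a b)))
  ... | no none = inj₁ λ a b ua ub wa wb → connected (λ d → none (a , b , d)) _ _ (avoid⁺ ua ub) (avoid⁺ wa wb)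
  ... | yes (a , b , d) with a F.≟ b
  ... | yes refl = inj₂ (inj₁ ((λ x → (x == a) ∨ (x == a)) , clq , d))
    where
    is-a : ∀ {u} → (u == a) ∨ (u == a) ≡ true → u ≡ a
    is-a {u} p = [ ==⁻ {i = u} , ==⁻ {i = u} ]′ (∨-true⁻ (u == a) p)
    clq : ∀ u v → (u == a) ∨ (u == a) ≡ true → (v == a) ∨ (v == a) ≡ true → u ≢ v → θ G u v ≡ strong
    clq u v p q ne = ⊥-elim (ne (trans (is-a {u} p) (sym (is-a {v} q))))
  ... | no ne with θ G a b in eq
  ... | anti = inj₂ (inj₂ (a , b , ne , (λ e → case (trans (sym eq) e)) , d))
    where
    case : anti ≡ strong → ⊥
    case ()
  ... | semi = inj₂ (inj₂ (a , b , ne , (λ e → case (trans (sym eq) e)) , d))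
    where
    case : semi ≡ strong → ⊥
    case ()
  ... | strong = inj₂ (inj₁ ((λ x → (x == a) ∨ (x == b)) , clq , d))
    where
    which : ∀ {u} → (u == a) ∨ (u == b) ≡ true → u ≡ a ⊎ u ≡ b
    which {u} p with ∨-true⁻ (u == a) p
    ... | inj₁ q = inj₁ (==⁻ {i = u} q)
    ... | inj₂ q = inj₂ (==⁻ {i = u} q)
    clq : ∀ u v → (u == a) ∨ (u == b) ≡ true → (v == a) ∨ (v == b) ≡ true → u ≢ v → θ G u v ≡ strong
    clq u v p q ne with which {u} p | which {v} q
    ... | inj₁ refl | inj₁ refl = ⊥-elim (ne refl)
    ... | inj₂ refl | inj₂ refl = ⊥-elim (ne refl)
    ... | inj₁ refl | inj₂ refl = eq
    ... | inj₂ refl | inj₁ refl = trans (θ-sym G u v) eq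

  Stable₃ : V → V → V → Set
  Stable₃ a b c = (a ≢ b) × (a ≢ c) × (b ≢ c) × (¬ a ~ b) × (¬ a ~ c) × (¬ b ~ c)

  stable₃? : ∀ a b c → Dec (Stable₃ a b c)
  stable₃? a b c = ¬? (a F.≟ b) ×-dec (¬? (a F.≟ c) ×-dec (¬? (b F.≟ c) ×-dec (¬? (a ~? b) ×-dec (¬? (a ~? c) ×-dec ¬? (b ~? c)))))

  Sees₃ : V → V → V → V → Set
  Sees₃ a b c d = (a ~ b) × (a ~ c) × (a ~ d)

  sees₃? : ∀ a b c d → Dec (Sees₃ a b c d)
  sees₃? a b c d = (a ~? b) ×-dec ((a ~? c) ×-dec (a ~? d))

  k33? : Dec K33
  k33? with F.any? (λ a₁ → F.any? (λ a₂ → F.any? (λ a₃ → F.any? (λ b₁ → F.any? (λ b₂ → F.any? (λ b₃ →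
    stable₃? a₁ a₂ a₃ ×-dec (stable₃? b₁ b₂ b₃ ×-dec (sees₃? a₁ b₁ b₂ b₃ ×-dec (sees₃? a₂ b₁ b₂ b₃ ×-dec sees₃? a₃ b₁ b₂ b₃)))))))))
  ... | yes (a₁ , a₂ , a₃ , b₁ , b₂ , b₃ , (p₁ , p₂ , p₃ , p₄ , p₅ , p₆) , (q₁ , q₂ , q₃ , q₄ , q₅ , q₆) , (r₁ , r₂ , r₃) , (s₁ , s₂ , s₃) , (t₁ , t₂ , t₃)) =
    yes record { a₁ = a₁ ; a₂ = a₂ ; a₃ = a₃ ; b₁ = b₁ ; b₂ = b₂ ; b₃ = b₃ ; a₁₂ = p₁ ; a₁₃ = p₂ ; a₂₃ = p₃ ; ¬a₁₂ = p₄ ; ¬a₁₃ = p₅ ; ¬a₂₃ = p₆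
      ; b₁₂ = q₁ ; b₁₃ = q₂ ; b₂₃ = q₃ ; ¬b₁₂ = q₄ ; ¬b₁₃ = q₅ ; ¬b₂₃ = q₆ ; e₁₁ = r₁ ; e₁₂ = r₂ ; e₁₃ = r₃ ; e₂₁ = s₁ ; e₂₂ = s₂ ; e₂₃ = s₃ ; e₃₁ = t₁ ; e₃₂ = t₂ ; e₃₃ = t₃ }
  ... | no none = no λ k → let open K33 k in none (a₁ , a₂ , a₃ , b₁ , b₂ , b₃ , (a₁₂ , a₁₃ , a₂₃ , ¬a₁₂ , ¬a₁₃ , ¬a₂₃) , (b₁₂ , b₁₃ , b₂₃ , ¬b₁₂ , ¬b₁₃ , ¬b₂₃) , (e₁₁ , e₁₂ , e₁₃) , (e₂₁ , e₂₂ , e₂₃) , (e₃₁ , e₃₂ , e₃₃))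

  module Thick (conn₃ : Conn₃) (k : K33) where
    open ThreeConnected R full-graph noISK4 noWheel 4≤n conn₃ using (thin; cover)
    module Sᴬ = Side thin k
    module Sᴮ = Side thin (k33-swap k)
    open Sᴬ using (A; B)
    open K33 k

    not-semi : ∀ {u v} → A u → B v → θ G u v ≢ semi
    not-semi {u} {v} Au Bv s = soft-bipartite-⊥ R full-graph noISK4 noWheel thin k R′ graph′ (proj₁ fr) (proj₂ fr) sub keep gone Au Bv
      where
      open Remove u v
      fr = free R′ (realization s)

    colour : V → Bool
    colour u = ⌊ inA? k u ⌋

    in-A : ∀ {u} → colour u ≡ true → A u
    in-A {u} = isYes⁻ {d = inA? k u}

    in-B : ∀ {u} → colour u ≡ false → B u
    in-B {u} e with cover k u
    ... | inj₁ p = ⊥-elim (true≢false (isYes⁺ {d = inA? k u} p) e)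
    ... | inj₂ p = p

    colour-B : ∀ {u} → B u → compl colour u ≡ true
    colour-B {u} Bu = not-true⁺ (λ e → Sᴬ.AB-disjoint (in-A {u} e) Bu)

    thick : ThickCompleteBipartite G
    thick = colour , same , cross ,
      count≥3 colour {a₁} {a₂} {a₃} a₁₂ a₁₃ a₂₃ (isYes⁺ {d = inA? k a₁} Sᴬ.a₁A) (isYes⁺ {d = inA? k a₂} Sᴬ.a₂A) (isYes⁺ {d = inA? k a₃} Sᴬ.a₃A) ,
      count≥3 (compl colour) {b₁} {b₂} {b₃} b₁₂ b₁₃ b₂₃ (colour-B Sᴬ.b₁B) (colour-B Sᴬ.b₂B) (colour-B Sᴬ.b₃B)
      where
      same : ∀ u v → u ≢ v → colour u ≡ colour v → θ G u v ≡ anti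
      same u v ne e with colour u in eu
      ... | true = false⇒anti ne (Sᴬ.A-stable (in-A {u} eu) (in-A {v} (sym e)))
      ... | false = false⇒anti ne (Sᴬ.B-stable (in-B {u} eu) (in-B {v} (sym e)))
      cross : ∀ u v → colour u ≡ true → colour v ≡ false → θ G u v ≡ strong
      cross u v eu ev = true⇒strong (Sᴬ.complete (in-A {u} eu) (in-B {v} ev)) (not-semi (in-A {u} eu) (in-B {v} ev))

  module NoK33 (conn₃ : Conn₃) (noK33 : ¬ K33) where
    open ThreeConnected R full-graph noISK4 noWheel 4≤n conn₃ using (thin; claw-free; fourth; another)

    triangle-strong : ∀ {a b c} → a ~ b → a ~ c → b ~ c → θ G a b ≡ strong
    triangle-strong {a} {b} {c} ab ac bc = true⇒strong ab soft
      where
      open Remove a b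
      soft : θ G a b ≢ semi
      soft s = SoftTriangle.impossible R full-graph noISK4 noWheel 4≤n conn₃ noK33 R′ graph′ (proj₁ (free R′ (realization s))) (proj₂ (free R′ (realization s))) ab ac bc sub keep gone

    -- The triangles were shown to be strong, so one whose removal disconnects the graph is a
    -- clique-cutset of the trigraph itself, not only of its full realization.
    conn△-or-cutset : Conn△ ⊎ HasCliqueCutset G
    conn△-or-cutset with F.any? (λ a → F.any? (λ b → F.any? (λ c → (a ~? b) ×-dec ((a ~? c) ×-dec ((b ~? c) ×-dec disconnected? R (avoid₃ a b c))))))
    ... | no none = inj₁ λ {a} {b} {c} ab ac bc pu pw → connected (λ d → none (a , b , c , ab , ac , bc , d)) _ _ pu pw
    ... | yes (a , b , c , ab , ac , bc , d) = inj₂ (C , clq , d)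
      where
      C : V → Bool
      C x = (x == a) ∨ (x == b) ∨ (x == c)
      which : ∀ {u} → C u ≡ true → u ≡ a ⊎ u ≡ b ⊎ u ≡ c
      which {u} p with ∨-true⁻ (u == a) p
      ... | inj₁ q = inj₁ (==⁻ {i = u} q)
      ... | inj₂ q with ∨-true⁻ (u == b) q
      ... | inj₁ r = inj₂ (inj₁ (==⁻ {i = u} r))
      ... | inj₂ r = inj₂ (inj₂ (==⁻ {i = u} r))
      clq : ∀ u v → C u ≡ true → C v ≡ true → u ≢ v → θ G u v ≡ strong
      clq u v p q ne with which {u} p | which {v} q
      ... | inj₁ refl | inj₁ refl = ⊥-elim (ne refl)
      ... | inj₁ refl | inj₂ (inj₁ refl) = triangle-strong ab ac bc
      ... | inj₁ refl | inj₂ (inj₂ refl) = triangle-strong ac ab (~-sym bc)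
      ... | inj₂ (inj₁ refl) | inj₁ refl = triangle-strong (~-sym ab) bc ac
      ... | inj₂ (inj₁ refl) | inj₂ (inj₁ refl) = ⊥-elim (ne refl)
      ... | inj₂ (inj₁ refl) | inj₂ (inj₂ refl) = triangle-strong bc (~-sym ab) (~-sym ac)
      ... | inj₂ (inj₂ refl) | inj₁ refl = triangle-strong (~-sym ac) (~-sym bc) ab
      ... | inj₂ (inj₂ refl) | inj₂ (inj₁ refl) = triangle-strong (~-sym bc) (~-sym ac) (~-sym ab)
      ... | inj₂ (inj₂ refl) | inj₂ (inj₂ refl) = ⊥-elim (ne refl)

    tight : Conn△ → Tight R
    tight conn△ = record { isg = full-graph ; noWheel = noWheel ; thin = thin ; claw-free = claw-free noK33 conn△ ; fourth = fourth ; another = another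
      ; conn₃ = conn₃ ; conn△ = conn△ ; v₀ = fromℕ< (ℕ.≤-trans (s≤s z≤n) 4≤n) }

    line : Tight R → LineTrigraphOfC3CChordlessDeg3 G
    line t = go (Cliques.system R full-graph thin)
      where
      go : CliqueSystem R → LineTrigraphOfC3CChordlessDeg3 G
      go C = CliqueSystem.m C , LG.root , LG.isGraph-root , LG.cyclically-3-connected , LG.chordless , LG.max-degree , LG.is-line-graph ,
          λ u v w uv vw uw → triangle-strong uv uw vw , triangle-strong vw (~-sym uv) (~-sym uw) , triangle-strong uw uv (~-sym vw)
        where module LG = LineGraph R t C (TwoEnds.ends R t C)

  decompose : SeriesParallel G ⊎ ThickCompleteBipartite G ⊎ LineTrigraphOfC3CChordlessDeg3 G ⊎ HasCliqueCutset G ⊎ HasStable2Cutset G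
  decompose with conn₃-or-cutset
  ... | inj₂ cut = inj₂ (inj₂ (inj₂ cut))
  ... | inj₁ conn₃ with k33?
  ... | yes k = inj₂ (inj₁ (Thick.thick conn₃ k))
  ... | no noK33 with NoK33.conn△-or-cutset conn₃ noK33
  ... | inj₂ cut = inj₂ (inj₂ (inj₂ (inj₁ cut)))
  ... | inj₁ conn△ = inj₂ (inj₂ (inj₁ (NoK33.line conn₃ noK33 (NoK33.tight conn₃ noK33 conn△))))

theorem4p19 : {n : ℕ} (G : Trigraph n) → ISK4WheelFree G →
    SeriesParallel G ⊎ ThickCompleteBipartite G ⊎ LineTrigraphOfC3CChordlessDeg3 G ⊎
    HasCliqueCutset G ⊎ HasStable2Cutset G
theorem4p19 {n} G free with 4 ℕ.≤? n
... | yes 4≤n = Main.decompose G free 4≤n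
... | no n<4 = inj₁ (small-seriesParallel G n<4)
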